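{- Let $p$ be a sufficiently large prime and let $k \geq 4$ be even. Let $\Psi$ be a $2\times k$ system of linear equations over $\mathbb{F}_p$ such that $s(\Psi)=k-1$. Let $m\ge 2$ and $t\geq k$. If $\Psi'$ is an $m\times t$ system of linear equations over $\mathbb{F}_p$ that has $s(\Psi') = k-1$ and that contains $\Psi$, then $\Psi'$ is uncommon.
   Context: An $m\times t$ system $\Psi$ is a system of $m$ homogeneous linear equations in $t$ variables, given by an $m\times t$ matrix $M_\Psi$ over $\mathbb{F}_p$ of full rank $m$, with $t>m$. For $n\ge1$, $\mathrm{sol}(\Psi;\mathbb{F}_p^n)$ is the set of $x=(x_1,\dots,x_t)\in(\mathbb{F}_p^n)^t$ with $M_\Psi x=0$ (each equation applied coordinatewise). For $f:\mathbb{F}_p^n\to\mathbb{C}$, $T_\Psi(f)=\mathbb{E}_{x\in \mathrm{sol}(\Psi;\mathbb{F}_p^n)} f(x_1)\cdots f(x_t)$ (normalised average). The length of an equation is its number of nonzero coefficients; $s(\Psi)$ is the minimum length of a nonzero equation in the row space of $M_\Psi$ (the shortest equation contained in $\Psi$). A $t$-variable system $\Psi'$ is common if for every $n\ge1$ and every $f:\mathbb{F}_p^n\to[0,1]$ one has $T_{\Psi'}(f)+T_{\Psi'}(1-f)\ge 2^{1-t}$, and uncommon otherwise. A $t$-variable system $\Psi'$ contains a $k$-variable system $\Psi$ if there is a set $B$ of $k$ of the variables of $\Psi'$ (with an identification of $B$ with the variables of $\Psi$) such that for every $n$, every solution of $\Psi'$ restricts on the variables in $B$ to a solution of $\Psi$.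 -}

module Defs where

open import Data.Nat as ℕ using (ℕ; zero; suc; NonZero; _%_)
open import Data.Nat.Properties using (_≟_)
open import Data.Integer using (+_)
open import Data.Rational using (ℚ; 0ℚ; 1ℚ; _/_; _+_; _*_; _-_; _≤_; _<_)
open import Data.Fin using (Fin; toℕ)
open import Data.Fin.Properties using (all?)
open import Data.Vec.Functional using (_∷_)
open import Data.Product using (Σ; ∃; _×_; _,_)
open import Relation.Nullary using (¬_; Dec; yes; no)
open import Relation.Binary.PropositionalEquality using (_≡_; _≢_)
open import Function.Definitions using (Injective)

-- Elements of 𝔽_p are represented by Fin p (residues 0..p-1); arithmetic is
-- done in ℕ and reduced mod p.

sumℕ : ∀ k → (Fin k → ℕ) → ℕ
sumℕ zero    g = 0
sumℕ (suc k) g = g Fin.zero ℕ.+ sumℕ k (λ i → g (Fin.suc i))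
  where import Data.Fin as Fin

SumOver : Set → Set → Set
SumOver R B = (B → R) → R

sumFin : ∀ k → SumOver ℚ (Fin k)
sumFin zero    g = 0ℚ
sumFin (suc k) g = g Fin.zero + sumFin k (λ i → g (Fin.suc i))
  where import Data.Fin as Fin

sumFinℕ : ∀ k → SumOver ℕ (Fin k)
sumFinℕ = sumℕ

sumPi : ∀ {R B : Set} k → SumOver R B → SumOver R (Fin k → B)
sumPi zero    sB g = g (λ ())
sumPi (suc k) sB g = sB (λ b → sumPi k sB (λ h → g (b ∷ h)))

prodFin : ∀ k → (Fin k → ℚ) → ℚ
prodFin zero    g = 1ℚ
prodFin (suc k) g = g Fin.zero * prodFin k (λ i → g (Fin.suc i))
  where import Data.Fin as Fin

Matrix : ℕ → ℕ → ℕ → Set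
Matrix p m t = Fin m → Fin t → Fin p

Vecp : ℕ → ℕ → Set
Vecp p n = Fin n → Fin p

module _ {p : ℕ} .{{_ : NonZero p}} where

  evalEq : ∀ {m t n} → Matrix p m t → (Fin t → Vecp p n) → Fin m → Fin n → ℕ
  evalEq {t = t} M x i l = sumℕ t (λ j → toℕ (M i j) ℕ.* toℕ (x j l)) % p

  IsSol : ∀ {m t n} → Matrix p m t → (Fin t → Vecp p n) → Set
  IsSol M x = ∀ i l → evalEq M x i l ≡ 0

  isSol? : ∀ {m t n} (M : Matrix p m t) (x : Fin t → Vecp p n) → Dec (IsSol M x)
  isSol? M x = all? (λ i → all? (λ l → evalEq M x i l ≟ 0))

  ind : ∀ {m t n} (M : Matrix p m t) (x : Fin t → Vecp p n) → ℚ
  ind M x with isSol? M x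
  ... | yes _ = 1ℚ
  ... | no  _ = 0ℚ

  indℕ : ∀ {m t n} (M : Matrix p m t) (x : Fin t → Vecp p n) → ℕ
  indℕ M x with isSol? M x
  ... | yes _ = 1
  ... | no  _ = 0

  numSols : ∀ {m t} n → Matrix p m t → ℕ
  numSols {t = t} n M = sumPi t (sumPi n (sumFinℕ p)) (indℕ M)

  -- normalised average s / c (c ≥ 1 always, as 0 is a solution)
  avg : ℚ → ℕ → ℚ
  avg s zero    = 0ℚ
  avg s (suc c) = s * (+ 1 / suc c)

  TΨ : ∀ {m t} n → Matrix p m t → (Vecp p n → ℚ) → ℚ
  TΨ {t = t} n M f =
    avg (sumPi t (sumPi n (sumFin p)) (λ x → ind M x * prodFin t (λ j → f (x j))))
        (numSols n M)

  combo : ∀ {m t} → Matrix p m t → (Fin m → Fin p) → Fin t → ℕ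
  combo {m} M c j = sumℕ m (λ i → toℕ (c i) ℕ.* toℕ (M i j)) % p

  FullRank : ∀ {m t} → Matrix p m t → Set
  FullRank M = ∀ c → (∀ j → combo M c j ≡ 0) → ∀ i → toℕ (c i) ≡ 0

  IsSystem : ∀ m t → Matrix p m t → Set
  IsSystem m t M = FullRank M × m ℕ.< t

  eqLength : ∀ {t} → (Fin t → ℕ) → ℕ
  eqLength {t} v = sumℕ t (λ j → nz (v j))
    where
      nz : ℕ → ℕ
      nz zero    = 0
      nz (suc _) = 1

  NonzeroEq : ∀ {t} → (Fin t → ℕ) → Set
  NonzeroEq {t} v = ∃ λ (j : Fin t) → v j ≢ 0

  ShortestEq : ∀ {m t} → Matrix p m t → ℕ → Set
  ShortestEq M s =
    (∀ c → NonzeroEq (combo M c) → s ℕ.≤ eqLength (combo M c))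
    × (∃ λ c → NonzeroEq (combo M c) × eqLength (combo M c) ≡ s)

  Contains : ∀ {m' t m k} → Matrix p m' t → Matrix p m k → Set
  Contains {t = t} {k = k} M' M =
    Σ (Fin k → Fin t) λ B → Injective _≡_ _≡_ B ×
      (∀ n (x : Fin t → Vecp p n) → IsSol M' x → IsSol M (λ j → x (B j)))

  halfPow : ℕ → ℚ
  halfPow zero    = 1ℚ
  halfPow (suc e) = (+ 1 / 2) * halfPow e

  Common : ∀ {m t} → Matrix p m t → Set
  Common {t = t} M = ∀ n (f : Vecp p n → ℚ) → (∀ v → 0ℚ ≤ f v × f v ≤ 1ℚ) →
    halfPow (t ℕ.∸ 1) ≤ TΨ n M f + TΨ n M (λ v → 1ℚ - f v)

  Uncommon : ∀ {m t} → Matrix p m t → Set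
  Uncommon {t = t} M = ∃ λ n → Σ (Vecp p n → ℚ) λ f → (∀ v → 0ℚ ≤ f v × f v ≤ 1ℚ) ×
    TΨ n M f + TΨ n M (λ v → 1ℚ - f v) < halfPow (t ℕ.∸ 1)

{-# OPTIONS --safe #-}
-- Write 2f = 1 + εg and expand both averages over subsets S of the variables. Since every equation of Ψ' has
-- length at least k - 1, the sets S with 0 < |S| < k - 1 contribute nothing when g has mean zero, and those of
-- odd size cancel; so for small ε only the sets of size k matter, and g has to make their total negative.
--
-- Let w be the sum of the nontrivial characters of 𝔽_p and v_0, …, v_{k-1} ∈ 𝔽_p² the columns of Ψ, which are
-- pairwise independent. On 𝔽_p^{2+ρ} take g = -Y·w(ℓ) + Σ w(ℓ_{a,i}), where ℓ is the linear form with vector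
-- (v_0 ; 0) and ℓ_{a,i}, for a < ρ and 0 < i < k, the one with vector (v_i ; det(v_0,v_i) e_a). The forms of the
-- a-th petal {ℓ, ℓ_{a,1}, …, ℓ_{a,k-1}} span a plane, and no other plane contains three of all these forms. Hence
-- an assignment of the forms to the variables in S contributes only if it is constant, or bijects S with a petal.
-- The latter use ℓ exactly once and contribute at most -Y, at least ρ times in total, as Ψ' contains Ψ; the
-- former contribute O(Y^k) + O(ρ). So first Y and then ρ are chosen large, and finally ε small.
module Submission where

-- What an assignment contributes is settled by a duality. Either some solution of Ψ' moves one
-- chosen form by 1 and fixes all the others, and then averaging `w` in that direction gives zero;
-- or the forms satisfy a linear relation on the solutions. Contracting such a relation with a
-- covector θ gives one equation of Ψ', whose coefficient at a variable is the multiplier times the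
-- value of θ at its form. With k active variables, a θ that kills two coefficients but not a third
-- would give a nonzero equation of length at most k - 2, so the classification comes down to
-- finding suitable covectors. Sharing ℓ among all petals is what makes the weights work: a petal
-- contains ℓ once, at a gain linear in Y, whereas the constant assignment to ℓ costs a power of Y
-- that does not grow with ρ, so many petals outweigh it. The constant assignments to the ℓ_{a,i} do
-- grow with ρ, but at a rate independent of Y, so Y outweighs those. No complex characters appear:
-- `w` is P·[y = 0] - 1, and translations along solutions replace Fourier inversion, so all
-- quantities stay rational.

module Development where

  open import Defs
  open import Data.Nat as ℕ using (ℕ; zero; suc; NonZero; z≤n; s≤s; _%_)
  import Data.Nat.Properties as ℕP
  import Data.Nat.DivMod as DM
  open import Data.Nat.Primality using (Prime; prime⇒nonTrivial)
  import Data.Nat.Coprimality as Cop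
  open import Data.Nat.GCD using (module Bézout)
  import Data.Nat.Solver
  import Data.Integer as ℤ
  import Data.Integer.Properties as ℤP
  open import Data.Rational hiding (NonZero)
  open import Data.Rational.Properties hiding (1≢0)
  import Data.Rational.Unnormalised as ℚᵘ
  import Data.Rational.Unnormalised.Properties as ℚᵘP
  open import Data.Rational.Solver
  open import Data.Bool using (Bool; true; false)
  open import Data.Maybe using (Maybe; just; nothing)
  open import Data.Fin as Fin using (Fin; zero; suc; toℕ)
  import Data.Fin.Properties as FinP
  open import Data.Fin.Permutation using (permutation)
  open import Data.List using (List; []; _∷_; _++_; map; concatMap; allFin; cartesianProduct)
  import Data.List.Properties as ListP
  open import Data.List.Relation.Unary.All as All using (All; []; _∷_)
  import Data.List.Membership.Propositional.Properties as ∈P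
  open import Data.Vec.Functional using () renaming (_∷_ to _∷ᶠ_)
  open import Data.Product using (Σ; ∃; _×_; _,_; proj₁; proj₂)
  open import Data.Sum using (_⊎_; inj₁; inj₂)
  open import Relation.Nullary using (¬_; Dec; yes; no; contradiction; ¬?)
  open import Relation.Nullary.Decidable using (decidable-stable; _×-dec_)
  open import Relation.Binary.Definitions using (tri<; tri≈; tri>)
  open import Relation.Binary.PropositionalEquality
  open import Function using (_∘_)
  open import Function.Definitions using (Injective)
  open import Algebra.Bundles using (CommutativeRing; RawRing)
  open import Algebra.Structures using (IsCommutativeRing)
  import Algebra.Properties.CommutativeMonoid.Sum as MonoidSum
  import Algebra.Solver.Ring as RingSolver
  import Algebra.Solver.Ring.AlmostCommutativeRing as ACR

  -- Sums and products over finite types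

  module ℚS = +-*-Solver

  sumL : {B : Set} → List B → (B → ℚ) → ℚ
  sumL []       g = 0ℚ
  sumL (b ∷ bs) g = g b + sumL bs g

  sumL-cong : ∀ {B : Set} (bs : List B) {g h} → (∀ b → g b ≡ h b) → sumL bs g ≡ sumL bs h
  sumL-cong []       e = refl
  sumL-cong (b ∷ bs) e = cong₂ _+_ (e b) (sumL-cong bs e)

  sumL-+ : ∀ {B : Set} (bs : List B) g h → sumL bs (λ b → g b + h b) ≡ sumL bs g + sumL bs h
  sumL-+ []       g h = refl
  sumL-+ (b ∷ bs) g h rewrite sumL-+ bs g h =
    ℚS.solve 4 (λ a b c d → (a ℚS.:+ b) ℚS.:+ (c ℚS.:+ d) ℚS.:= (a ℚS.:+ c) ℚS.:+ (b ℚS.:+ d)) refl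
      (g b) (h b) (sumL bs g) (sumL bs h)

  sumL-* : ∀ {B : Set} (bs : List B) c g → sumL bs (λ b → c * g b) ≡ c * sumL bs g
  sumL-* []       c g = sym (*-zeroʳ c)
  sumL-* (b ∷ bs) c g rewrite sumL-* bs c g = sym (*-distribˡ-+ c (g b) (sumL bs g))

  sumL-mono : ∀ {B : Set} (bs : List B) {g h} → (∀ b → g b ≤ h b) → sumL bs g ≤ sumL bs h
  sumL-mono []       e = ≤-refl
  sumL-mono (b ∷ bs) e = +-mono-≤ (e b) (sumL-mono bs e)

  sumL-0 : ∀ {B : Set} (bs : List B) → sumL bs (λ _ → 0ℚ) ≡ 0ℚ
  sumL-0 []       = refl
  sumL-0 (b ∷ bs) = trans (+-identityˡ _) (sumL-0 bs)

  sumL-swap : ∀ {B C : Set} (bs : List B) (cs : List C) (g : B → C → ℚ) →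
    sumL bs (λ b → sumL cs (g b)) ≡ sumL cs (λ c → sumL bs (λ b → g b c))
  sumL-swap []       cs g = sym (sumL-0 cs)
  sumL-swap (b ∷ bs) cs g = trans (cong (sumL cs (g b) +_) (sumL-swap bs cs g)) (sym (sumL-+ cs (g b) _))

  sumL-++ : ∀ {B : Set} (bs cs : List B) g → sumL (bs ++ cs) g ≡ sumL bs g + sumL cs g
  sumL-++ []       cs g = sym (+-identityˡ _)
  sumL-++ (b ∷ bs) cs g = trans (cong (g b +_) (sumL-++ bs cs g)) (sym (+-assoc (g b) (sumL bs g) (sumL cs g)))

  sumL-map : ∀ {B C : Set} (f : B → C) (bs : List B) g → sumL (map f bs) g ≡ sumL bs (g ∘ f)
  sumL-map f []       g = refl
  sumL-map f (b ∷ bs) g = cong (g (f b) +_) (sumL-map f bs g)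

  sumL-concatMap : ∀ {B C : Set} (f : B → List C) (bs : List B) g →
    sumL (concatMap f bs) g ≡ sumL bs (λ b → sumL (f b) g)
  sumL-concatMap f []       g = refl
  sumL-concatMap f (b ∷ bs) g =
    trans (sumL-++ (f b) (concatMap f bs) g) (cong (sumL (f b) g +_) (sumL-concatMap f bs g))

  -- The sums of the statement are bare operators. Tying an operator to a list gives linearity,
  -- monotonicity and exchange of summation for all of them at once, and the property passes through
  -- `sumPi`.
  record Finite {B : Set} (s : SumOver ℚ B) : Set where
    constructor finite
    field
      elems : List B
      eq    : ∀ g → s g ≡ sumL elems g

  open Finite {{...}}

  sum-cong : ∀ {B} (s : SumOver ℚ B) {{_ : Finite s}} {g h} → (∀ b → g b ≡ h b) → s g ≡ s h
  sum-cong s {g} {h} e = trans (eq g) (trans (sumL-cong elems e) (sym (eq h)))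

  sum-+ : ∀ {B} (s : SumOver ℚ B) {{_ : Finite s}} g h → s (λ b → g b + h b) ≡ s g + s h
  sum-+ s g h = trans (eq _) (trans (sumL-+ elems g h) (sym (cong₂ _+_ (eq g) (eq h))))

  sum-* : ∀ {B} (s : SumOver ℚ B) {{_ : Finite s}} c g → s (λ b → c * g b) ≡ c * s g
  sum-* s c g = trans (eq _) (trans (sumL-* elems c g) (sym (cong (c *_) (eq g))))

  sum-mono : ∀ {B} (s : SumOver ℚ B) {{_ : Finite s}} {g h} → (∀ b → g b ≤ h b) → s g ≤ s h
  sum-mono s {g} {h} e = subst₂ _≤_ (sym (eq g)) (sym (eq h)) (sumL-mono elems e)

  sum-0 : ∀ {B} (s : SumOver ℚ B) {{_ : Finite s}} → s (λ _ → 0ℚ) ≡ 0ℚ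
  sum-0 s = trans (eq _) (sumL-0 elems)

  sum-swap : ∀ {B C} (s : SumOver ℚ B) {{_ : Finite s}} (r : SumOver ℚ C) {{_ : Finite r}} (g : B → C → ℚ) →
    s (λ b → r (g b)) ≡ r (λ c → s (λ b → g b c))
  sum-swap s r g = begin
    s (λ b → r (g b))                           ≡⟨ sum-cong s (λ b → eq (g b)) ⟩
    s (λ b → sumL (elems {s = r}) (g b))        ≡⟨ eq _ ⟩
    sumL (elems {s = s}) (λ b → sumL elems (g b))         ≡⟨ sumL-swap (elems {s = s}) (elems {s = r}) g ⟩
    sumL (elems {s = r}) (λ c → sumL elems (λ b → g b c)) ≡⟨ sym (eq _) ⟩
    r (λ c → sumL (elems {s = s}) (λ b → g b c)) ≡⟨ sym (sum-cong r (λ c → eq _)) ⟩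
    r (λ c → s (λ b → g b c)) ∎
    where open ≡-Reasoning

  sumL-abs : ∀ {B : Set} (bs : List B) g → ∣ sumL bs g ∣ ≤ sumL bs (λ b → ∣ g b ∣)
  sumL-abs []       g = ≤-refl
  sumL-abs (b ∷ bs) g = ≤-trans (∣p+q∣≤∣p∣+∣q∣ (g b) (sumL bs g)) (+-monoʳ-≤ ∣ g b ∣ (sumL-abs bs g))

  sum-abs : ∀ {B} (s : SumOver ℚ B) {{_ : Finite s}} g → ∣ s g ∣ ≤ s (λ b → ∣ g b ∣)
  sum-abs s g = subst₂ _≤_ (cong ∣_∣ (sym (eq g))) (sym (eq _)) (sumL-abs elems g)

  sum-nonneg : ∀ {B} (s : SumOver ℚ B) {{_ : Finite s}} {g} → (∀ b → 0ℚ ≤ g b) → 0ℚ ≤ s g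
  sum-nonneg s {g} e = subst (λ z → z ≤ s g) (sum-0 s) (sum-mono s e)

  instance
    finite-sumFin : ∀ {k} → Finite (sumFin k)
    finite-sumFin {k} = finite (allFin k) (go k)
      where
      go : ∀ k g → sumFin k g ≡ sumL (allFin k) g
      go zero    g = refl
      go (suc k) g = cong (g zero +_) (trans (go k (g ∘ suc)) (trans (sym (sumL-map suc (allFin k) g))
        (cong (λ l → sumL l g) (ListP.map-tabulate (λ i → i) suc))))

    finite-sumPi : ∀ {B} {s : SumOver ℚ B} {k} {{_ : Finite s}} → Finite (sumPi k s)
    finite-sumPi {B} {s} {k} = finite (funs k) (go k)
      where
      funs : ∀ k → List (Fin k → B)
      funs zero    = (λ ()) ∷ []
      funs (suc k) = concatMap (λ b → map (b ∷ᶠ_) (funs k)) (elems {s = s})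
      go : ∀ k g → sumPi k s g ≡ sumL (funs k) g
      go zero    g = sym (+-identityʳ _)
      go (suc k) g = begin
        s (λ b → sumPi k s (λ h → g (b ∷ᶠ h)))             ≡⟨ sum-cong s (λ b → go k _) ⟩
        s (λ b → sumL (funs k) (λ h → g (b ∷ᶠ h)))         ≡⟨ eq {s = s} _ ⟩
        sumL (elems {s = s}) (λ b → sumL (funs k) (λ h → g (b ∷ᶠ h)))
          ≡⟨ sumL-cong (elems {s = s}) (λ b → sym (sumL-map (b ∷ᶠ_) (funs k) g)) ⟩
        sumL (elems {s = s}) (λ b → sumL (map (b ∷ᶠ_) (funs k)) g)
          ≡⟨ sym (sumL-concatMap _ (elems {s = s}) g) ⟩
        sumL (funs (suc k)) g ∎
        where open ≡-Reasoning

  prod-cong : ∀ k {f g : Fin k → ℚ} → (∀ j → f j ≡ g j) → prodFin k f ≡ prodFin k g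
  prod-cong zero    e = refl
  prod-cong (suc k) e = cong₂ _*_ (e zero) (prod-cong k (e ∘ suc))

  prod-* : ∀ k (f g : Fin k → ℚ) → prodFin k (λ j → f j * g j) ≡ prodFin k f * prodFin k g
  prod-* zero    f g = refl
  prod-* (suc k) f g rewrite prod-* k (f ∘ suc) (g ∘ suc) =
    ℚS.solve 4 (λ a b c d → (a ℚS.:* b) ℚS.:* (c ℚS.:* d) ℚS.:= (a ℚS.:* c) ℚS.:* (b ℚS.:* d)) refl
      (f zero) (g zero) (prodFin k (f ∘ suc)) (prodFin k (g ∘ suc))

  prod-1 : ∀ k → prodFin k (λ _ → 1ℚ) ≡ 1ℚ
  prod-1 zero    = refl
  prod-1 (suc k) = trans (*-identityˡ _) (prod-1 k)

  -- Distributivity, with one term for each choice function. For `s = sumPt` it turns a solution sum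
  -- into a sum over assignments of forms to variables.
  prod-sum : ∀ {B} (s : SumOver ℚ B) {{_ : Finite s}} k (h : Fin k → B → ℚ) →
    prodFin k (λ j → s (h j)) ≡ sumPi k s (λ α → prodFin k (λ j → h j (α j)))
  prod-sum s zero    h = refl
  prod-sum s (suc k) h = begin
    s (h zero) * prodFin k (λ j → s (h (suc j)))  ≡⟨ cong (s (h zero) *_) (prod-sum s k (h ∘ suc)) ⟩
    s (h zero) * P                                ≡⟨ *-comm (s (h zero)) P ⟩
    P * s (h zero)                                ≡⟨ sym (sum-* s P (h zero)) ⟩
    s (λ b → P * h zero b)                        ≡⟨ sum-cong s (λ b → trans (*-comm P (h zero b)) (sym (sum-* (sumPi k s) (h zero b) _))) ⟩
    sumPi (suc k) s (λ α → prodFin (suc k) (λ j → h j (α j))) ∎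
    where
    open ≡-Reasoning
    P = sumPi k s (λ α → prodFin k (λ j → h (suc j) (α j)))

  -- Deletes the factor `j` by setting it to 1, so that the index set stays `Fin k`.
  mask : ∀ {k} → Fin k → (Fin k → ℚ) → Fin k → ℚ
  mask zero    f zero    = 1ℚ
  mask zero    f (suc i) = f (suc i)
  mask (suc j) f zero    = f zero
  mask (suc j) f (suc i) = mask j (f ∘ suc) i

  prod-extract : ∀ k (j : Fin k) f → prodFin k f ≡ f j * prodFin k (mask j f)
  prod-extract (suc k) zero    f = cong (f zero *_) (sym (*-identityˡ _))
  prod-extract (suc k) (suc j) f rewrite prod-extract k j (f ∘ suc) =
    ℚS.solve 3 (λ a b c → a ℚS.:* (b ℚS.:* c) ℚS.:= b ℚS.:* (a ℚS.:* c)) refl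
      (f zero) (f (suc j)) (prodFin k (mask j (f ∘ suc)))

  mask-same : ∀ {k} (j : Fin k) f → mask j f j ≡ 1ℚ
  mask-same zero    f = refl
  mask-same (suc j) f = mask-same j (f ∘ suc)

  mask-other : ∀ {k} (j i : Fin k) f → i ≢ j → mask j f i ≡ f i
  mask-other zero    zero    f n = contradiction refl n
  mask-other zero    (suc i) f n = refl
  mask-other (suc j) zero    f n = refl
  mask-other (suc j) (suc i) f n = mask-other j i (f ∘ suc) (n ∘ cong suc)

  *-nonneg : ∀ {a b} → 0ℚ ≤ a → 0ℚ ≤ b → 0ℚ ≤ a * b
  *-nonneg {a} {b} p q = nonNegative⁻¹ (a * b) {{nonNeg*nonNeg⇒nonNeg a {{nonNegative p}} b {{nonNegative q}}}}

  *-mono-nonneg : ∀ {a b c d} → 0ℚ ≤ a → a ≤ b → 0ℚ ≤ c → c ≤ d → a * c ≤ b * d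
  *-mono-nonneg {a} {b} {c} {d} a0 ab c0 cd =
    ≤-trans (*-monoʳ-≤-nonNeg c {{nonNegative c0}} ab) (*-monoˡ-≤-nonNeg b {{nonNegative (≤-trans a0 ab)}} cd)

  prod-nonneg : ∀ k {f} → (∀ j → 0ℚ ≤ f j) → 0ℚ ≤ prodFin k f
  prod-nonneg zero    e = nonNegative⁻¹ 1ℚ
  prod-nonneg (suc k) e = *-nonneg (e zero) (prod-nonneg k (e ∘ suc))

  prod-mono : ∀ k {f g} → (∀ j → 0ℚ ≤ f j) → (∀ j → f j ≤ g j) → prodFin k f ≤ prodFin k g
  prod-mono zero    _ e = ≤-refl
  prod-mono (suc k) z e = *-mono-nonneg (z zero) (e zero) (prod-nonneg k (z ∘ suc)) (prod-mono k (z ∘ suc) (e ∘ suc))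

  prod-abs : ∀ k f → ∣ prodFin k f ∣ ≡ prodFin k (λ j → ∣ f j ∣)
  prod-abs zero    f = refl
  prod-abs (suc k) f = trans (∣p*q∣≡∣p∣*∣q∣ (f zero) _) (cong (∣ f zero ∣ *_) (prod-abs k (f ∘ suc)))

  prod-zero : ∀ k {f} j → f j ≡ 0ℚ → prodFin k f ≡ 0ℚ
  prod-zero k {f} j e = trans (prod-extract k j f) (trans (cong (_* prodFin k (mask j f)) e) (*-zeroˡ (prodFin k (mask j f))))

  fromℕ : ℕ → ℚ
  fromℕ zero    = 0ℚ
  fromℕ (suc n) = 1ℚ + fromℕ n

  fromℕ-+ : ∀ a b → fromℕ (a ℕ.+ b) ≡ fromℕ a + fromℕ b
  fromℕ-+ zero    b = sym (+-identityˡ _)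
  fromℕ-+ (suc a) b = trans (cong (1ℚ +_) (fromℕ-+ a b)) (sym (+-assoc 1ℚ (fromℕ a) (fromℕ b)))

  fromℕ-nonneg : ∀ a → 0ℚ ≤ fromℕ a
  fromℕ-nonneg zero    = ≤-refl
  fromℕ-nonneg (suc a) = +-mono-≤ (nonNegative⁻¹ 1ℚ) (fromℕ-nonneg a)

  fromℕ-≡ : ∀ n → fromℕ n ≡ fromℚᵘ (ℚᵘ.mkℚᵘ (ℤ.+ n) 0)
  fromℕ-≡ zero    = refl
  fromℕ-≡ (suc n) = toℚᵘ-injective (begin
    toℚᵘ (1ℚ + fromℕ n)              ≈⟨ toℚᵘ-homo-+ 1ℚ (fromℕ n) ⟩
    toℚᵘ 1ℚ ℚᵘ.+ toℚᵘ (fromℕ n)      ≈⟨ ℚᵘP.+-congʳ (toℚᵘ 1ℚ) (ℚᵘP.≃-trans (ℚᵘP.≃-reflexive (cong toℚᵘ (fromℕ-≡ n))) (toℚᵘ-fromℚᵘ (ℚᵘ.mkℚᵘ (ℤ.+ n) 0))) ⟩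
    toℚᵘ 1ℚ ℚᵘ.+ ℚᵘ.mkℚᵘ (ℤ.+ n) 0     ≈⟨ ℚᵘ.*≡* (cong (ℤ._* ℤ.+ 1) (cong (λ z → ℤ.+ 1 ℤ.+ z) (ℤP.*-identityʳ (ℤ.+ n)))) ⟩
    ℚᵘ.mkℚᵘ (ℤ.+ suc n) 0              ≈⟨ ℚᵘP.≃-sym (toℚᵘ-fromℚᵘ (ℚᵘ.mkℚᵘ (ℤ.+ suc n) 0)) ⟩
    toℚᵘ (fromℚᵘ (ℚᵘ.mkℚᵘ (ℤ.+ suc n) 0)) ∎)
    where open ℚᵘP.≃-Reasoning

  fromℕ-inverse : ∀ c → fromℕ (suc c) * (ℤ.+ 1 / suc c) ≡ 1ℚ
  fromℕ-inverse c = toℚᵘ-injective (begin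
    toℚᵘ (fromℕ (suc c) * (ℤ.+ 1 / suc c))              ≈⟨ toℚᵘ-homo-* (fromℕ (suc c)) (ℤ.+ 1 / suc c) ⟩
    toℚᵘ (fromℕ (suc c)) ℚᵘ.* toℚᵘ (ℤ.+ 1 / suc c)      ≈⟨ ℚᵘP.*-cong (ℚᵘP.≃-trans (ℚᵘP.≃-reflexive (cong toℚᵘ (fromℕ-≡ (suc c)))) (toℚᵘ-fromℚᵘ (ℚᵘ.mkℚᵘ (ℤ.+ suc c) 0))) (toℚᵘ-fromℚᵘ (ℚᵘ.mkℚᵘ (ℤ.+ 1) c)) ⟩
    ℚᵘ.mkℚᵘ (ℤ.+ suc c) 0 ℚᵘ.* ℚᵘ.mkℚᵘ (ℤ.+ 1) c          ≈⟨ ℚᵘ.*≡* (cong (λ z → ℤ.+ suc z) (trans (ℕP.*-identityʳ _) (trans (ℕP.*-identityʳ c) (sym (trans (ℕP.+-identityʳ _) (ℕP.+-identityʳ c)))))) ⟩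
    toℚᵘ 1ℚ ∎)
    where open ℚᵘP.≃-Reasoning

  sumFin-fromℕ : ∀ k g → fromℕ (sumFinℕ k g) ≡ sumFin k (fromℕ ∘ g)
  sumFin-fromℕ zero    g = refl
  sumFin-fromℕ (suc k) g = trans (fromℕ-+ (g zero) _) (cong (fromℕ (g zero) +_) (sumFin-fromℕ k (g ∘ suc)))

  sumPi-fromℕ : ∀ {B : Set} (sℕ : SumOver ℕ B) (s : SumOver ℚ B) {{_ : Finite s}} →
    (∀ g → fromℕ (sℕ g) ≡ s (fromℕ ∘ g)) → ∀ k g → fromℕ (sumPi k sℕ g) ≡ sumPi k s (fromℕ ∘ g)
  sumPi-fromℕ sℕ s e zero    g = refl
  sumPi-fromℕ sℕ s e (suc k) g = trans (e _) (sum-cong s (λ b → sumPi-fromℕ sℕ s e k _))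

  -- `R` stands for pointwise equality of values that are themselves functions: these need not be
  -- propositionally equal, so summands are only asked to respect `R`.
  sumPi-transform : ∀ {B : Set} (R : B → B → Set) → (∀ {b} → R b b) →
    (s : SumOver ℚ B) {{_ : Finite s}} → ∀ k (T : Fin k → B → B) →
    (∀ i F → (∀ {a b} → R a b → F a ≡ F b) → s (λ b → F (T i b)) ≡ s F) →
    ∀ F → (∀ {x y} → (∀ i → R (x i) (y i)) → F x ≡ F y) →
    sumPi k s (λ x → F (λ i → T i (x i))) ≡ sumPi k s F
  sumPi-transform R r s zero    T inv F resp = resp (λ ())
  sumPi-transform R r s (suc k) T inv F resp = begin
    s (λ b → sumPi k s (λ h → F (λ i → T i ((b ∷ᶠ h) i))))
      ≡⟨ sum-cong s (λ b → sum-cong (sumPi k s) (λ h → resp λ { zero → r ; (suc i) → r })) ⟩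
    s (λ b → sumPi k s (λ h → F (T zero b ∷ᶠ (λ i → T (suc i) (h i)))))
      ≡⟨ sum-cong s (λ b → sumPi-transform R r s k (T ∘ suc) (inv ∘ suc) (λ h → F (T zero b ∷ᶠ h))
           (λ e → resp λ { zero → r ; (suc i) → e i })) ⟩
    s (λ b → sumPi k s (λ h → F (T zero b ∷ᶠ h)))
      ≡⟨ inv zero (λ b → sumPi k s (λ h → F (b ∷ᶠ h)))
           (λ e → sum-cong (sumPi k s) (λ h → resp λ { zero → e ; (suc i) → r })) ⟩
    sumPi (suc k) s F ∎
    where open ≡-Reasoning

  -- The prime field

  module NS = Data.Nat.Solver.+-*-Solver

  module Field (p : ℕ) .{{_ : NonZero p}} where

    𝔽 : Set
    𝔽 = Fin p

    ι : ℕ → 𝔽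
    ι a = a DM.mod p

    toℕ-ι : ∀ a → toℕ (ι a) ≡ a % p
    toℕ-ι a = FinP.toℕ-fromℕ< (DM.m%n<n a p)

    ι-cong : ∀ {a b} → a % p ≡ b % p → ι a ≡ ι b
    ι-cong {a} {b} e = FinP.toℕ-injective (trans (toℕ-ι a) (trans e (sym (toℕ-ι b))))

    ι-toℕ : ∀ x → ι (toℕ x) ≡ x
    ι-toℕ x = FinP.toℕ-injective (trans (toℕ-ι (toℕ x)) (DM.m<n⇒m%n≡m (FinP.toℕ<n x)))

    infixl 6 _⊕_
    infixl 7 _⊗_
    infix 8 ⊖_

    0F 1F : 𝔽
    0F = ι 0
    1F = ι 1

    abstract
      _⊕_ _⊗_ : 𝔽 → 𝔽 → 𝔽
      x ⊕ y = ι (toℕ x ℕ.+ toℕ y)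
      x ⊗ y = ι (toℕ x ℕ.* toℕ y)

      ⊖_ : 𝔽 → 𝔽
      ⊖ x = ι (ℕ.pred p ℕ.* toℕ x)

      ⊗-def : ∀ x y → x ⊗ y ≡ ι (toℕ x ℕ.* toℕ y)
      ⊗-def x y = refl

      ι-+ : ∀ a b → ι a ⊕ ι b ≡ ι (a ℕ.+ b)
      ι-+ a b = ι-cong (begin
        (toℕ (ι a) ℕ.+ toℕ (ι b)) % p ≡⟨ cong₂ (λ u v → (u ℕ.+ v) % p) (toℕ-ι a) (toℕ-ι b) ⟩
        (a % p ℕ.+ b % p) % p         ≡⟨ sym (DM.%-distribˡ-+ a b p) ⟩
        (a ℕ.+ b) % p                 ∎)
        where open ≡-Reasoning

      ι-* : ∀ a b → ι a ⊗ ι b ≡ ι (a ℕ.* b)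
      ι-* a b = ι-cong (begin
        (toℕ (ι a) ℕ.* toℕ (ι b)) % p ≡⟨ cong₂ (λ u v → (u ℕ.* v) % p) (toℕ-ι a) (toℕ-ι b) ⟩
        ((a % p) ℕ.* (b % p)) % p     ≡⟨ sym (DM.%-distribˡ-* a b p) ⟩
        (a ℕ.* b) % p                 ∎)
        where open ≡-Reasoning

      ⊕-ι : ∀ x b → x ⊕ ι b ≡ ι (toℕ x ℕ.+ b)
      ⊕-ι x b = trans (cong (_⊕ ι b) (sym (ι-toℕ x))) (ι-+ (toℕ x) b)

      ι-⊕ : ∀ a y → ι a ⊕ y ≡ ι (a ℕ.+ toℕ y)
      ι-⊕ a y = trans (cong (ι a ⊕_) (sym (ι-toℕ y))) (ι-+ a (toℕ y))

      ⊗-ι : ∀ x b → x ⊗ ι b ≡ ι (toℕ x ℕ.* b)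
      ⊗-ι x b = trans (cong (_⊗ ι b) (sym (ι-toℕ x))) (ι-* (toℕ x) b)

      ι-⊗ : ∀ a y → ι a ⊗ y ≡ ι (a ℕ.* toℕ y)
      ι-⊗ a y = trans (cong (ι a ⊗_) (sym (ι-toℕ y))) (ι-* a (toℕ y))

      ⊖-def : ∀ x → ⊖ x ≡ ι (ℕ.pred p) ⊗ x
      ⊖-def x = sym (ι-⊗ (ℕ.pred p) x)

      ⊕-comm : ∀ x y → x ⊕ y ≡ y ⊕ x
      ⊕-comm x y = cong ι (ℕP.+-comm (toℕ x) (toℕ y))

      ⊗-comm : ∀ x y → x ⊗ y ≡ y ⊗ x
      ⊗-comm x y = cong ι (ℕP.*-comm (toℕ x) (toℕ y))

      ⊕-assoc : ∀ x y z → (x ⊕ y) ⊕ z ≡ x ⊕ (y ⊕ z)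
      ⊕-assoc x y z = trans (ι-⊕ _ z) (trans (cong ι (ℕP.+-assoc (toℕ x) (toℕ y) (toℕ z))) (sym (⊕-ι x _)))

      ⊗-assoc : ∀ x y z → (x ⊗ y) ⊗ z ≡ x ⊗ (y ⊗ z)
      ⊗-assoc x y z = trans (ι-⊗ _ z) (trans (cong ι (ℕP.*-assoc (toℕ x) (toℕ y) (toℕ z))) (sym (⊗-ι x _)))

      ⊕-identityˡ : ∀ x → 0F ⊕ x ≡ x
      ⊕-identityˡ x = trans (ι-⊕ 0 x) (ι-toℕ x)

      ⊗-identityˡ : ∀ x → 1F ⊗ x ≡ x
      ⊗-identityˡ x = trans (ι-⊗ 1 x) (trans (cong ι (ℕP.*-identityˡ (toℕ x))) (ι-toℕ x))

      ⊗-distribˡ : ∀ x y z → x ⊗ (y ⊕ z) ≡ (x ⊗ y) ⊕ (x ⊗ z)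
      ⊗-distribˡ x y z = trans (⊗-ι x _) (trans (cong ι (ℕP.*-distribˡ-+ (toℕ x) (toℕ y) (toℕ z))) (sym (ι-+ _ _)))

      ⊕-inverseˡ : ∀ x → (⊖ x) ⊕ x ≡ 0F
      ⊕-inverseˡ x = trans (ι-⊕ _ x) (ι-cong (begin
        (ℕ.pred p ℕ.* toℕ x ℕ.+ toℕ x) % p ≡⟨ cong (_% p) (ℕP.+-comm (ℕ.pred p ℕ.* toℕ x) (toℕ x)) ⟩
        (suc (ℕ.pred p) ℕ.* toℕ x) % p     ≡⟨ cong (λ q → (q ℕ.* toℕ x) % p) (ℕP.suc-pred p) ⟩
        (p ℕ.* toℕ x) % p                  ≡⟨ cong (_% p) (ℕP.*-comm p (toℕ x)) ⟩
        (0 ℕ.+ toℕ x ℕ.* p) % p            ≡⟨ DM.[m+kn]%n≡m%n 0 (toℕ x) p ⟩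
        0 % p                              ∎))
        where open ≡-Reasoning

    isCommutativeRing : IsCommutativeRing _≡_ _⊕_ _⊗_ ⊖_ 0F 1F
    isCommutativeRing = record
      { isRing = record
        { +-isAbelianGroup = record
          { isGroup = record
            { isMonoid = record
              { isSemigroup = record
                { isMagma = record { isEquivalence = isEquivalence ; ∙-cong = cong₂ _⊕_ }
                ; assoc = ⊕-assoc }
              ; identity = ⊕-identityˡ , λ x → trans (⊕-comm x 0F) (⊕-identityˡ x) }
            ; inverse = ⊕-inverseˡ , λ x → trans (⊕-comm x (⊖ x)) (⊕-inverseˡ x)
            ; ⁻¹-cong = cong ⊖_ }
          ; comm = ⊕-comm }
        ; *-cong = cong₂ _⊗_
        ; *-assoc = ⊗-assoc
        ; *-identity = ⊗-identityˡ , λ x → trans (⊗-comm x 1F) (⊗-identityˡ x)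
        ; distrib = ⊗-distribˡ , λ x y z → trans (⊗-comm (y ⊕ z) x)
            (trans (⊗-distribˡ x y z) (cong₂ _⊕_ (⊗-comm x y) (⊗-comm x z))) }
      ; *-comm = ⊗-comm }

    ring : CommutativeRing _ _
    ring = record { isCommutativeRing = isCommutativeRing }

    open CommutativeRing ring public
      using () renaming (+-identityʳ to ⊕-identityʳ; *-identityʳ to ⊗-identityʳ; zeroˡ to ⊗-zeroˡ; zeroʳ to ⊗-zeroʳ
                        ; -‿inverseʳ to ⊕-inverseʳ)

    -- Ring solver with formal differences of naturals as coefficients: unlike residues
    -- modulo the variable p, these compute, so that the solver sees cancellations.
    private
      q : ℕ
      q = ℕ.pred p

      ι-period : ∀ {a b} k l → a ℕ.+ k ℕ.* suc q ≡ b ℕ.+ l ℕ.* suc q → ι a ≡ ι b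
      ι-period {a} {b} k l e = ι-cong (begin
        a % p               ≡⟨ sym (DM.[m+kn]%n≡m%n a k p) ⟩
        (a ℕ.+ k ℕ.* p) % p ≡⟨ cong (_% p) (subst (λ n → a ℕ.+ k ℕ.* n ≡ b ℕ.+ l ℕ.* n) (ℕP.suc-pred p) e) ⟩
        (b ℕ.+ l ℕ.* p) % p ≡⟨ DM.[m+kn]%n≡m%n b l p ⟩
        b % p               ∎)
        where open ≡-Reasoning

      differences : RawRing _ _
      differences = record
        { Carrier = ℕ × ℕ ; _≈_ = _≡_
        ; _+_ = λ { (a , b) (c , d) → a ℕ.+ c , b ℕ.+ d }
        ; _*_ = λ { (a , b) (c , d) → a ℕ.* c ℕ.+ b ℕ.* d , a ℕ.* d ℕ.+ b ℕ.* c }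
        ; -_ = λ { (a , b) → b , a } ; 0# = 0 , 0 ; 1# = 1 , 0 }

      -- The pair `(a , b)` stands for `a - b`; as `q = p - 1` is congruent to -1, the difference is
      -- `b q + a`.
      ⟦_⟧ᵈ : ℕ × ℕ → 𝔽
      ⟦ a , b ⟧ᵈ = ι (b ℕ.* q ℕ.+ a)

      differences⟶𝔽 : differences ACR.-Raw-AlmostCommutative⟶ ACR.fromCommutativeRing ring
      differences⟶𝔽 = record
        { ⟦_⟧ = ⟦_⟧ᵈ
        ; +-homo = λ { (a , b) (c , d) → trans (cong ι (NS.solve 5 (λ a b c d q →
              (b NS.:+ d) NS.:* q NS.:+ (a NS.:+ c) NS.:= (b NS.:* q NS.:+ a) NS.:+ (d NS.:* q NS.:+ c)) refl a b c d q))
            (sym (ι-+ _ _)) }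
        ; *-homo = λ { (a , b) (c , d) → trans (ι-period (q ℕ.* (b ℕ.* d)) (b ℕ.* d) (NS.solve 5 (λ a b c d q →
              (a NS.:* d NS.:+ b NS.:* c) NS.:* q NS.:+ (a NS.:* c NS.:+ b NS.:* d) NS.:+ (q NS.:* (b NS.:* d)) NS.:* (NS.con 1 NS.:+ q)
                NS.:= (b NS.:* q NS.:+ a) NS.:* (d NS.:* q NS.:+ c) NS.:+ (b NS.:* d) NS.:* (NS.con 1 NS.:+ q)) refl a b c d q))
            (sym (ι-* _ _)) }
        ; -‿homo = λ { (a , b) → trans (ι-period (q ℕ.* b) b (NS.solve 3 (λ a b q →
              (a NS.:* q NS.:+ b) NS.:+ (q NS.:* b) NS.:* (NS.con 1 NS.:+ q)
                NS.:= q NS.:* (b NS.:* q NS.:+ a) NS.:+ b NS.:* (NS.con 1 NS.:+ q)) refl a b q))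
            (trans (sym (ι-* q (b ℕ.* q ℕ.+ a))) (sym (⊖-def _))) }
        ; 0-homo = refl
        ; 1-homo = refl }

      _≟ᵈ_ : ∀ x y → Maybe (⟦ x ⟧ᵈ ≡ ⟦ y ⟧ᵈ)
      (a , b) ≟ᵈ (c , d) with a ℕ.+ d ℕP.≟ c ℕ.+ b
      ... | no  _ = nothing
      ... | yes e = just (ι-period d b (begin
        (b ℕ.* q ℕ.+ a) ℕ.+ d ℕ.* suc q     ≡⟨ NS.solve 4 (λ a b d q → (b NS.:* q NS.:+ a) NS.:+ d NS.:* (NS.con 1 NS.:+ q)
                                                NS.:= (a NS.:+ d) NS.:+ q NS.:* (b NS.:+ d)) refl a b d q ⟩
        (a ℕ.+ d) ℕ.+ q ℕ.* (b ℕ.+ d)       ≡⟨ cong (ℕ._+ q ℕ.* (b ℕ.+ d)) e ⟩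
        (c ℕ.+ b) ℕ.+ q ℕ.* (b ℕ.+ d)       ≡⟨ NS.solve 4 (λ c b d q → (c NS.:+ b) NS.:+ q NS.:* (b NS.:+ d)
                                                NS.:= (d NS.:* q NS.:+ c) NS.:+ b NS.:* (NS.con 1 NS.:+ q)) refl c b d q ⟩
        (d ℕ.* q ℕ.+ c) ℕ.+ b ℕ.* suc q     ∎))
        where open ≡-Reasoning

    module 𝔽S = RingSolver differences (ACR.fromCommutativeRing ring) differences⟶𝔽 _≟ᵈ_

    ∑ : ∀ k → (Fin k → 𝔽) → 𝔽
    ∑ zero    g = 0F
    ∑ (suc k) g = g zero ⊕ ∑ k (g ∘ suc)

    ∑-cong : ∀ k {f g : Fin k → 𝔽} → (∀ i → f i ≡ g i) → ∑ k f ≡ ∑ k g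
    ∑-cong zero    e = refl
    ∑-cong (suc k) e = cong₂ _⊕_ (e zero) (∑-cong k (e ∘ suc))

    ∑-⊕ : ∀ k (f g : Fin k → 𝔽) → ∑ k (λ i → f i ⊕ g i) ≡ ∑ k f ⊕ ∑ k g
    ∑-⊕ zero    f g = sym (⊕-identityˡ 0F)
    ∑-⊕ (suc k) f g rewrite ∑-⊕ k (f ∘ suc) (g ∘ suc) =
      𝔽S.solve 4 (λ a b c d → (a 𝔽S.:+ b) 𝔽S.:+ (c 𝔽S.:+ d) 𝔽S.:= (a 𝔽S.:+ c) 𝔽S.:+ (b 𝔽S.:+ d)) refl
        (f zero) (g zero) (∑ k (f ∘ suc)) (∑ k (g ∘ suc))

    ∑-⊗ : ∀ k c (f : Fin k → 𝔽) → ∑ k (λ i → c ⊗ f i) ≡ c ⊗ ∑ k f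
    ∑-⊗ zero    c f = sym (⊗-zeroʳ c)
    ∑-⊗ (suc k) c f rewrite ∑-⊗ k c (f ∘ suc) = sym (⊗-distribˡ c (f zero) (∑ k (f ∘ suc)))

    ∑-0 : ∀ k {f : Fin k → 𝔽} → (∀ i → f i ≡ 0F) → ∑ k f ≡ 0F
    ∑-0 zero    e = refl
    ∑-0 (suc k) e = trans (cong₂ _⊕_ (e zero) (∑-0 k (e ∘ suc))) (⊕-identityˡ 0F)

    ∑-swap : ∀ j k (f : Fin j → Fin k → 𝔽) → ∑ j (λ a → ∑ k (f a)) ≡ ∑ k (λ b → ∑ j (λ a → f a b))
    ∑-swap zero    k f = sym (∑-0 k (λ _ → refl))
    ∑-swap (suc j) k f = trans (cong (∑ k (f zero) ⊕_) (∑-swap j k (f ∘ suc))) (sym (∑-⊕ k (f zero) _))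

    ∑-single : ∀ k (i : Fin k) (f : Fin k → 𝔽) → (∀ j → j ≢ i → f j ≡ 0F) → ∑ k f ≡ f i
    ∑-single (suc k) zero    f e = trans (cong (f zero ⊕_) (∑-0 k (λ j → e (suc j) λ ()))) (⊕-identityʳ (f zero))
    ∑-single (suc k) (suc i) f e = trans (cong₂ _⊕_ (e zero λ ()) (∑-single k i (f ∘ suc) (λ j n → e (suc j) (n ∘ FinP.suc-injective))))
      (⊕-identityˡ (f (suc i)))

    ι-sumℕ : ∀ k (g : Fin k → ℕ) → ι (sumℕ k g) ≡ ∑ k (ι ∘ g)
    ι-sumℕ zero    g = refl
    ι-sumℕ (suc k) g = trans (sym (ι-+ (g zero) _)) (cong (ι (g zero) ⊕_) (ι-sumℕ k (g ∘ suc)))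

    toℕ-∑ : ∀ k (a b : Fin k → 𝔽) → sumℕ k (λ i → toℕ (a i) ℕ.* toℕ (b i)) % p ≡ toℕ (∑ k (λ i → a i ⊗ b i))
    toℕ-∑ k a b = trans (sym (toℕ-ι _)) (cong toℕ (trans (ι-sumℕ k _) (∑-cong k (λ i → sym (⊗-def (a i) (b i))))))

    toℕ-0F : toℕ 0F ≡ 0
    toℕ-0F = trans (toℕ-ι 0) (DM.m<n⇒m%n≡m (ℕ.>-nonZero⁻¹ p))

    toℕ≡0 : ∀ {x} → toℕ x ≡ 0 → x ≡ 0F
    toℕ≡0 e = FinP.toℕ-injective (trans e (sym toℕ-0F))

    module Inverses (prime : Prime p) where

      inverse : ∀ x → x ≢ 0F → ∃ λ y → y ⊗ x ≡ 1F
      inverse x x≢0 with Cop.coprime-Bézout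
          (Cop.prime⇒coprime prime {{ℕ.≢-nonZero (x≢0 ∘ toℕ≡0)}} (FinP.toℕ<n x))
      ... | Bézout.-+ a b e = ι b , trans (ι-⊗ b x) (ι-cong (trans (cong (_% p) (sym e)) (DM.[m+kn]%n≡m%n 1 a p)))
      -- Here `1 + b x` is a multiple of `p`, so `b x` is -1 and the inverse is `- b`.
      ... | Bézout.+- a b e = ⊖ ι b , (begin
          (⊖ ι b) ⊗ x        ≡⟨ 𝔽S.solve 2 (λ u v → (𝔽S.:- u) 𝔽S.:* v 𝔽S.:= 𝔽S.:- (u 𝔽S.:* v)) refl (ι b) x ⟩
          ⊖ (ι b ⊗ x)        ≡⟨ cong ⊖_ (ι-⊗ b x) ⟩
          ⊖ y                ≡⟨ sym (⊕-identityʳ (⊖ y)) ⟩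
          ⊖ y ⊕ 0F           ≡⟨ cong (⊖ y ⊕_) (sym 1+y) ⟩
          ⊖ y ⊕ (1F ⊕ y)     ≡⟨ 𝔽S.solve 2 (λ u v → (𝔽S.:- u) 𝔽S.:+ (v 𝔽S.:+ u) 𝔽S.:= v) refl y 1F ⟩
          1F                 ∎)
        where
        open ≡-Reasoning
        y = ι (b ℕ.* toℕ x)
        1+y : 1F ⊕ y ≡ 0F
        1+y = trans (ι-+ 1 _) (ι-cong (trans (cong (_% p) e) (DM.[m+kn]%n≡m%n 0 a p)))

      1≢0 : 1F ≢ 0F
      1≢0 e = contradiction (trans (sym (DM.m<n⇒m%n≡m (ℕ.nonTrivial⇒n>1 p {{prime⇒nonTrivial prime}})))
        (trans (sym (toℕ-ι 1)) (trans (cong toℕ e) toℕ-0F))) λ ()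

      ⊗≡0 : ∀ {x y} → x ⊗ y ≡ 0F → x ≢ 0F → y ≡ 0F
      ⊗≡0 {x} {y} e n with inverse x n
      ... | z , zx = begin
        y              ≡⟨ sym (⊗-identityˡ y) ⟩
        1F ⊗ y         ≡⟨ cong (_⊗ y) (sym zx) ⟩
        (z ⊗ x) ⊗ y    ≡⟨ ⊗-assoc z x y ⟩
        z ⊗ (x ⊗ y)    ≡⟨ cong (z ⊗_) e ⟩
        z ⊗ 0F         ≡⟨ ⊗-zeroʳ z ⟩
        0F             ∎
        where open ≡-Reasoning

  -- Linear algebra

  module LinearAlgebra (p : ℕ) .{{_ : NonZero p}} (prime : Prime p) where
    open Field p
    open Inverses prime

    dot : ∀ n → (Fin n → 𝔽) → (Fin n → 𝔽) → 𝔽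
    dot n u v = ∑ n (λ l → u l ⊗ v l)

    dot-linearʳ : ∀ n u v v' c → dot n u (λ l → v l ⊕ c ⊗ v' l) ≡ dot n u v ⊕ c ⊗ dot n u v'
    dot-linearʳ n u v v' c = begin
      ∑ n (λ l → u l ⊗ (v l ⊕ c ⊗ v' l))          ≡⟨ ∑-cong n (λ l → 𝔽S.solve 4 (λ a b c d → a 𝔽S.:* (b 𝔽S.:+ c 𝔽S.:* d)
                                                       𝔽S.:= a 𝔽S.:* b 𝔽S.:+ c 𝔽S.:* (a 𝔽S.:* d)) refl (u l) (v l) c (v' l)) ⟩
      ∑ n (λ l → u l ⊗ v l ⊕ c ⊗ (u l ⊗ v' l))    ≡⟨ ∑-⊕ n _ _ ⟩
      dot n u v ⊕ ∑ n (λ l → c ⊗ (u l ⊗ v' l))    ≡⟨ cong (dot n u v ⊕_) (∑-⊗ n c _) ⟩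
      dot n u v ⊕ c ⊗ dot n u v'                  ∎
      where open ≡-Reasoning

    dot-comm : ∀ n u v → dot n u v ≡ dot n v u
    dot-comm n u v = ∑-cong n (λ l → ⊗-comm (u l) (v l))

    dot-cong : ∀ n {u u' v v'} → (∀ l → u l ≡ u' l) → (∀ l → v l ≡ v' l) → dot n u v ≡ dot n u' v'
    dot-cong n e f = ∑-cong n (λ l → cong₂ _⊗_ (e l) (f l))

    δ : ∀ {k} → Fin k → Fin k → 𝔽
    δ i j with i FinP.≟ j
    ... | yes _ = 1F
    ... | no  _ = 0F

    δ-same : ∀ {k} (i : Fin k) → δ i i ≡ 1F
    δ-same i with i FinP.≟ i
    ... | yes _ = refl
    ... | no  n = contradiction refl n

    δ-other : ∀ {k} {i j : Fin k} → j ≢ i → δ i j ≡ 0F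
    δ-other {i = i} {j} n with i FinP.≟ j
    ... | yes e = contradiction (sym e) n
    ... | no  _ = refl

    dot-δ : ∀ n u (i : Fin n) → dot n u (δ i) ≡ u i
    dot-δ n u i = trans (∑-single n i _ (λ j j≢i → trans (cong (u j ⊗_) (δ-other j≢i)) (⊗-zeroʳ (u j))))
      (trans (cong (u i ⊗_) (δ-same i)) (⊗-identityʳ (u i)))

    module _ {t n : ℕ} where

      -- Serves both for points, with one vector per variable, and for tuples of linear forms;
      -- `⟪_,_⟫` pairs the two.
      Table : Set
      Table = Fin t → Fin n → 𝔽

      _⟨+_·_⟩ : Table → 𝔽 → Table → Table
      (x ⟨+ c · y ⟩) j l = x j l ⊕ c ⊗ y j l

      ⟪_,_⟫ : Table → Table → 𝔽
      ⟪ a , x ⟫ = ∑ t (λ j → dot n (a j) (x j))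

      ⟪⟫-linearʳ : ∀ a x c y → ⟪ a , x ⟨+ c · y ⟩ ⟫ ≡ ⟪ a , x ⟫ ⊕ c ⊗ ⟪ a , y ⟫
      ⟪⟫-linearʳ a x c y = begin
        ⟪ a , x ⟨+ c · y ⟩ ⟫                          ≡⟨ ∑-cong t (λ j → dot-linearʳ n (a j) (x j) (y j) c) ⟩
        ∑ t (λ j → dot n (a j) (x j) ⊕ c ⊗ dot n (a j) (y j)) ≡⟨ ∑-⊕ t _ _ ⟩
        ⟪ a , x ⟫ ⊕ ∑ t (λ j → c ⊗ dot n (a j) (y j)) ≡⟨ cong (⟪ a , x ⟫ ⊕_) (∑-⊗ t c _) ⟩
        ⟪ a , x ⟫ ⊕ c ⊗ ⟪ a , y ⟫                     ∎
        where open ≡-Reasoning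

      ⟪⟫-comm : ∀ a x → ⟪ a , x ⟫ ≡ ⟪ x , a ⟫
      ⟪⟫-comm a x = ∑-cong t (λ j → dot-comm n (a j) (x j))

      ⟪⟫-linearˡ : ∀ a c b x → ⟪ a ⟨+ c · b ⟩ , x ⟫ ≡ ⟪ a , x ⟫ ⊕ c ⊗ ⟪ b , x ⟫
      ⟪⟫-linearˡ a c b x = trans (⟪⟫-comm _ x) (trans (⟪⟫-linearʳ x a c b)
        (cong₂ (λ u v → u ⊕ c ⊗ v) (⟪⟫-comm x a) (⟪⟫-comm x b)))

      ⟪⟫-single : ∀ a j → (y : Fin n → 𝔽) → ⟪ a , (λ i l → δ j i ⊗ y l) ⟫ ≡ dot n (a j) y
      ⟪⟫-single a j y = trans (∑-single t j _ (λ i i≢j → ∑-0 n (λ l →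
          trans (cong (λ z → a i l ⊗ (z ⊗ y l)) (δ-other i≢j)) (trans (cong (a i l ⊗_) (⊗-zeroˡ (y l))) (⊗-zeroʳ (a i l))))))
        (dot-cong n {u = a j} (λ _ → refl) (λ l → trans (cong (_⊗ y l) (δ-same j)) (⊗-identityˡ (y l))))

      module _ {I : Set} (φ : I → Table) where

        Span : List I → Table → Set
        Span []       ψ = ∀ j l → ψ j l ≡ 0F
        Span (i ∷ is) ψ = ∃ λ c → Span is (ψ ⟨+ ⊖ c · φ i ⟩)

        Span-cong : ∀ is {ψ χ} → (∀ j l → ψ j l ≡ χ j l) → Span is ψ → Span is χ
        Span-cong []       e s j l = trans (sym (e j l)) (s j l)
        Span-cong (i ∷ is) e (c , s) = c , Span-cong is (λ j l → cong (_⊕ (⊖ c) ⊗ φ i j l) (e j l)) s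

        -- Gaussian elimination, one functional at a time: if ψ separates from the tail through x,
        -- then ψ minus the multiple of φ i that kills x is spanned or separated in turn.
        span-or-separate : ∀ is ψ → Span is ψ ⊎
          ∃ λ x → All (λ i → ⟪ φ i , x ⟫ ≡ 0F) is × ⟪ ψ , x ⟫ ≡ 1F
        span-or-separate [] ψ with FinP.any? (λ j → FinP.any? (λ l → ¬? (ψ j l FinP.≟ 0F)))
        ... | no  none = inj₁ (λ j l → decidable-stable (ψ j l FinP.≟ 0F) (λ ψ≢0 → none (j , l , ψ≢0)))
        ... | yes (j , l , ψ≢0) with inverse (ψ j l) ψ≢0
        ...   | r , rψ = inj₂ ((λ i k → δ j i ⊗ (r ⊗ δ l k)) , [] , (begin
          ⟪ ψ , (λ i k → δ j i ⊗ (r ⊗ δ l k)) ⟫ ≡⟨ ⟪⟫-single ψ j (λ k → r ⊗ δ l k) ⟩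
          dot n (ψ j) (λ k → r ⊗ δ l k)         ≡⟨ ∑-cong n (λ k → 𝔽S.solve 3 (λ a b c → a 𝔽S.:* (b 𝔽S.:* c)
                                                      𝔽S.:= b 𝔽S.:* (a 𝔽S.:* c)) refl (ψ j k) r (δ l k)) ⟩
          ∑ n (λ k → r ⊗ (ψ j k ⊗ δ l k))       ≡⟨ ∑-⊗ n r _ ⟩
          r ⊗ dot n (ψ j) (δ l)                 ≡⟨ cong (r ⊗_) (dot-δ n (ψ j) l) ⟩
          r ⊗ ψ j l                             ≡⟨ rψ ⟩
          1F                                    ∎))
          where open ≡-Reasoning
        span-or-separate (i ∷ is) ψ with span-or-separate is ψ
        ... | inj₁ s = inj₁ (0F , Span-cong is (λ j l → 𝔽S.solve 2 (λ a b → a 𝔽S.:= a 𝔽S.:+ (𝔽S.:- 𝔽S.con (0 , 0)) 𝔽S.:* b) refl (ψ j l) (φ i j l)) s)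
        ... | inj₂ (x , x⊥ , ψx) with ⟪ φ i , x ⟫ FinP.≟ 0F
        ...   | yes e = inj₂ (x , e ∷ x⊥ , ψx)
        ...   | no  u≢0 with inverse ⟪ φ i , x ⟫ u≢0
        ...     | r , ru with span-or-separate is (ψ ⟨+ ⊖ r · φ i ⟩)
        ...       | inj₁ s = inj₁ (r , s)
        ...       | inj₂ (y , y⊥ , ψy) = inj₂ (z , eqφ ∷ All.map killed (All.zip (y⊥ , x⊥)) , eqψ)
          where
          open ≡-Reasoning
          a = ⟪ φ i , y ⟫
          -- Subtracting `a r` times `x` makes `φ i` vanish, and changes the value of `ψ` from
          -- `⟪ ψ , y ⟫` to that of `ψ - r φ i` at `y`, which is 1.
          z = y ⟨+ ⊖ (a ⊗ r) · x ⟩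
          eqφ : ⟪ φ i , z ⟫ ≡ 0F
          eqφ = begin
            ⟪ φ i , z ⟫                       ≡⟨ ⟪⟫-linearʳ (φ i) y (⊖ (a ⊗ r)) x ⟩
            a ⊕ (⊖ (a ⊗ r)) ⊗ ⟪ φ i , x ⟫     ≡⟨ 𝔽S.solve 3 (λ a r u → a 𝔽S.:+ (𝔽S.:- (a 𝔽S.:* r)) 𝔽S.:* u
                                                   𝔽S.:= a 𝔽S.:+ (𝔽S.:- (a 𝔽S.:* (r 𝔽S.:* u)))) refl a r ⟪ φ i , x ⟫ ⟩
            a ⊕ (⊖ (a ⊗ (r ⊗ ⟪ φ i , x ⟫)))   ≡⟨ cong (λ v → a ⊕ (⊖ (a ⊗ v))) ru ⟩
            a ⊕ (⊖ (a ⊗ 1F))                  ≡⟨ cong (λ v → a ⊕ (⊖ v)) (⊗-identityʳ a) ⟩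
            a ⊕ (⊖ a)                         ≡⟨ ⊕-inverseʳ a ⟩
            0F                                ∎
          eqψ : ⟪ ψ , z ⟫ ≡ 1F
          eqψ = begin
            ⟪ ψ , z ⟫                                  ≡⟨ ⟪⟫-linearʳ ψ y (⊖ (a ⊗ r)) x ⟩
            ⟪ ψ , y ⟫ ⊕ (⊖ (a ⊗ r)) ⊗ ⟪ ψ , x ⟫        ≡⟨ cong (λ v → ⟪ ψ , y ⟫ ⊕ (⊖ (a ⊗ r)) ⊗ v) ψx ⟩
            ⟪ ψ , y ⟫ ⊕ (⊖ (a ⊗ r)) ⊗ 1F               ≡⟨ cong (⟪ ψ , y ⟫ ⊕_) (⊗-identityʳ _) ⟩
            ⟪ ψ , y ⟫ ⊕ (⊖ (a ⊗ r))                    ≡⟨ 𝔽S.solve 3 (λ b a r → b 𝔽S.:+ (𝔽S.:- (a 𝔽S.:* r))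
                                                            𝔽S.:= b 𝔽S.:+ (𝔽S.:- r) 𝔽S.:* a) refl ⟪ ψ , y ⟫ a r ⟩
            ⟪ ψ , y ⟫ ⊕ (⊖ r) ⊗ a                      ≡⟨ sym (⟪⟫-linearˡ ψ (⊖ r) (φ i) y) ⟩
            ⟪ ψ ⟨+ ⊖ r · φ i ⟩ , y ⟫                   ≡⟨ ψy ⟩
            1F                                         ∎
          killed : ∀ {k} → ⟪ φ k , y ⟫ ≡ 0F × ⟪ φ k , x ⟫ ≡ 0F → ⟪ φ k , z ⟫ ≡ 0F
          killed {k} (ey , ex) = trans (⟪⟫-linearʳ (φ k) y (⊖ (a ⊗ r)) x)
            (trans (cong₂ (λ u v → u ⊕ (⊖ (a ⊗ r)) ⊗ v) ey ex) (trans (⊕-identityˡ _) (⊗-zeroʳ (⊖ (a ⊗ r)))))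

        Span-induction : (P : Table → Set) → (∀ {ψ χ} → (∀ j l → ψ j l ≡ χ j l) → P ψ → P χ) →
          P (λ _ _ → 0F) → (∀ {ψ} i c → P ψ → P (ψ ⟨+ c · φ i ⟩)) → ∀ is {ψ} → Span is ψ → P ψ
        Span-induction P resp z step []       s = resp (λ j l → sym (s j l)) z
        Span-induction P resp z step (i ∷ is) {ψ} (c , s) =
          resp (λ j l → 𝔽S.solve 3 (λ a c b → (a 𝔽S.:+ (𝔽S.:- c) 𝔽S.:* b) 𝔽S.:+ c 𝔽S.:* b 𝔽S.:= a) refl (ψ j l) c (φ i j l))
            (step i c (Span-induction P resp z step is s))

    module _ {m t : ℕ} (M : Fin m → Fin t → 𝔽) where

      Solves : ∀ {n} → Table {t} {n} → Set
      Solves {n} x = ∀ i l → ∑ t (λ j → M i j ⊗ x j l) ≡ 0F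

      IsSol⇒Solves : ∀ {n} {x : Table {t} {n}} → IsSol M x → Solves x
      IsSol⇒Solves {x = x} s i l = toℕ≡0 (trans (sym (toℕ-∑ t (M i) (λ j → x j l))) (s i l))

      Solves⇒IsSol : ∀ {n} {x : Table {t} {n}} → Solves x → IsSol M x
      Solves⇒IsSol {x = x} s i l = trans (toℕ-∑ t (M i) (λ j → x j l)) (trans (cong toℕ (s i l)) toℕ-0F)

      rowCombo : ∀ {n} → (Fin m → Fin n → 𝔽) → Table {t} {n}
      rowCombo c j l = ∑ m (λ i → c i l ⊗ M i j)

      -- Fredholm alternative: a functional that vanishes wherever the homogeneous constraints do is
      -- a combination of them. The constraints are the equations of `M`, one per coordinate, and
      -- one form `K j` per variable; `c` and `μ` collect their coefficients.
      solve-or-certify : ∀ {n} (K ψ : Table {t} {n}) →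
        (∃ λ x → Solves x × (∀ j → dot n (K j) (x j) ≡ 0F) × ⟪ ψ , x ⟫ ≡ 1F) ⊎
        (∃ λ c → ∃ λ μ → ∀ j l → ψ j l ≡ rowCombo c j l ⊕ μ j ⊗ K j l)
      solve-or-certify {n} K ψ with span-or-separate φ is ψ
        where
        φ : (Fin m × Fin n) ⊎ Fin t → Table
        φ (inj₁ (i , l)) j l' = M i j ⊗ δ l l'
        φ (inj₂ i)       j l  = δ i j ⊗ K j l
        is = map inj₁ (cartesianProduct (allFin m) (allFin n)) ++ map inj₂ (allFin t)
      ... | inj₂ (x , x⊥ , ψx) = inj₁ (x , sol , pts , ψx)
        where
        sol : Solves x
        sol i l = trans (∑-cong t (λ j → sym (begin
            ∑ n (λ l' → (M i j ⊗ δ l l') ⊗ x j l')   ≡⟨ ∑-cong n (λ l' → 𝔽S.solve 3 (λ a b c → (a 𝔽S.:* b) 𝔽S.:* c 𝔽S.:= a 𝔽S.:* (c 𝔽S.:* b)) refl (M i j) (δ l l') (x j l')) ⟩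
            ∑ n (λ l' → M i j ⊗ (x j l' ⊗ δ l l'))   ≡⟨ ∑-⊗ n (M i j) _ ⟩
            M i j ⊗ dot n (x j) (δ l)                ≡⟨ cong (M i j ⊗_) (dot-δ n (x j) l) ⟩
            M i j ⊗ x j l                            ∎)))
          (All.lookup x⊥ (∈P.∈-++⁺ˡ (∈P.∈-map⁺ inj₁ (∈P.∈-cartesianProduct⁺ (∈P.∈-allFin i) (∈P.∈-allFin l)))))
          where open ≡-Reasoning
        pts : ∀ j → dot n (K j) (x j) ≡ 0F
        pts j = trans (dot-comm n (K j) (x j)) (trans (sym (⟪⟫-single x j (K j))) (trans (∑-cong t (λ i → begin
            ∑ n (λ l → x i l ⊗ (δ j i ⊗ K j l)) ≡⟨ ∑-cong n (λ l → swapK i l (i FinP.≟ j)) ⟩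
            ∑ n (λ l → (δ j i ⊗ K i l) ⊗ x i l) ∎))
          (All.lookup x⊥ (∈P.∈-++⁺ʳ _ (∈P.∈-map⁺ inj₂ (∈P.∈-allFin j))))))
          where
          open ≡-Reasoning
          swapK : ∀ i l → Dec (i ≡ j) → x i l ⊗ (δ j i ⊗ K j l) ≡ (δ j i ⊗ K i l) ⊗ x i l
          swapK i l (yes refl) = ⊗-comm (x i l) _
          swapK i l (no  i≢j) rewrite δ-other i≢j = trans (cong (x i l ⊗_) (⊗-zeroˡ (K j l)))
            (trans (⊗-comm (x i l) 0F) (cong (_⊗ x i l) (sym (⊗-zeroˡ (K i l)))))
      ... | inj₁ s = inj₂ (Span-induction _ P P-resp base step _ s)
        where
        P : Table → Set
        P ψ = ∃ λ c → ∃ λ μ → ∀ j l → ψ j l ≡ rowCombo c j l ⊕ μ j ⊗ K j l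
        P-resp : ∀ {ψ χ} → (∀ j l → ψ j l ≡ χ j l) → P ψ → P χ
        P-resp e (c , μ , f) = c , μ , λ j l → trans (sym (e j l)) (f j l)
        base : P (λ _ _ → 0F)
        base = (λ _ _ → 0F) , (λ _ → 0F) , λ j l →
          sym (trans (cong₂ _⊕_ (∑-0 m (λ i → ⊗-zeroˡ (M i j))) (⊗-zeroˡ (K j l))) (⊕-identityˡ 0F))
        step : ∀ {ψ} i c → P ψ → P (ψ ⟨+ c · _ ⟩)
        step (inj₁ (i , l)) a (c , μ , f) = (λ i' l' → c i' l' ⊕ a ⊗ (δ i i' ⊗ δ l l')) , μ , λ j l' → begin
            _ ≡⟨ cong (_⊕ a ⊗ (M i j ⊗ δ l l')) (f j l') ⟩
            (rowCombo c j l' ⊕ μ j ⊗ K j l') ⊕ a ⊗ (M i j ⊗ δ l l')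
              ≡⟨ 𝔽S.solve 5 (λ r s a u d → (r 𝔽S.:+ s) 𝔽S.:+ a 𝔽S.:* (u 𝔽S.:* d) 𝔽S.:= (r 𝔽S.:+ (a 𝔽S.:* d) 𝔽S.:* u) 𝔽S.:+ s) refl
                   (rowCombo c j l') (μ j ⊗ K j l') a (M i j) (δ l l') ⟩
            (rowCombo c j l' ⊕ (a ⊗ δ l l') ⊗ M i j) ⊕ μ j ⊗ K j l'
              ≡⟨ cong (λ v → (rowCombo c j l' ⊕ (a ⊗ δ l l') ⊗ v) ⊕ μ j ⊗ K j l') (sym (dot-δ m (λ i' → M i' j) i)) ⟩
            (rowCombo c j l' ⊕ (a ⊗ δ l l') ⊗ dot m (λ i' → M i' j) (δ i)) ⊕ μ j ⊗ K j l'
              ≡⟨ cong (_⊕ μ j ⊗ K j l') (sym (trans (∑-cong m (λ i' → 𝔽S.solve 5 (λ c a d e v → (c 𝔽S.:+ a 𝔽S.:* (d 𝔽S.:* e)) 𝔽S.:* v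
                   𝔽S.:= c 𝔽S.:* v 𝔽S.:+ (a 𝔽S.:* e) 𝔽S.:* (v 𝔽S.:* d)) refl (c i' l') a (δ i i') (δ l l') (M i' j)))
                   (trans (∑-⊕ m _ _) (cong (rowCombo c j l' ⊕_) (∑-⊗ m (a ⊗ δ l l') _))))) ⟩
            _ ∎
          where open ≡-Reasoning
        step (inj₂ i) a (c , μ , f) = c , (λ j → μ j ⊕ a ⊗ δ i j) , λ j l →
          trans (cong (_⊕ a ⊗ (δ i j ⊗ K j l)) (f j l))
            (𝔽S.solve 5 (λ r u k a d → (r 𝔽S.:+ u 𝔽S.:* k) 𝔽S.:+ a 𝔽S.:* (d 𝔽S.:* k) 𝔽S.:= r 𝔽S.:+ (u 𝔽S.:+ a 𝔽S.:* d) 𝔽S.:* k) refl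
              (rowCombo c j l) (μ j) (K j l) a (δ i j))

      Isolates : ∀ {n} → Table {t} {n} → Fin t → Table {t} {n} → Set
      Isolates {n} L j x = Solves x × dot n (L j) (x j) ≡ 1F × (∀ i → i ≢ j → dot n (L i) (x i) ≡ 0F)

      -- A relation `∑ mult j · (L j)(x j) = 0` valid on all solutions, kept with the combination of
      -- equations that proves it: `coeff i l` multiplies equation `i` in coordinate `l`.
      record Certificate {n} (L : Table {t} {n}) : Set where
        constructor certificate
        field
          coeff : Fin m → Fin n → 𝔽
          mult  : Fin t → 𝔽
          match : ∀ j l → rowCombo coeff j l ≡ mult j ⊗ L j l

      open Certificate public

      -- Contracting the coordinates with `θ` leaves a single combination of the rows of `M`.
      -- Through it, bounds on the length of equations act on relations between forms.
      certificate-applied : ∀ {n} {L : Table {t} {n}} (C : Certificate L) θ j →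
        ∑ m (λ i → dot n θ (coeff C i) ⊗ M i j) ≡ mult C j ⊗ dot n θ (L j)
      certificate-applied {n} {L} C θ j = begin
        ∑ m (λ i → dot n θ (coeff C i) ⊗ M i j)
          ≡⟨ ∑-cong m (λ i → trans (⊗-comm _ (M i j)) (trans (sym (∑-⊗ n (M i j) _)) (∑-cong n (λ l →
               𝔽S.solve 3 (λ a b c → a 𝔽S.:* (b 𝔽S.:* c) 𝔽S.:= b 𝔽S.:* (c 𝔽S.:* a)) refl (M i j) (θ l) (coeff C i l))))) ⟩
        ∑ m (λ i → ∑ n (λ l → θ l ⊗ (coeff C i l ⊗ M i j)))
          ≡⟨ ∑-swap m n _ ⟩
        ∑ n (λ l → ∑ m (λ i → θ l ⊗ (coeff C i l ⊗ M i j)))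
          ≡⟨ ∑-cong n (λ l → trans (∑-⊗ m (θ l) _) (trans (cong (θ l ⊗_) (match C j l))
               (𝔽S.solve 3 (λ a b c → a 𝔽S.:* (b 𝔽S.:* c) 𝔽S.:= b 𝔽S.:* (a 𝔽S.:* c)) refl (θ l) (mult C j) (L j l)))) ⟩
        ∑ n (λ l → mult C j ⊗ (θ l ⊗ L j l))
          ≡⟨ ∑-⊗ n (mult C j) _ ⟩
        mult C j ⊗ dot n θ (L j) ∎
        where open ≡-Reasoning

      certificate-relation : ∀ {n} {L : Table {t} {n}} (C : Certificate L) → ∀ x → Solves x →
        ∑ t (λ j → mult C j ⊗ dot n (L j) (x j)) ≡ 0F
      certificate-relation {n} {L} C x sol = begin
        ∑ t (λ j → mult C j ⊗ dot n (L j) (x j))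
          ≡⟨ ∑-cong t (λ j → trans (sym (∑-⊗ n (mult C j) _)) (∑-cong n (λ l → trans (sym (⊗-assoc (mult C j) (L j l) (x j l)))
               (trans (cong (_⊗ x j l) (sym (match C j l))) (trans (⊗-comm _ (x j l)) (sym (∑-⊗ m (x j l) _))))))) ⟩
        ∑ t (λ j → ∑ n (λ l → ∑ m (λ i → x j l ⊗ (coeff C i l ⊗ M i j))))
          ≡⟨ ∑-swap t n _ ⟩
        ∑ n (λ l → ∑ t (λ j → ∑ m (λ i → x j l ⊗ (coeff C i l ⊗ M i j))))
          ≡⟨ ∑-0 n (λ l → trans (∑-swap t m _) (∑-0 m (λ i → trans (∑-cong t (λ j →
               𝔽S.solve 3 (λ a b c → a 𝔽S.:* (b 𝔽S.:* c) 𝔽S.:= b 𝔽S.:* (c 𝔽S.:* a)) refl (x j l) (coeff C i l) (M i j)))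
               (trans (∑-⊗ t (coeff C i l) _) (trans (cong (coeff C i l ⊗_) (sol i l)) (⊗-zeroʳ (coeff C i l))))))) ⟩
        0F ∎
        where open ≡-Reasoning

      -- The alternative is applied to the form at `j`, with the other forms as constraints. If
      -- there is no isolating solution, solving the resulting identity for `rowCombo` gives
      -- multiplier 1 at `j` and minus the coefficients of the constraints elsewhere.
      isolate-or-certify : ∀ {n} (L : Table {t} {n}) j →
        ∃ (Isolates L j) ⊎ ∃ λ (C : Certificate L) → mult C j ≡ 1F
      isolate-or-certify {n} L j = go (solve-or-certify K (λ i l → δ j i ⊗ L j l))
        where
        open ≡-Reasoning
        K : Table
        K i l = (1F ⊕ ⊖ δ j i) ⊗ L i l
        go : _ → _
        go (inj₁ (x , sol , ⊥K , one)) = inj₁ (x , sol , at-j , λ i i≢j →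
            trans (dot-cong n (λ l → sym (trans (cong (λ d → (1F ⊕ ⊖ d) ⊗ L i l) (δ-other i≢j))
              (𝔽S.solve 2 (λ o u → (o 𝔽S.:+ 𝔽S.:- 𝔽S.con (0 , 0)) 𝔽S.:* u 𝔽S.:= o 𝔽S.:* u) refl 1F (L i l) ∙ ⊗-identityˡ (L i l)))) (λ _ → refl)) (⊥K i))
          where
          _∙_ = trans
          at-j : dot n (L j) (x j) ≡ 1F
          at-j = trans (dot-comm n (L j) (x j)) (trans (sym (⟪⟫-single x j (L j))) (trans (⟪⟫-comm x _) one))
        go (inj₂ (c , μ , f)) = inj₂ (certificate c (λ i → δ j i ⊕ ⊖ (μ i ⊗ (1F ⊕ ⊖ δ j i))) (λ i l → begin
              rowCombo c i l
                ≡⟨ 𝔽S.solve 2 (λ r k → r 𝔽S.:= (r 𝔽S.:+ k) 𝔽S.:+ 𝔽S.:- k) refl (rowCombo c i l) (μ i ⊗ K i l) ⟩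
              (rowCombo c i l ⊕ μ i ⊗ K i l) ⊕ ⊖ (μ i ⊗ K i l)
                ≡⟨ cong (_⊕ ⊖ (μ i ⊗ K i l)) (trans (sym (f i l)) (δL i l (i FinP.≟ j))) ⟩
              δ j i ⊗ L i l ⊕ ⊖ (μ i ⊗ ((1F ⊕ ⊖ δ j i) ⊗ L i l))
                ≡⟨ 𝔽S.solve 4 (λ d u v o → d 𝔽S.:* v 𝔽S.:+ 𝔽S.:- (u 𝔽S.:* ((o 𝔽S.:+ 𝔽S.:- d) 𝔽S.:* v))
                     𝔽S.:= (d 𝔽S.:+ 𝔽S.:- (u 𝔽S.:* (o 𝔽S.:+ 𝔽S.:- d))) 𝔽S.:* v) refl (δ j i) (μ i) (L i l) 1F ⟩
              _ ∎)
            , trans (cong (λ d → d ⊕ ⊖ (μ j ⊗ (1F ⊕ ⊖ d))) (δ-same j))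
                (𝔽S.solve 2 (λ o u → o 𝔽S.:+ 𝔽S.:- (u 𝔽S.:* (o 𝔽S.:+ 𝔽S.:- o)) 𝔽S.:= o) refl 1F (μ j)))
          where
          δL : ∀ i l → Dec (i ≡ j) → δ j i ⊗ L j l ≡ δ j i ⊗ L i l
          δL i l (yes refl) = refl
          δL i l (no  i≢j) rewrite δ-other i≢j = trans (⊗-zeroˡ (L j l)) (sym (⊗-zeroˡ (L i l)))

  -- Averages over solutions

  sumFin-point : ∀ k (i : Fin k) {g} → (∀ j → j ≢ i → g j ≡ 0ℚ) → sumFin k g ≡ g i
  sumFin-point (suc k) zero    {g} e = trans (cong (g zero +_) (trans (sum-cong (sumFin k) (λ j → e (suc j) λ ())) (sum-0 (sumFin k)))) (+-identityʳ (g zero))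
  sumFin-point (suc k) (suc i) {g} e = trans (cong₂ _+_ (e zero λ ()) (sumFin-point k i (λ j n → e (suc j) (n ∘ FinP.suc-injective))))
    (+-identityˡ (g (suc i)))

  sumFin-const : ∀ k c → sumFin k (λ _ → c) ≡ fromℕ k * c
  sumFin-const zero    c = sym (*-zeroˡ c)
  sumFin-const (suc k) c = trans (cong₂ _+_ (sym (*-identityˡ c)) (sumFin-const k c)) (sym (*-distribʳ-+ c 1ℚ (fromℕ k)))

  module Averages (p : ℕ) .{{_ : NonZero p}} (prime : Prime p) where
    open Field p
    open Inverses prime
    open LinearAlgebra p prime

    P : ℚ
    P = fromℕ p

    0<P : 0ℚ < P
    0<P = go p
      where
      go : ∀ k .{{_ : NonZero k}} → 0ℚ < fromℕ k
      go (suc k) = <-≤-trans (positive⁻¹ 1ℚ) (subst (λ z → z ≤ 1ℚ + fromℕ k) (+-identityʳ 1ℚ) (+-monoʳ-≤ 1ℚ (fromℕ-nonneg k)))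

    P-cancel : ∀ {a b} → P * a ≡ P * b → a ≡ b
    P-cancel {a} {b} e = ≤-antisym (*-cancelˡ-≤-pos P {{positive 0<P}} (≤-reflexive e))
      (*-cancelˡ-≤-pos P {{positive 0<P}} (≤-reflexive (sym e)))

    sumFin-shift : ∀ a (g : 𝔽 → ℚ) → sumFin p (λ b → g (b ⊕ a)) ≡ sumFin p g
    sumFin-shift a g = trans (toSum p _) (trans (sym (Σℚ.sum-permute g π)) (sym (toSum p g)))
      where
      module Σℚ = MonoidSum +-0-commutativeMonoid
      toSum : ∀ k f → sumFin k f ≡ Σℚ.sum f
      toSum zero    f = refl
      toSum (suc k) f = cong (f zero +_) (toSum k (f ∘ suc))
      π = permutation (_⊕ a) (_⊕ ⊖ a)
        (λ b → 𝔽S.solve 2 (λ b a → (b 𝔽S.:+ 𝔽S.:- a) 𝔽S.:+ a 𝔽S.:= b) refl b a)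
        (λ b → 𝔽S.solve 2 (λ b a → (b 𝔽S.:+ a) 𝔽S.:+ 𝔽S.:- a 𝔽S.:= b) refl b a)

    [_≡0] : 𝔽 → ℚ
    [ y ≡0] with y FinP.≟ 0F
    ... | yes _ = 1ℚ
    ... | no  _ = 0ℚ

    [≡0]-yes : ∀ {y} → y ≡ 0F → [ y ≡0] ≡ 1ℚ
    [≡0]-yes {y} e with y FinP.≟ 0F
    ... | yes _ = refl
    ... | no  n = contradiction e n

    [≡0]-no : ∀ {y} → y ≢ 0F → [ y ≡0] ≡ 0ℚ
    [≡0]-no {y} n with y FinP.≟ 0F
    ... | yes e = contradiction e n
    ... | no  _ = refl

    -- The sum of the nontrivial characters of 𝔽 evaluated at y.
    w : 𝔽 → ℚ
    w y = P * [ y ≡0] - 1ℚ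

    -- An affine function of nonzero slope has exactly one root, so one term survives. The root is
    -- returned with its equation because `w-convolution` has to evaluate `g` there.
    sum-line : ∀ y μ → μ ≢ 0F → ∀ (g : 𝔽 → ℚ) → ∃ λ c → y ⊕ c ⊗ μ ≡ 0F × sumFin p (λ c → [ y ⊕ c ⊗ μ ≡0] * g c) ≡ g c
    sum-line y μ μ≢0 g with inverse μ μ≢0
    ... | r , rμ = c₀ , root , trans (sumFin-point p c₀ {λ c → [ y ⊕ c ⊗ μ ≡0] * g c} (λ c c≢ → trans (cong (_* g c) ([≡0]-no (λ e → c≢ (unique c e)))) (*-zeroˡ (g c))))
        (trans (cong (_* g c₀) ([≡0]-yes root)) (*-identityˡ (g c₀)))
      where
      open ≡-Reasoning
      c₀ = ⊖ (y ⊗ r)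
      root : y ⊕ c₀ ⊗ μ ≡ 0F
      root = begin
        y ⊕ (⊖ (y ⊗ r)) ⊗ μ   ≡⟨ 𝔽S.solve 3 (λ y r u → y 𝔽S.:+ (𝔽S.:- (y 𝔽S.:* r)) 𝔽S.:* u 𝔽S.:= y 𝔽S.:+ 𝔽S.:- (y 𝔽S.:* (r 𝔽S.:* u))) refl y r μ ⟩
        y ⊕ ⊖ (y ⊗ (r ⊗ μ))   ≡⟨ cong (λ v → y ⊕ ⊖ (y ⊗ v)) rμ ⟩
        y ⊕ ⊖ (y ⊗ 1F)        ≡⟨ 𝔽S.solve 1 (λ y → y 𝔽S.:+ 𝔽S.:- (y 𝔽S.:* 𝔽S.con (1 , 0)) 𝔽S.:= 𝔽S.con (0 , 0)) refl y ⟩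
        0F                    ∎
      unique : ∀ c → y ⊕ c ⊗ μ ≡ 0F → c ≡ c₀
      unique c e = begin
        c                                   ≡⟨ sym (⊗-identityʳ c) ⟩
        c ⊗ 1F                              ≡⟨ cong (c ⊗_) (sym rμ) ⟩
        c ⊗ (r ⊗ μ)                         ≡⟨ 𝔽S.solve 4 (λ c r u y → c 𝔽S.:* (r 𝔽S.:* u) 𝔽S.:= (y 𝔽S.:+ c 𝔽S.:* u) 𝔽S.:* r 𝔽S.:+ 𝔽S.:- (y 𝔽S.:* r)) refl c r μ y ⟩
        (y ⊕ c ⊗ μ) ⊗ r ⊕ ⊖ (y ⊗ r)         ≡⟨ cong (λ v → v ⊗ r ⊕ ⊖ (y ⊗ r)) e ⟩
        0F ⊗ r ⊕ ⊖ (y ⊗ r)                  ≡⟨ trans (cong (_⊕ c₀) (⊗-zeroˡ r)) (⊕-identityˡ c₀) ⟩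
        c₀                                  ∎

    sum-[≡0] : ∀ y μ → μ ≢ 0F → sumFin p (λ c → [ y ⊕ c ⊗ μ ≡0]) ≡ 1ℚ
    sum-[≡0] y μ n = trans (sum-cong (sumFin p) (λ c → sym (*-identityʳ [ y ⊕ c ⊗ μ ≡0]))) (proj₂ (proj₂ (sum-line y μ n (λ _ → 1ℚ))))

    w-sum : ∀ y μ → μ ≢ 0F → sumFin p (λ c → w (y ⊕ c ⊗ μ)) ≡ 0ℚ
    w-sum y μ n = begin
      sumFin p (λ c → w (y ⊕ c ⊗ μ))                                    ≡⟨ sum-+ (sumFin p) _ _ ⟩
      sumFin p (λ c → P * [ y ⊕ c ⊗ μ ≡0]) + sumFin p (λ _ → - 1ℚ)      ≡⟨ cong₂ _+_ (sum-* (sumFin p) P _) (sumFin-const p (- 1ℚ)) ⟩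
      P * sumFin p (λ c → [ y ⊕ c ⊗ μ ≡0]) + P * - 1ℚ                   ≡⟨ cong (λ v → P * v + P * - 1ℚ) (sum-[≡0] y μ n) ⟩
      P * 1ℚ + P * - 1ℚ                                                 ≡⟨ sym (*-distribˡ-+ P 1ℚ (- 1ℚ)) ⟩
      P * 0ℚ                                                            ≡⟨ *-zeroʳ P ⟩
      0ℚ                                                                ∎
      where open ≡-Reasoning

    -- Orthogonality of characters in elementary form: the indicator in the first factor selects
    -- `c = - y`, and its constant -1 contributes nothing by `w-sum`. The argument `z - y μ` is the
    -- combination that the line leaves fixed.
    w-convolution : ∀ y z μ → μ ≢ 0F → sumFin p (λ c → w (y ⊕ c ⊗ 1F) * w (z ⊕ c ⊗ μ)) ≡ P * w (z ⊕ ⊖ (y ⊗ μ))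
    w-convolution y z μ n = begin
      sumFin p (λ c → w (y ⊕ c ⊗ 1F) * w (z ⊕ c ⊗ μ))
        ≡⟨ sum-cong (sumFin p) (λ c → ℚS.solve 3 (λ P a v → (P ℚS.:* a ℚS.:- ℚS.con 1ℚ) ℚS.:* v ℚS.:= P ℚS.:* (a ℚS.:* v) ℚS.:+ (ℚS.con (- 1ℚ)) ℚS.:* v) refl
             P [ y ⊕ c ⊗ 1F ≡0] (w (z ⊕ c ⊗ μ))) ⟩
      sumFin p (λ c → P * ([ y ⊕ c ⊗ 1F ≡0] * w (z ⊕ c ⊗ μ)) + (- 1ℚ) * w (z ⊕ c ⊗ μ))
        ≡⟨ trans (sum-+ (sumFin p) _ _) (cong₂ _+_ (sum-* (sumFin p) P _) (sum-* (sumFin p) (- 1ℚ) _)) ⟩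
      P * sumFin p (λ c → [ y ⊕ c ⊗ 1F ≡0] * w (z ⊕ c ⊗ μ)) + (- 1ℚ) * sumFin p (λ c → w (z ⊕ c ⊗ μ))
        ≡⟨ cong₂ (λ u v → P * u + (- 1ℚ) * v) (trans (proj₂ (proj₂ line)) (cong w at-root)) (w-sum z μ n) ⟩
      P * w (z ⊕ ⊖ (y ⊗ μ)) + (- 1ℚ) * 0ℚ
        ≡⟨ trans (cong (P * w (z ⊕ ⊖ (y ⊗ μ)) +_) (*-zeroʳ (- 1ℚ))) (+-identityʳ (P * w (z ⊕ ⊖ (y ⊗ μ)))) ⟩
      P * w (z ⊕ ⊖ (y ⊗ μ)) ∎
      where
      open ≡-Reasoning
      line = sum-line y 1F 1≢0 (λ c → w (z ⊕ c ⊗ μ))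
      c₀ = proj₁ line
      at-root : z ⊕ c₀ ⊗ μ ≡ z ⊕ ⊖ (y ⊗ μ)
      at-root = begin
        z ⊕ c₀ ⊗ μ                            ≡⟨ 𝔽S.solve 4 (λ z c u y → z 𝔽S.:+ c 𝔽S.:* u 𝔽S.:= (y 𝔽S.:+ c 𝔽S.:* 𝔽S.con (1 , 0)) 𝔽S.:* u 𝔽S.:+ (z 𝔽S.:+ 𝔽S.:- (y 𝔽S.:* u))) refl z c₀ μ y ⟩
        (y ⊕ c₀ ⊗ 1F) ⊗ μ ⊕ (z ⊕ ⊖ (y ⊗ μ))   ≡⟨ cong (λ v → v ⊗ μ ⊕ (z ⊕ ⊖ (y ⊗ μ))) (proj₁ (proj₂ line)) ⟩
        0F ⊗ μ ⊕ (z ⊕ ⊖ (y ⊗ μ))              ≡⟨ trans (cong (_⊕ (z ⊕ ⊖ (y ⊗ μ))) (⊗-zeroˡ μ)) (⊕-identityˡ _) ⟩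
        z ⊕ ⊖ (y ⊗ μ)                         ∎

    module _ {m t : ℕ} (M : Matrix p m t) (n : ℕ) where

      X : Set
      X = Fin t → Vecp p n

      -- Points are functions, so a summand must be shown to depend on their values only before the
      -- sum can be reindexed.
      Ext : ∀ {A : Set} → (X → A) → Set
      Ext F = ∀ {x y} → (∀ j l → x j l ≡ y j l) → F x ≡ F y

      allX : SumOver ℚ X
      allX = sumPi t (sumPi n (sumFin p))

      sol∑ : (X → ℚ) → ℚ
      sol∑ F = allX (λ x → ind M x * F x)

      Z : ℚ
      Z = sol∑ (λ _ → 1ℚ)

      ind-cong : ∀ {x y : X} → (IsSol M x → IsSol M y) → (IsSol M y → IsSol M x) → ind M x ≡ ind M y
      ind-cong {x} {y} f g with isSol? M x | isSol? M y
      ... | yes _ | yes _ = refl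
      ... | yes a | no  b = contradiction (f a) b
      ... | no  a | yes b = contradiction (g b) a
      ... | no  _ | no  _ = refl

      ind-nonneg : ∀ (x : X) → 0ℚ ≤ ind M x
      ind-nonneg x with isSol? M x
      ... | yes _ = nonNegative⁻¹ 1ℚ
      ... | no  _ = ≤-refl

      Solves-cong : ∀ {x y : X} → (∀ j l → x j l ≡ y j l) → Solves M x → Solves M y
      Solves-cong e s i l = trans (∑-cong t (λ j → cong (M i j ⊗_) (sym (e j l)))) (s i l)

      ind-Solves : ∀ {x y : X} → (Solves M x → Solves M y) → (Solves M y → Solves M x) → ind M x ≡ ind M y
      ind-Solves f g = ind-cong (Solves⇒IsSol M ∘ f ∘ IsSol⇒Solves M) (Solves⇒IsSol M ∘ g ∘ IsSol⇒Solves M)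

      sol∑-cong : ∀ {F G} → (∀ x → Solves M x → F x ≡ G x) → sol∑ F ≡ sol∑ G
      sol∑-cong {F} {G} e = sum-cong allX go
        where
        go : ∀ x → ind M x * F x ≡ ind M x * G x
        go x with isSol? M x
        ... | yes s = cong (1ℚ *_) (e x (IsSol⇒Solves M s))
        ... | no  _ = trans (*-zeroˡ (F x)) (sym (*-zeroˡ (G x)))

      sol∑-* : ∀ c F → sol∑ (λ x → c * F x) ≡ c * sol∑ F
      sol∑-* c F = trans (sum-cong allX (λ x → ℚS.solve 3 (λ a b c → a ℚS.:* (b ℚS.:* c) ℚS.:= b ℚS.:* (a ℚS.:* c)) refl (ind M x) c (F x)))
        (sum-* allX c _)

      sol∑-mono : ∀ {F G} → (∀ x → F x ≤ G x) → sol∑ F ≤ sol∑ G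
      sol∑-mono {F} {G} e = sum-mono allX {λ x → ind M x * F x} {λ x → ind M x * G x} (λ x → *-monoˡ-≤-nonNeg (ind M x) {{nonNegative (ind-nonneg x)}} (e x))

      sol∑-swap : ∀ {B} (s : SumOver ℚ B) {{_ : Finite s}} (F : B → X → ℚ) →
        sol∑ (λ x → s (λ b → F b x)) ≡ s (λ b → sol∑ (F b))
      sol∑-swap s F = trans (sum-cong allX (λ x → sym (sum-* s (ind M x) _))) (sum-swap allX s _)

      sol∑-abs : ∀ c F → (∀ x → ∣ F x ∣ ≤ c) → ∣ sol∑ F ∣ ≤ c * Z
      sol∑-abs c F e = ≤-trans (sum-abs allX _) (≤-trans
        (≤-reflexive (sum-cong allX (λ x → trans (∣p*q∣≡∣p∣*∣q∣ (ind M x) (F x)) (cong (_* ∣ F x ∣) (0≤p⇒∣p∣≡p (ind-nonneg x))))))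
        (≤-trans (sol∑-mono e) (≤-reflexive (trans (sum-cong allX (λ x → cong (ind M x *_) (sym (*-identityʳ c)))) (sol∑-* c (λ _ → 1ℚ))))))

      -- Translation by a solution permutes the whole space and preserves the solution set.
      sol∑-shift : ∀ {F} → Ext F → ∀ y → Solves M y → ∀ c → sol∑ (λ x → F (x ⟨+ c · y ⟩)) ≡ sol∑ F
      sol∑-shift {F} ext y sol c = trans (sum-cong allX (λ x → cong (_* F (x ⟨+ c · y ⟩)) (ind-Solves (forth x) (back x))))
        (sumPi-transform (λ u v → ∀ l → u l ≡ v l) (λ _ → refl) (sumPi n (sumFin p)) t (λ j u l → u l ⊕ c ⊗ y j l)
          (λ j G resp → sumPi-transform _≡_ refl (sumFin p) n (λ l a → a ⊕ c ⊗ y j l)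
            (λ l H _ → sumFin-shift (c ⊗ y j l) H) G resp)
          (λ x → ind M x * F x) (λ e → cong₂ _*_ (ind-Solves (Solves-cong e) (Solves-cong (λ j l → sym (e j l)))) (ext e)))
        where
        rows : ∀ x i l → ∑ t (λ j → M i j ⊗ (x ⟨+ c · y ⟩) j l) ≡ ∑ t (λ j → M i j ⊗ x j l)
        rows x i l = trans (dot-linearʳ t (M i) (λ j → x j l) (λ j → y j l) c)
          (trans (cong (λ v → dot t (M i) (λ j → x j l) ⊕ c ⊗ v) (sol i l)) (trans (cong (_ ⊕_) (⊗-zeroʳ c)) (⊕-identityʳ _)))
        forth : ∀ x → Solves M x → Solves M (x ⟨+ c · y ⟩)
        forth x s i l = trans (rows x i l) (s i l)
        back : ∀ x → Solves M (x ⟨+ c · y ⟩) → Solves M x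
        back x s i l = trans (sym (rows x i l)) (s i l)

      sol∑-average : ∀ {F} → Ext F → ∀ y → Solves M y → P * sol∑ F ≡ sol∑ (λ x → sumFin p (λ c → F (x ⟨+ c · y ⟩)))
      sol∑-average {F} ext y sol = sym (trans (sol∑-swap (sumFin p) (λ c x → F (x ⟨+ c · y ⟩)))
        (trans (sum-cong (sumFin p) (sol∑-shift ext y sol)) (sumFin-const p (sol∑ F))))

      Invariant : X → (X → ℚ) → Set
      Invariant y R = ∀ x c → R (x ⟨+ c · y ⟩) ≡ R x

      MovesBy : X → 𝔽 → (X → 𝔽) → Set
      MovesBy y μ u = ∀ x c → u (x ⟨+ c · y ⟩) ≡ u x ⊕ c ⊗ μ

      -- Averaging along `y` leaves `R` alone and lets the argument of `w` run through all residues,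
      -- over which `w` sums to zero.
      kill : ∀ {y R u} → Solves M y → Ext R → Ext u → Invariant y R → MovesBy y 1F u →
        sol∑ (λ x → R x * w (u x)) ≡ 0ℚ
      kill {y} {R} {u} sol extR extu inv mv = P-cancel (begin
        P * sol∑ (λ x → R x * w (u x))
          ≡⟨ sol∑-average (λ e → cong₂ _*_ (extR e) (cong w (extu e))) y sol ⟩
        sol∑ (λ x → sumFin p (λ c → R (x ⟨+ c · y ⟩) * w (u (x ⟨+ c · y ⟩))))
          ≡⟨ sol∑-cong (λ x _ → trans (sum-cong (sumFin p) (λ c → cong₂ (λ a b → a * w b) (inv x c) (mv x c)))
               (trans (sum-* (sumFin p) (R x) _) (trans (cong (R x *_) (w-sum (u x) 1F 1≢0)) (*-comm (R x) 0ℚ)))) ⟩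
        sol∑ (λ x → 0ℚ * R x)
          ≡⟨ trans (sol∑-* 0ℚ R) (trans (*-zeroˡ (sol∑ R)) (sym (*-zeroʳ P))) ⟩
        P * 0ℚ ∎)
        where open ≡-Reasoning

      -- Averaging along `y` affects the two factors `w` only, and their convolution is a single `w`
      -- of the combination of `u` and `z` that is constant along `y`. One form has been eliminated.
      merge : ∀ {y R u z} μ → μ ≢ 0F → Solves M y → Ext R → Ext u → Ext z → Invariant y R → MovesBy y 1F u → MovesBy y μ z →
        sol∑ (λ x → R x * (w (u x) * w (z x))) ≡ sol∑ (λ x → R x * w (z x ⊕ ⊖ (u x ⊗ μ)))
      merge {y} {R} {u} {z} μ μ≢0 sol extR extu extz inv mvu mvz = P-cancel (begin
        P * sol∑ (λ x → R x * (w (u x) * w (z x)))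
          ≡⟨ sol∑-average (λ e → cong₂ _*_ (extR e) (cong₂ (λ a b → w a * w b) (extu e) (extz e))) y sol ⟩
        sol∑ (λ x → sumFin p (λ c → R (x ⟨+ c · y ⟩) * (w (u (x ⟨+ c · y ⟩)) * w (z (x ⟨+ c · y ⟩)))))
          ≡⟨ sol∑-cong (λ x _ → trans (sum-cong (sumFin p) (λ c → cong₂ _*_ (inv x c) (cong₂ (λ a b → w a * w b) (mvu x c) (mvz x c))))
               (trans (sum-* (sumFin p) (R x) _) (trans (cong (R x *_) (w-convolution (u x) (z x) μ μ≢0))
                 (ℚS.solve 3 (λ a b c → a ℚS.:* (b ℚS.:* c) ℚS.:= b ℚS.:* (a ℚS.:* c)) refl (R x) P (w (z x ⊕ ⊖ (u x ⊗ μ))))))) ⟩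
        sol∑ (λ x → P * (R x * w (z x ⊕ ⊖ (u x ⊗ μ))))
          ≡⟨ sol∑-* P _ ⟩
        P * sol∑ (λ x → R x * w (z x ⊕ ⊖ (u x ⊗ μ))) ∎)
        where open ≡-Reasoning

  -- Correlations of linear forms

  prod-mask-cong : ∀ k (j : Fin k) {f g : Fin k → ℚ} → (∀ i → i ≢ j → f i ≡ g i) → prodFin k (mask j f) ≡ prodFin k (mask j g)
  prod-mask-cong k j {f} {g} e = prod-cong k go
    where
    go : ∀ i → mask j f i ≡ mask j g i
    go i with i FinP.≟ j
    ... | yes refl = trans (mask-same j f) (sym (mask-same j g))
    ... | no  n    = trans (mask-other j i f n) (trans (e i n) (sym (mask-other j i g n)))

  module Correlations (p : ℕ) .{{_ : NonZero p}} (prime : Prime p) {m t : ℕ} (M : Matrix p m t) (n : ℕ) where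
    open Field p
    open Inverses prime
    open LinearAlgebra p prime
    open Averages p prime

    private
      Tab = Table {t} {n}
      S = sol∑ M n
      Zₙ = Z M n

    factor : Bool → 𝔽 → ℚ
    factor true  y = w y
    factor false y = 1ℚ

    1≤P : 1ℚ ≤ P
    1≤P = go p
      where
      go : ∀ k .{{_ : NonZero k}} → 1ℚ ≤ fromℕ k
      go (suc k) = subst (λ z → z ≤ 1ℚ + fromℕ k) (+-identityʳ 1ℚ) (+-monoʳ-≤ 1ℚ (fromℕ-nonneg k))

    w-bound : ∀ y → ∣ w y ∣ ≤ P
    w-bound y with y FinP.≟ 0F
    ... | yes _ = ≤-trans (≤-reflexive (0≤p⇒∣p∣≡p (subst (λ z → 0ℚ ≤ z) (cong (_- 1ℚ) (sym (*-identityʳ P)))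
          (subst (λ z → z ≤ P - 1ℚ) (+-inverseʳ 1ℚ) (+-monoˡ-≤ (- 1ℚ) 1≤P)))))
        (subst (λ z → P * 1ℚ - 1ℚ ≤ z) (trans (+-identityʳ (P * 1ℚ)) (*-identityʳ P)) (+-monoʳ-≤ (P * 1ℚ) (neg-antimono-≤ (nonNegative⁻¹ 1ℚ))))
    ... | no  _ = subst (λ z → ∣ z - 1ℚ ∣ ≤ P) (sym (*-zeroʳ P)) 1≤P

    factor-bound : ∀ b y → ∣ factor b y ∣ ≤ P
    factor-bound true  y = w-bound y
    factor-bound false y = 1≤P

    w0-nonneg : 0ℚ ≤ w 0F
    w0-nonneg = subst (λ z → 0ℚ ≤ P * z - 1ℚ) (sym ([≡0]-yes refl)) (subst (λ z → 0ℚ ≤ z - 1ℚ) (sym (*-identityʳ P))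
      (subst (λ z → z ≤ P - 1ℚ) (+-inverseʳ 1ℚ) (+-monoˡ-≤ (- 1ℚ) 1≤P)))

    -- One elimination step: a solution that changes, among the forms `u`, only `u i`. It has to
    -- change the pivot `z` too, since otherwise the sum would vanish instead of merging.
    record Move (s : ℕ) (u : Fin s → X M n → 𝔽) (z : X M n → 𝔽) (i : Fin s) : Set where
      field
        shift  : X M n
        solves : Solves M shift
        step   : 𝔽
        step≢0 : step ≢ 0F
        self   : MovesBy M n shift 1F (u i)
        others : ∀ j → j ≢ i → MovesBy M n shift 0F (u j)
        pivot  : MovesBy M n shift step z

    Steps : (s : ℕ) → (Fin s → Bool) → (Fin s → X M n → 𝔽) → (X M n → 𝔽) → Set
    Steps s b u z = ∀ i → (b i ≡ false × (∀ x → u i x ≡ 0F)) ⊎ (b i ≡ true × Move s u z i)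


    slope : ∀ {s b u z i} → (b ≡ false × (∀ x → u i x ≡ 0F)) ⊎ (b ≡ true × Move s u z i) → 𝔽
    slope (inj₁ _)       = 0F
    slope (inj₂ (_ , m)) = Move.step m

    -- Each `merge` absorbs one active factor into the pivot, which becomes `z - u i · slope i`;
    -- inactive factors are 1 and have slope 0.
    eliminate : ∀ s b u z → (∀ i → Ext M n (u i)) → Ext M n z → (st : Steps s b u z) →
      S (λ x → prodFin s (λ i → factor (b i) (u i x)) * w (z x)) ≡
      S (λ x → w (z x ⊕ ⊖ ∑ s (λ i → u i x ⊗ slope {s} {b i} {u} {z} {i} (st i))))
    eliminate zero b u z extu extz st = sol∑-cong M n (λ x _ → trans (*-identityˡ (w (z x))) (cong w
      (𝔽S.solve 1 (λ a → a 𝔽S.:= a 𝔽S.:+ 𝔽S.:- 𝔽S.con (0 , 0)) refl (z x))))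
    eliminate (suc s) b u z extu extz st with b zero | st zero
    ... | .false | inj₁ (refl , u0) = trans (sol∑-cong M n (λ x _ → cong (_* w (z x)) (*-identityˡ (prodFin s (λ i → factor (b (suc i)) (u (suc i) x))))))
        (trans (eliminate s (b ∘ suc) (u ∘ suc) z (λ i → extu (suc i)) extz st')
          (sol∑-cong M n (λ x _ → cong (λ v → w (z x ⊕ ⊖ v)) (trans (∑-cong s (λ i → cong (u (suc i) x ⊗_) (slope-st' i)))
            (sym (trans (cong (_⊕ rest x) (⊗-zeroʳ (u zero x))) (⊕-identityˡ (rest x))))))))
      where
      tail-move : ∀ {i} → Move (suc s) u z (suc i) → Move s (u ∘ suc) z i
      tail-move mv = record { Move mv ; others = λ j n → Move.others mv (suc j) (n ∘ FinP.suc-injective) }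
      tail-st : ∀ i → (b (suc i) ≡ false × (∀ x → u (suc i) x ≡ 0F)) ⊎ (b (suc i) ≡ true × Move (suc s) u z (suc i)) →
        (b (suc i) ≡ false × (∀ x → u (suc i) x ≡ 0F)) ⊎ (b (suc i) ≡ true × Move s (u ∘ suc) z i)
      tail-st i (inj₁ a)       = inj₁ a
      tail-st i (inj₂ (e , a)) = inj₂ (e , tail-move a)
      st' : Steps s (b ∘ suc) (u ∘ suc) z
      st' i = tail-st i (st (suc i))
      slope-st' : ∀ i → slope {s} {b (suc i)} {u ∘ suc} {z} {i} (st' i) ≡ slope {suc s} {b (suc i)} {u} {z} {suc i} (st (suc i))
      slope-st' i with st (suc i)
      ... | inj₁ _ = refl
      ... | inj₂ _ = refl
      rest : X M n → 𝔽
      rest x = ∑ s (λ i → u (suc i) x ⊗ slope {suc s} {b (suc i)} {u} {z} {suc i} (st (suc i)))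
    ... | .true | inj₂ (refl , m₀) = begin
        S (λ x → (w (u zero x) * R x) * w (z x))
          ≡⟨ sol∑-cong M n (λ x _ → ℚS.solve 3 (λ a b c → (a ℚS.:* b) ℚS.:* c ℚS.:= b ℚS.:* (a ℚS.:* c)) refl (w (u zero x)) (R x) (w (z x))) ⟩
        S (λ x → R x * (w (u zero x) * w (z x)))
          ≡⟨ merge M n step step≢0 solves R-ext (extu zero) extz R-inv self pivot ⟩
        S (λ x → R x * w (z' x))
          ≡⟨ eliminate s (b ∘ suc) (u ∘ suc) z' (λ i → extu (suc i)) (λ e → cong₂ (λ a c → a ⊕ ⊖ (c ⊗ step)) (extz e) (extu zero e)) st' ⟩
        S (λ x → w (z' x ⊕ ⊖ ∑ s (λ i → u (suc i) x ⊗ slope {s} {b (suc i)} {u ∘ suc} {z'} {i} (st' i))))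
          ≡⟨ sol∑-cong M n (λ x _ → cong w (trans (cong (λ v → z' x ⊕ ⊖ v) (∑-cong s (λ i → cong (u (suc i) x ⊗_) (slope-st' i))))
               (𝔽S.solve 3 (λ a b c → (a 𝔽S.:+ 𝔽S.:- b) 𝔽S.:+ 𝔽S.:- c 𝔽S.:= a 𝔽S.:+ 𝔽S.:- (b 𝔽S.:+ c)) refl (z x) (u zero x ⊗ step) (rest x)))) ⟩
        S (λ x → w (z x ⊕ ⊖ (u zero x ⊗ step ⊕ rest x))) ∎
      where
      open ≡-Reasoning
      open Move m₀
      R : X M n → ℚ
      R x = prodFin s (λ i → factor (b (suc i)) (u (suc i) x))
      R-ext : Ext M n R
      R-ext e = prod-cong s (λ i → cong (factor (b (suc i))) (extu (suc i) e))
      R-inv : Invariant M n shift R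
      R-inv x c = prod-cong s (λ i → cong (factor (b (suc i))) (trans (others (suc i) (λ ()) x c)
        (trans (cong (u (suc i) x ⊕_) (⊗-zeroʳ c)) (⊕-identityʳ (u (suc i) x)))))
      z' : X M n → 𝔽
      z' x = z x ⊕ ⊖ (u zero x ⊗ step)
      tail-st : ∀ i → (b (suc i) ≡ false × (∀ x → u (suc i) x ≡ 0F)) ⊎ (b (suc i) ≡ true × Move (suc s) u z (suc i)) →
        (b (suc i) ≡ false × (∀ x → u (suc i) x ≡ 0F)) ⊎ (b (suc i) ≡ true × Move s (u ∘ suc) z' i)
      tail-st i (inj₁ a)       = inj₁ a
      tail-st i (inj₂ (e , a)) = inj₂ (e , record
        { shift = Move.shift a ; solves = Move.solves a ; step = Move.step a ; step≢0 = Move.step≢0 a ; self = Move.self a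
        ; others = λ j n → Move.others a (suc j) (n ∘ FinP.suc-injective)
        -- The new pivot moves by the same step as the old one, because the remaining moves do not
        -- change `u zero`.
        ; pivot = λ x c → trans (cong₂ (λ f g → f ⊕ ⊖ (g ⊗ step)) (Move.pivot a x c) (Move.others a zero (λ ()) x c))
            (𝔽S.solve 5 (λ z c u v s → (z 𝔽S.:+ c 𝔽S.:* u) 𝔽S.:+ 𝔽S.:- ((v 𝔽S.:+ c 𝔽S.:* 𝔽S.con (0 , 0)) 𝔽S.:* s)
              𝔽S.:= (z 𝔽S.:+ 𝔽S.:- (v 𝔽S.:* s)) 𝔽S.:+ c 𝔽S.:* u) refl (z x) c (Move.step a) (u zero x) step) })
      st' : Steps s (b ∘ suc) (u ∘ suc) z'
      st' i = tail-st i (st (suc i))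
      slope-st' : ∀ i → slope {s} {b (suc i)} {u ∘ suc} {z'} {i} (st' i) ≡ slope {suc s} {b (suc i)} {u} {z} {suc i} (st (suc i))
      slope-st' i with st (suc i)
      ... | inj₁ _ = refl
      ... | inj₂ _ = refl
      rest : X M n → 𝔽
      rest x = ∑ s (λ i → u (suc i) x ⊗ slope {suc s} {b (suc i)} {u} {z} {suc i} (st (suc i)))

    form : Tab → Fin t → X M n → 𝔽
    form L j x = dot n (L j) (x j)

    form-ext : ∀ L j → Ext M n (form L j)
    form-ext L j e = dot-cong n {u = L j} (λ _ → refl) (e j)

    form-moves : ∀ L j y {μ} → form L j y ≡ μ → MovesBy M n y μ (form L j)
    form-moves L j y e x c = trans (dot-linearʳ n (L j) (x j) (y j) c) (cong (λ v → form L j x ⊕ c ⊗ v) e)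

    corr : (Fin t → Bool) → Tab → ℚ
    corr b L = S (λ x → prodFin t (λ j → factor (b j) (form L j x)))

    corr-bound : ∀ b L → ∣ corr b L ∣ ≤ prodFin t (λ _ → P) * Zₙ
    corr-bound b L = sol∑-abs M n _ _ (λ x → ≤-trans (≤-reflexive (prod-abs t _))
      (prod-mono t (λ j → 0≤∣p∣ _) (λ j → factor-bound (b j) (form L j x))))

    corr-extract : ∀ b L j → b j ≡ true →
      corr b L ≡ S (λ x → prodFin t (mask j (λ i → factor (b i) (form L i x))) * w (form L j x))
    corr-extract b L j e = sol∑-cong M n (λ x _ → trans (prod-extract t j _)
      (trans (cong (λ c → factor c (form L j x) * prodFin t (mask j (λ i → factor (b i) (form L i x)))) e) (*-comm (w (form L j x)) _)))

    -- The isolating solution is a direction along which only the factor at `j` moves.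
    corr-isolated : ∀ b L j → b j ≡ true → ∃ (Isolates M L j) → corr b L ≡ 0ℚ
    corr-isolated b L j e (y , sol , one , zeros) = trans (corr-extract b L j e) (kill M n sol
      (λ eq → prod-mask-cong t j (λ i _ → cong (factor (b i)) (form-ext L i eq)))
      (form-ext L j)
      (λ x c → prod-mask-cong t j (λ i i≢j → cong (factor (b i)) (trans (form-moves L i y (zeros i i≢j) x c)
        (trans (cong (form L i x ⊕_) (⊗-zeroʳ c)) (⊕-identityʳ (form L i x))))))
      (form-moves L j y one))

    -- If the active forms satisfy a single relation, and any of them other than a pivot can be moved
    -- without affecting the others except the pivot, then they are uniform on a hyperplane.
    corr-hyperplane : ∀ b L j₁ → b j₁ ≡ true → (∀ i → b i ≡ false → ∀ l → L i l ≡ 0F) →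
      (ν : Fin t → 𝔽) → (∀ x → Solves M x → ∑ t (λ i → ν i ⊗ form L i x) ≡ 0F) → (∀ i → b i ≡ true → ν i ≢ 0F) →
      (∀ i → b i ≡ true → i ≢ j₁ → ∃ λ y → Solves M y × form L i y ≡ 1F × (∀ i' → i' ≢ i → i' ≢ j₁ → form L i' y ≡ 0F)) →
      corr b L ≡ w 0F * Zₙ
    corr-hyperplane b L j₁ b₁ inactive ν rel ν≢0 moves = begin
      corr b L
        ≡⟨ corr-extract b L j₁ b₁ ⟩
      S (λ x → prodFin t (mask j₁ (λ i → factor (b i) (form L i x))) * w (form L j₁ x))
        ≡⟨ sol∑-cong M n (λ x _ → cong (_* w (form L j₁ x)) (prod-cong t (masked x))) ⟩
      S (λ x → prodFin t (λ i → factor (b' i) (u i x)) * w (form L j₁ x))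
        ≡⟨ eliminate t b' u (form L j₁) u-ext (form-ext L j₁) st ⟩
      S (λ x → w (form L j₁ x ⊕ ⊖ ∑ t (λ i → u i x ⊗ sl i)))
        ≡⟨ sol∑-cong M n (λ x sol → trans (cong w (on-solutions x sol)) (sym (*-identityʳ (w 0F)))) ⟩
      S (λ x → w 0F * 1ℚ)
        ≡⟨ sol∑-* M n (w 0F) (λ _ → 1ℚ) ⟩
      w 0F * Zₙ ∎
      where
      open ≡-Reasoning
      -- The factor at `j₁` is the pivot and stands outside the product, so its own position counts
      -- as inactive.
      b' : Fin t → Bool
      b' i with i FinP.≟ j₁
      ... | yes _ = false
      ... | no  _ = b i
      u : Fin t → X M n → 𝔽
      u i x with i FinP.≟ j₁
      ... | yes _ = 0F
      ... | no  _ = form L i x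
      u-ext : ∀ i → Ext M n (u i)
      u-ext i e with i FinP.≟ j₁
      ... | yes _ = refl
      ... | no  _ = form-ext L i e
      masked : ∀ x i → mask j₁ (λ i → factor (b i) (form L i x)) i ≡ factor (b' i) (u i x)
      masked x i with i FinP.≟ j₁
      ... | yes refl = mask-same j₁ (λ i → factor (b i) (form L i x))
      ... | no  n    = mask-other j₁ i (λ i → factor (b i) (form L i x)) n
      u-moves : ∀ y i {μ} → form L i y ≡ μ → i ≢ j₁ → MovesBy M n y μ (u i)
      u-moves y i e n x c with i FinP.≟ j₁
      ... | yes eq = contradiction eq n
      ... | no  _  = form-moves L i y e x c
      u-still : ∀ y i → (i ≢ j₁ → form L i y ≡ 0F) → MovesBy M n y 0F (u i)
      u-still y i e x c with i FinP.≟ j₁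
      ... | yes _ = sym (trans (⊕-identityˡ (c ⊗ 0F)) (⊗-zeroʳ c))
      ... | no  n = form-moves L i y (e n) x c
      -- At the move `y` of `i` only two terms of the relation survive. Hence the slope at `i` is
      -- `- ν i / ν j₁`, which is nonzero.
      rel-at : ∀ i → i ≢ j₁ → ∀ y → Solves M y → form L i y ≡ 1F → (∀ i' → i' ≢ i → i' ≢ j₁ → form L i' y ≡ 0F) →
        ν i ⊕ ν j₁ ⊗ form L j₁ y ≡ 0F
      rel-at i i≢j₁ y sol one zeros = trans (sym (trans (∑-cong t split) (trans (∑-⊕ t _ _)
          (cong₂ _⊕_ (dot-δ t ν i) (trans (∑-⊗ t (ν j₁ ⊗ form L j₁ y) _) (trans (cong ((ν j₁ ⊗ form L j₁ y) ⊗_) (∑δ j₁)) (⊗-identityʳ _))))))) (rel y sol)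
        where
        ∑δ : ∀ {k} (j : Fin k) → ∑ k (δ j) ≡ 1F
        ∑δ {k} j = trans (∑-single k j (δ j) (λ i n → δ-other n)) (δ-same j)
        split : ∀ i' → ν i' ⊗ form L i' y ≡ ν i' ⊗ δ i i' ⊕ (ν j₁ ⊗ form L j₁ y) ⊗ δ j₁ i'
        split i' with i' FinP.≟ i | i' FinP.≟ j₁
        ... | yes refl | yes e = contradiction e i≢j₁
        ... | yes refl | no  n rewrite δ-same i' | δ-other n | one =
          𝔽S.solve 2 (λ a c → a 𝔽S.:* 𝔽S.con (1 , 0) 𝔽S.:= a 𝔽S.:* 𝔽S.con (1 , 0) 𝔽S.:+ c 𝔽S.:* 𝔽S.con (0 , 0)) refl (ν i') (ν j₁ ⊗ form L j₁ y)
        ... | no  n | yes refl rewrite δ-other n | δ-same i' =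
          𝔽S.solve 2 (λ a c → c 𝔽S.:= a 𝔽S.:* 𝔽S.con (0 , 0) 𝔽S.:+ c 𝔽S.:* 𝔽S.con (1 , 0)) refl (ν i') (ν i' ⊗ form L i' y)
        ... | no  n | no  n' rewrite δ-other n | δ-other n' | zeros i' n n' =
          𝔽S.solve 2 (λ a c → a 𝔽S.:* 𝔽S.con (0 , 0) 𝔽S.:= a 𝔽S.:* 𝔽S.con (0 , 0) 𝔽S.:+ c 𝔽S.:* 𝔽S.con (0 , 0)) refl (ν i') (ν j₁ ⊗ form L j₁ y)
      move-at : ∀ i → b i ≡ true → i ≢ j₁ → Move t u (form L j₁) i
      move-at i bi n with moves i bi n
      ... | y , sol , one , zeros = record
        { shift = y ; solves = sol ; step = form L j₁ y
        ; step≢0 = λ e → ν≢0 i bi (trans (sym (trans (cong (λ v → ν i ⊕ ν j₁ ⊗ v) e)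
            (trans (cong (ν i ⊕_) (⊗-zeroʳ (ν j₁))) (⊕-identityʳ (ν i))))) (rel-at i n y sol one zeros))
        ; self = u-moves y i one n
        ; others = λ i' i'≢i → u-still y i' (zeros i' i'≢i)
        ; pivot = form-moves L j₁ y refl }
      move-relation : ∀ i (bi : b i ≡ true) (n : i ≢ j₁) → ν i ⊕ ν j₁ ⊗ Move.step (move-at i bi n) ≡ 0F
      move-relation i bi n with moves i bi n
      ... | y , sol , one , zeros = rel-at i n y sol one zeros
      status : ∀ i → (b' i ≡ false × (∀ x → u i x ≡ 0F)) ⊎ (Σ (b i ≡ true) λ _ → i ≢ j₁ × b' i ≡ true)
      status i with i FinP.≟ j₁
      ... | yes _ = inj₁ (refl , λ _ → refl)
      ... | no  n with b i in eq
      ...   | true  = inj₂ (refl , n , refl)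
      ...   | false = inj₁ (refl , λ x → ∑-0 _ (λ l → trans (cong (_⊗ x i l) (inactive i eq l)) (⊗-zeroˡ (x i l))))
      toStep : ∀ i → (b' i ≡ false × (∀ x → u i x ≡ 0F)) ⊎ (Σ (b i ≡ true) λ _ → i ≢ j₁ × b' i ≡ true) →
        (b' i ≡ false × (∀ x → u i x ≡ 0F)) ⊎ (b' i ≡ true × Move t u (form L j₁) i)
      toStep i (inj₁ a)              = inj₁ a
      toStep i (inj₂ (bi , n , b'i)) = inj₂ (b'i , move-at i bi n)
      st : Steps t b' u (form L j₁)
      st i = toStep i (status i)
      sl : Fin t → 𝔽
      sl i = slope {t} {b' i} {u} {form L j₁} {i} (st i)
      slopes : ∀ i x → ν j₁ ⊗ (u i x ⊗ sl i) ≡ ⊖ (ν i ⊗ u i x)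
      slopes i x with status i
      ... | inj₁ (_ , u0) rewrite u0 x = 𝔽S.solve 2 (λ a c → a 𝔽S.:* (𝔽S.con (0 , 0) 𝔽S.:* 𝔽S.con (0 , 0)) 𝔽S.:= 𝔽S.:- (c 𝔽S.:* 𝔽S.con (0 , 0))) refl (ν j₁) (ν i)
      ... | inj₂ (bi , n , _) = begin
          ν j₁ ⊗ (u i x ⊗ s)
            ≡⟨ 𝔽S.solve 4 (λ a u s v → a 𝔽S.:* (u 𝔽S.:* s) 𝔽S.:= (v 𝔽S.:+ a 𝔽S.:* s) 𝔽S.:* u 𝔽S.:+ 𝔽S.:- (v 𝔽S.:* u)) refl (ν j₁) (u i x) s (ν i) ⟩
          (ν i ⊕ ν j₁ ⊗ s) ⊗ u i x ⊕ ⊖ (ν i ⊗ u i x)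
            ≡⟨ cong (λ v → v ⊗ u i x ⊕ ⊖ (ν i ⊗ u i x)) (move-relation i bi n) ⟩
          0F ⊗ u i x ⊕ ⊖ (ν i ⊗ u i x)
            ≡⟨ trans (cong (_⊕ ⊖ (ν i ⊗ u i x)) (⊗-zeroˡ (u i x))) (⊕-identityˡ _) ⟩
          ⊖ (ν i ⊗ u i x) ∎
        where s = Move.step (move-at i bi n)
      relation-split : ∀ x → ∑ t (λ i → ν i ⊗ form L i x) ≡ ν j₁ ⊗ form L j₁ x ⊕ ∑ t (λ i → ν i ⊗ u i x)
      relation-split x = trans (∑-cong t pointwise) (trans (∑-⊕ t _ _) (cong (_⊕ ∑ t (λ i → ν i ⊗ u i x)) (dot-δ t (λ i → ν i ⊗ form L i x) j₁)))
        where
        pointwise : ∀ i → ν i ⊗ form L i x ≡ (ν i ⊗ form L i x) ⊗ δ j₁ i ⊕ ν i ⊗ u i x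
        pointwise i with i FinP.≟ j₁
        ... | yes refl rewrite δ-same j₁ = 𝔽S.solve 2 (λ a c → a 𝔽S.:= a 𝔽S.:* 𝔽S.con (1 , 0) 𝔽S.:+ c 𝔽S.:* 𝔽S.con (0 , 0)) refl (ν j₁ ⊗ form L j₁ x) (ν j₁)
        ... | no  n rewrite δ-other n = 𝔽S.solve 1 (λ a → a 𝔽S.:= a 𝔽S.:* 𝔽S.con (0 , 0) 𝔽S.:+ a) refl (ν i ⊗ form L i x)
      -- Up to the factor `ν j₁`, the argument that remains is the relation itself, so `w` is taken
      -- at 0 on every solution.
      on-solutions : ∀ x → Solves M x → form L j₁ x ⊕ ⊖ ∑ t (λ i → u i x ⊗ sl i) ≡ 0F
      on-solutions x sol = ⊗≡0 (begin
          ν j₁ ⊗ (form L j₁ x ⊕ ⊖ ∑ t (λ i → u i x ⊗ sl i))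
            ≡⟨ 𝔽S.solve 3 (λ a f s → a 𝔽S.:* (f 𝔽S.:+ 𝔽S.:- s) 𝔽S.:= a 𝔽S.:* f 𝔽S.:+ 𝔽S.:- (a 𝔽S.:* s)) refl (ν j₁) (form L j₁ x) (∑ t (λ i → u i x ⊗ sl i)) ⟩
          ν j₁ ⊗ form L j₁ x ⊕ ⊖ (ν j₁ ⊗ ∑ t (λ i → u i x ⊗ sl i))
            ≡⟨ cong (λ v → ν j₁ ⊗ form L j₁ x ⊕ ⊖ v) (trans (sym (∑-⊗ t (ν j₁) _)) (∑-cong t (λ i → trans (slopes i x)
                 (𝔽S.solve 1 (λ a → 𝔽S.:- a 𝔽S.:= (𝔽S.:- 𝔽S.con (1 , 0)) 𝔽S.:* a) refl (ν i ⊗ u i x))))) ⟩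
          ν j₁ ⊗ form L j₁ x ⊕ ⊖ ∑ t (λ i → (⊖ 1F) ⊗ (ν i ⊗ u i x))
            ≡⟨ cong (λ v → ν j₁ ⊗ form L j₁ x ⊕ ⊖ v) (∑-⊗ t (⊖ 1F) _) ⟩
          ν j₁ ⊗ form L j₁ x ⊕ ⊖ ((⊖ 1F) ⊗ ∑ t (λ i → ν i ⊗ u i x))
            ≡⟨ 𝔽S.solve 2 (λ a s → a 𝔽S.:+ 𝔽S.:- ((𝔽S.:- 𝔽S.con (1 , 0)) 𝔽S.:* s) 𝔽S.:= a 𝔽S.:+ s) refl (ν j₁ ⊗ form L j₁ x) (∑ t (λ i → ν i ⊗ u i x)) ⟩
          ν j₁ ⊗ form L j₁ x ⊕ ∑ t (λ i → ν i ⊗ u i x)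
            ≡⟨ trans (sym (relation-split x)) (rel x sol) ⟩
          0F ∎) (ν≢0 j₁ b₁)

  -- Lengths of equations and sizes of assignments

  sumℕ-cong : ∀ t {f g : Fin t → ℕ} → (∀ j → f j ≡ g j) → sumℕ t f ≡ sumℕ t g
  sumℕ-cong zero    e = refl
  sumℕ-cong (suc t) e = cong₂ ℕ._+_ (e zero) (sumℕ-cong t (e ∘ suc))

  sumℕ-mono : ∀ t {f g : Fin t → ℕ} → (∀ j → f j ℕ.≤ g j) → sumℕ t f ℕ.≤ sumℕ t g
  sumℕ-mono zero    e = z≤n
  sumℕ-mono (suc t) e = ℕP.+-mono-≤ (e zero) (sumℕ-mono t (e ∘ suc))

  sumℕ-+ : ∀ t (f g : Fin t → ℕ) → sumℕ t (λ j → f j ℕ.+ g j) ≡ sumℕ t f ℕ.+ sumℕ t g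
  sumℕ-+ zero    f g = refl
  sumℕ-+ (suc t) f g rewrite sumℕ-+ t (f ∘ suc) (g ∘ suc) =
    NS.solve 4 (λ a b c d → (a NS.:+ b) NS.:+ (c NS.:+ d) NS.:= (a NS.:+ c) NS.:+ (b NS.:+ d)) refl
      (f zero) (g zero) (sumℕ t (f ∘ suc)) (sumℕ t (g ∘ suc))

  sumℕ-0 : ∀ t → sumℕ t (λ _ → 0) ≡ 0
  sumℕ-0 zero    = refl
  sumℕ-0 (suc t) = sumℕ-0 t

  sumℕ-1 : ∀ t → sumℕ t (λ _ → 1) ≡ t
  sumℕ-1 zero    = refl
  sumℕ-1 (suc t) = cong suc (sumℕ-1 t)

  sumℕ-swap : ∀ s t (f : Fin s → Fin t → ℕ) → sumℕ s (λ i → sumℕ t (f i)) ≡ sumℕ t (λ j → sumℕ s (λ i → f i j))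
  sumℕ-swap zero    t f = sym (sumℕ-0 t)
  sumℕ-swap (suc s) t f = trans (cong (sumℕ t (f zero) ℕ.+_) (sumℕ-swap s t (f ∘ suc))) (sym (sumℕ-+ t (f zero) _))

  omit : ∀ {t} → Fin t → (Fin t → ℕ) → Fin t → ℕ
  omit j f i with i FinP.≟ j
  ... | yes _ = 0
  ... | no  _ = f i

  omit-other : ∀ {t} (j : Fin t) f {i} → i ≢ j → omit j f i ≡ f i
  omit-other j f {i} n with i FinP.≟ j
  ... | yes e = contradiction e n
  ... | no  _ = refl

  sumℕ-single : ∀ t (j : Fin t) f → (∀ i → i ≢ j → f i ≡ 0) → sumℕ t f ≡ f j
  sumℕ-single (suc t) zero    f e = trans (cong (f zero ℕ.+_) (trans (sumℕ-cong t (λ i → e (suc i) λ ())) (sumℕ-0 t))) (ℕP.+-identityʳ (f zero))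
  sumℕ-single (suc t) (suc j) f e = cong₂ ℕ._+_ (e zero λ ()) (sumℕ-single t j (f ∘ suc) (λ i n → e (suc i) (n ∘ FinP.suc-injective)))

  sumℕ-omit : ∀ t (j : Fin t) f → sumℕ t f ≡ f j ℕ.+ sumℕ t (omit j f)
  sumℕ-omit t j f = trans (sumℕ-cong t split) (trans (sumℕ-+ t only (omit j f)) (cong (ℕ._+ sumℕ t (omit j f)) (trans (sumℕ-single t j only only-other) only-same)))
    where
    only : Fin t → ℕ
    only i with i FinP.≟ j
    ... | yes _ = f i
    ... | no  _ = 0
    only-same : only j ≡ f j
    only-same with j FinP.≟ j
    ... | yes _ = refl
    ... | no  n = contradiction refl n
    only-other : ∀ i → i ≢ j → only i ≡ 0
    only-other i n with i FinP.≟ j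
    ... | yes e = contradiction e n
    ... | no  _ = refl
    split : ∀ i → f i ≡ only i ℕ.+ omit j f i
    split i with i FinP.≟ j
    ... | yes _ = sym (ℕP.+-identityʳ (f i))
    ... | no  _ = refl

  sumℕ-≤1 : ∀ t (f : Fin t → ℕ) → (∀ j → f j ℕ.≤ 1) → (∀ i j → f i ≢ 0 → f j ≢ 0 → i ≡ j) → sumℕ t f ℕ.≤ 1
  sumℕ-≤1 t f le uniq with FinP.any? (λ j → ¬? (f j ℕP.≟ 0))
  ... | yes (j , n) = ℕP.≤-trans (ℕP.≤-reflexive (sumℕ-single t j f
          (λ i i≢j → decidable-stable (f i ℕP.≟ 0) (λ n' → i≢j (uniq i j n' n))))) (le j)
  ... | no  none = ℕP.≤-trans (ℕP.≤-reflexive (trans (sumℕ-cong t (λ i → decidable-stable (f i ℕP.≟ 0) (λ n → none (i , n)))) (sumℕ-0 t))) z≤n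

  module Lengths (p : ℕ) .{{_ : NonZero p}} where
    open Field p

    -- The summand of eqLength, which is local to its definition, recovered by unification.
    private
      summand : ∀ {t} (v : Fin t → ℕ) → Σ (Fin t → ℕ) λ f → eqLength v ≡ sumℕ t f
      summand v = _ , refl

      summand-zero : ∀ {t} (v : Fin t → ℕ) j → v j ≡ 0 → proj₁ (summand v) j ≡ 0
      summand-zero v j e rewrite e = refl

      summand-≤1 : ∀ {t} (v : Fin t → ℕ) j → proj₁ (summand v) j ℕ.≤ 1
      summand-≤1 v j with v j
      ... | zero  = z≤n
      ... | suc _ = s≤s z≤n

    eqLength-≤ : ∀ {t} (v g : Fin t → ℕ) → (∀ j → v j ≡ 0 ⊎ 1 ℕ.≤ g j) → eqLength v ℕ.≤ sumℕ t g
    eqLength-≤ {t} v g h = sumℕ-mono t (λ j → bound j (h j))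
      where
      bound : ∀ j → v j ≡ 0 ⊎ 1 ℕ.≤ g j → proj₁ (summand v) j ℕ.≤ g j
      bound j (inj₁ e)   = subst (ℕ._≤ g j) (sym (summand-zero v j e)) z≤n
      bound j (inj₂ 1≤g) = ℕP.≤-trans (summand-≤1 v j) 1≤g

    MinLength : ∀ {m t} → Matrix p m t → ℕ → Set
    MinLength M s = ∀ c → NonzeroEq (combo M c) → s ℕ.≤ eqLength (combo M c)

    -- The length bound in the form in which it is applied: `g` majorises the support of the
    -- combination, so it is enough to count the positions not yet known to vanish.
    short⇒zero : ∀ {m t} (M : Matrix p m t) {s} → MinLength M s → ∀ (c : Fin m → 𝔽) (g : Fin t → ℕ) →
      (∀ j → ∑ m (λ i → c i ⊗ M i j) ≡ 0F ⊎ 1 ℕ.≤ g j) → sumℕ t g ℕ.< s → ∀ j → ∑ m (λ i → c i ⊗ M i j) ≡ 0F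
    short⇒zero {m} {t} M minlen c g sup short j =
      decidable-stable (_ FinP.≟ 0F) λ n → ℕP.<⇒≱ short (ℕP.≤-trans
        (minlen c (j , λ e → n (toℕ≡0 (trans (sym (combo-toℕ j)) e))))
        (eqLength-≤ (combo M c) g λ i → support i (sup i)))
      where
      combo-toℕ : ∀ i → combo M c i ≡ toℕ (∑ m (λ i' → c i' ⊗ M i' i))
      combo-toℕ i = toℕ-∑ m c (λ i' → M i' i)
      support : ∀ i → ∑ m (λ i' → c i' ⊗ M i' i) ≡ 0F ⊎ 1 ℕ.≤ g i → combo M c i ≡ 0 ⊎ 1 ℕ.≤ g i
      support i (inj₁ e) = inj₁ (trans (combo-toℕ i) (trans (cong toℕ e) toℕ-0F))
      support i (inj₂ l) = inj₂ l

  -- The forms ℓ and ℓ_{a,i}; none is assigned to the variables outside S.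
  data Pt (ρ k' : ℕ) : Set where
    none   : Pt ρ k'
    centre : Pt ρ k'
    petal  : Fin ρ → Fin k' → Pt ρ k'

  petal-injective : ∀ {ρ k'} {a b : Fin ρ} {i j : Fin k'} → petal a i ≡ petal b j → a ≡ b × i ≡ j
  petal-injective refl = refl , refl

  _≟ᴾ_ : ∀ {ρ k'} (P Q : Pt ρ k') → Dec (P ≡ Q)
  none      ≟ᴾ none      = yes refl
  none      ≟ᴾ centre    = no λ ()
  none      ≟ᴾ petal _ _ = no λ ()
  centre    ≟ᴾ none      = no λ ()
  centre    ≟ᴾ centre    = yes refl
  centre    ≟ᴾ petal _ _ = no λ ()
  petal _ _ ≟ᴾ none      = no λ ()
  petal _ _ ≟ᴾ centre    = no λ ()
  petal a i ≟ᴾ petal b j with a FinP.≟ b | i FinP.≟ j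
  ... | yes refl | yes refl = yes refl
  ... | no  n    | _        = no (n ∘ proj₁ ∘ petal-injective)
  ... | _        | no  n    = no (n ∘ proj₂ ∘ petal-injective)

  isPt : ∀ {ρ k'} → Pt ρ k' → Bool
  isPt none        = false
  isPt centre      = true
  isPt (petal _ _) = true

  size : ∀ {ρ k'} → Pt ρ k' → ℕ
  size none        = 0
  size centre      = 1
  size (petal _ _) = 1

  size-≢none : ∀ {ρ k'} {P : Pt ρ k'} → P ≢ none → size P ≡ 1
  size-≢none {P = none}      n = contradiction refl n
  size-≢none {P = centre}    n = refl
  size-≢none {P = petal _ _} n = refl

  isPt-≢none : ∀ {ρ k'} {P : Pt ρ k'} → P ≢ none → isPt P ≡ true
  isPt-≢none {P = none}      n = contradiction refl n
  isPt-≢none {P = centre}    n = refl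
  isPt-≢none {P = petal _ _} n = refl

  isPt-true : ∀ {ρ k'} {P : Pt ρ k'} → isPt P ≡ true → P ≢ none
  isPt-true {P = centre}    _ ()
  isPt-true {P = petal _ _} _ ()

  isPt-false : ∀ {ρ k'} {P : Pt ρ k'} → isPt P ≡ false → P ≡ none
  isPt-false {P = none} _ = refl

  N : ∀ {t ρ k'} → (Fin t → Pt ρ k') → ℕ
  N {t} α = sumℕ t (size ∘ α)

  N-remove2 : ∀ {t ρ k'} (α : Fin t → Pt ρ k') {i j} → i ≢ j → α i ≢ none → α j ≢ none →
    N α ≡ 2 ℕ.+ sumℕ t (omit j (omit i (size ∘ α)))
  N-remove2 {t} α {i} {j} i≢j αi αj = trans (sumℕ-omit t i (size ∘ α)) (cong₂ ℕ._+_ (size-≢none αi)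
    (trans (sumℕ-omit t j (omit i (size ∘ α))) (cong (ℕ._+ sumℕ t (omit j (omit i (size ∘ α))))
      (trans (omit-other i (size ∘ α) (i≢j ∘ sym)) (size-≢none αj)))))

  some : ∀ {t ρ k'} (α : Fin t → Pt ρ k') → 0 ℕ.< N α → ∃ λ j → α j ≢ none
  some {t} α 0<N with FinP.any? (λ j → ¬? (α j ≟ᴾ none))
  ... | yes r = r
  ... | no  n = contradiction (trans (sumℕ-cong t (λ j → cong size (decidable-stable (α j ≟ᴾ none) (λ q → n (j , q))))) (sumℕ-0 t))
                  (ℕP.>⇒≢ 0<N)

  third : ∀ {t ρ k'} (α : Fin t → Pt ρ k') → 3 ℕ.≤ N α → ∀ i j → i ≢ j → α i ≢ none → α j ≢ none →
    ∃ λ l → α l ≢ none × l ≢ i × l ≢ j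
  third {t} α 3≤N i j i≢j αi αj with FinP.any? (λ l → ¬? (α l ≟ᴾ none) ×-dec (¬? (l FinP.≟ i) ×-dec ¬? (l FinP.≟ j)))
  ... | yes r = r
  ... | no  n = contradiction 3≤N (ℕP.<⇒≱ (ℕP.≤-reflexive (cong suc (trans (N-remove2 α i≢j αi αj)
        (cong (2 ℕ.+_) (trans (sumℕ-cong t vanish) (sumℕ-0 t)))))))
    where
    vanish : ∀ l → omit j (omit i (size ∘ α)) l ≡ 0
    vanish l with l FinP.≟ j
    ... | yes _ = refl
    ... | no  l≢j with l FinP.≟ i
    ...   | yes _ = refl
    ...   | no  l≢i with α l ≟ᴾ none
    ...     | yes e = cong size e
    ...     | no  q = contradiction (l , q , l≢i , l≢j) n

  -- The configuration of linear forms

  module Configuration (p : ℕ) .{{_ : NonZero p}} (prime : Prime p) {k' : ℕ} (Ψ : Matrix p 2 (suc k'))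
    (minlen : Lengths.MinLength p Ψ k') (full : FullRank Ψ) (0<k' : 0 ℕ.< k') (ρ : ℕ) where
    open Field p
    open Inverses prime
    open LinearAlgebra p prime
    open Lengths p

    ψ₀ ψ₁ : Fin (suc k') → 𝔽
    ψ₀ = Ψ zero
    ψ₁ = Ψ (suc zero)

    det : Fin (suc k') → Fin (suc k') → 𝔽
    det i j = ψ₀ i ⊗ ψ₁ j ⊕ ⊖ (ψ₁ i ⊗ ψ₀ j)

    private
      pair : 𝔽 → 𝔽 → Fin 2 → 𝔽
      pair a b zero    = a
      pair a b (suc _) = b

      cross : Fin (suc k') → Fin 2 → 𝔽
      cross j = pair (ψ₁ j) (⊖ ψ₀ j)

      comb : (Fin 2 → 𝔽) → Fin (suc k') → 𝔽
      comb c j = ∑ 2 (λ i → c i ⊗ Ψ i j)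

      comb-pair : ∀ a b j → comb (pair a b) j ≡ a ⊗ ψ₀ j ⊕ b ⊗ ψ₁ j
      comb-pair a b j = cong (a ⊗ ψ₀ j ⊕_) (⊕-identityʳ (b ⊗ ψ₁ j))

      comb-cross : ∀ j l → comb (cross j) l ≡ det l j
      comb-cross j l = trans (comb-pair (ψ₁ j) (⊖ ψ₀ j) l) (𝔽S.solve 4 (λ a b c d → b 𝔽S.:* c 𝔽S.:+ (𝔽S.:- a) 𝔽S.:* d
        𝔽S.:= c 𝔽S.:* b 𝔽S.:+ 𝔽S.:- (d 𝔽S.:* a)) refl (ψ₀ j) (ψ₁ j) (ψ₀ l) (ψ₁ l))

      det-self : ∀ j → det j j ≡ 0F
      det-self j = 𝔽S.solve 2 (λ a b → a 𝔽S.:* b 𝔽S.:+ 𝔽S.:- (b 𝔽S.:* a) 𝔽S.:= 𝔽S.con (0 , 0)) refl (ψ₀ j) (ψ₁ j)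

      -- Of the `k' + 1` coefficients at most `k' - 1` survive, one fewer than the minimum length.
      two-zeros : ∀ {i j} → i ≢ j → ∀ c → comb c i ≡ 0F → comb c j ≡ 0F → ∀ l → comb c l ≡ 0F
      two-zeros {i} {j} i≢j c ci cj = short⇒zero Ψ minlen c (omit j (omit i (λ _ → 1))) support
          (ℕP.≤-reflexive (ℕP.suc-injective (sym (trans (sym (sumℕ-1 (suc k')))
            (trans (sumℕ-omit (suc k') i (λ _ → 1)) (cong suc
              (trans (sumℕ-omit (suc k') j (omit i (λ _ → 1))) (cong (ℕ._+ sumℕ (suc k') (omit j (omit i (λ _ → 1)))) (omit-other i (λ _ → 1) (i≢j ∘ sym))))))))))
        where
        support : ∀ l → comb c l ≡ 0F ⊎ 1 ℕ.≤ omit j (omit i (λ _ → 1)) l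
        support l with l FinP.≟ j
        ... | yes refl = inj₁ cj
        ... | no  _ with l FinP.≟ i
        ...   | yes refl = inj₁ ci
        ...   | no  _    = inj₂ ℕP.≤-refl

      independent : ∀ c → (∀ l → comb c l ≡ 0F) → ∀ i → c i ≡ 0F
      independent c e i = toℕ≡0 (full c (λ j → trans (toℕ-∑ 2 c (λ i → Ψ i j)) (trans (cong toℕ (e j)) toℕ-0F)) i)

    -- If the determinant vanished, the combination `cross j` would be zero at `i` and `j`, hence
    -- everywhere, and full rank would make column `j` zero. Then `cross l` is zero at `l` and `j`
    -- for every other `l`, so all columns are zero, against full rank.
    det≢0 : ∀ {i j} → i ≢ j → det i j ≢ 0F
    det≢0 {i} {j} i≢j e = 1≢0 (independent (pair 1F 0F) (λ l → trans (comb-pair 1F 0F l)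
        (trans (cong₂ (λ a b → 1F ⊗ a ⊕ 0F ⊗ b) (proj₁ (column l)) (proj₂ (column l)))
          (𝔽S.solve 0 (𝔽S.con (1 , 0) 𝔽S.:* 𝔽S.con (0 , 0) 𝔽S.:+ 𝔽S.con (0 , 0) 𝔽S.:* 𝔽S.con (0 , 0) 𝔽S.:= 𝔽S.con (0 , 0)) refl))) zero)
      where
      from-cross : ∀ l → (∀ l' → comb (cross l) l' ≡ 0F) → ψ₀ l ≡ 0F × ψ₁ l ≡ 0F
      from-cross l z = trans (𝔽S.solve 1 (λ a → a 𝔽S.:= 𝔽S.:- (𝔽S.:- a)) refl (ψ₀ l))
          (trans (cong ⊖_ (independent (cross l) z (suc zero))) (𝔽S.solve 0 (𝔽S.:- 𝔽S.con (0 , 0) 𝔽S.:= 𝔽S.con (0 , 0)) refl))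
        , independent (cross l) z zero
      column-j : ψ₀ j ≡ 0F × ψ₁ j ≡ 0F
      column-j = from-cross j (two-zeros i≢j (cross j) (trans (comb-cross j i) e) (trans (comb-cross j j) (det-self j)))
      column : ∀ l → ψ₀ l ≡ 0F × ψ₁ l ≡ 0F
      column l with l FinP.≟ j
      ... | yes refl = column-j
      ... | no  l≢j  = from-cross l (two-zeros l≢j (cross l) (trans (comb-cross l l) (det-self l)) (trans (comb-cross l j)
          (trans (cong₂ (λ a b → a ⊗ ψ₁ l ⊕ ⊖ (b ⊗ ψ₀ l)) (proj₁ column-j) (proj₂ column-j))
            (𝔽S.solve 2 (λ a b → 𝔽S.con (0 , 0) 𝔽S.:* a 𝔽S.:+ 𝔽S.:- (𝔽S.con (0 , 0) 𝔽S.:* b) 𝔽S.:= 𝔽S.con (0 , 0)) refl (ψ₁ l) (ψ₀ l)))))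

    Point : Set
    Point = Pt ρ k'

    dim : ℕ
    dim = suc (suc ρ)

    d : Fin (suc k') → 𝔽
    d = det zero

    -- A petal is the image of the columns under the injective linear map taking `v` to
    -- `(v ; det(v_0, v) e_a)`, so it inherits their relations. As `det(v_0, v)` vanishes only on
    -- multiples of `v_0`, different petals share no direction except that of `centre`.
    V : Point → Fin dim → 𝔽
    V none        _             = 0F
    V centre      zero          = ψ₀ zero
    V centre      (suc zero)    = ψ₁ zero
    V centre      (suc (suc b)) = 0F
    V (petal a i) zero          = ψ₀ (suc i)
    V (petal a i) (suc zero)    = ψ₁ (suc i)
    V (petal a i) (suc (suc b)) = d (suc i) ⊗ δ a b

    ev : (Fin dim → 𝔽) → Point → 𝔽
    ev θ P = dot dim θ (V P)

    private
      covector : 𝔽 → 𝔽 → (Fin ρ → 𝔽) → Fin dim → 𝔽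
      covector a b u zero          = a
      covector a b u (suc zero)    = b
      covector a b u (suc (suc c)) = u c

      spread : Point → Fin ρ → 𝔽
      spread none        _ = 0F
      spread centre      _ = 0F
      spread (petal a i) b = d (suc i) ⊗ δ a b

      idx : Point → Fin (suc k')
      idx none        = zero
      idx centre      = zero
      idx (petal a i) = suc i

      ev-covector : ∀ x y u P → P ≢ none → ev (covector x y u) P ≡ (x ⊗ ψ₀ (idx P) ⊕ y ⊗ ψ₁ (idx P)) ⊕ dot ρ u (spread P)
      ev-covector x y u none        n = contradiction refl n
      ev-covector x y u centre      n = sym (⊕-assoc (x ⊗ ψ₀ zero) (y ⊗ ψ₁ zero) (dot ρ u (λ _ → 0F)))
      ev-covector x y u (petal a i) n = sym (⊕-assoc (x ⊗ ψ₀ (suc i)) (y ⊗ ψ₁ (suc i)) (dot ρ u (λ b → d (suc i) ⊗ δ a b)))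

      scaled : ∀ {r} (a b : Fin r) c e → dot r (λ x → e ⊗ δ b x) (λ x → c ⊗ δ a x) ≡ (e ⊗ c) ⊗ δ b a
      scaled {r} a b c e = trans (∑-cong r (λ x → 𝔽S.solve 4 (λ e p c q → (e 𝔽S.:* p) 𝔽S.:* (c 𝔽S.:* q) 𝔽S.:= (e 𝔽S.:* c) 𝔽S.:* (p 𝔽S.:* q)) refl e (δ b x) c (δ a x)))
        (trans (∑-⊗ r (e ⊗ c) _) (cong ((e ⊗ c) ⊗_) (dot-δ r (δ b) a)))

      dot-spread : ∀ b e P → P ≢ none → (∃ λ i → P ≡ petal b i × dot ρ (λ x → e ⊗ δ b x) (spread P) ≡ e ⊗ d (suc i))
        ⊎ ((∀ i → P ≢ petal b i) × dot ρ (λ x → e ⊗ δ b x) (spread P) ≡ 0F)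
      dot-spread b e none   n = contradiction refl n
      dot-spread b e centre n = inj₂ ((λ i ()) , ∑-0 ρ (λ x → ⊗-zeroʳ (e ⊗ δ b x)))
      dot-spread b e (petal a i) n with a FinP.≟ b
      ... | yes refl = inj₁ (i , refl , trans (scaled a a (d (suc i)) e) (trans (cong ((e ⊗ d (suc i)) ⊗_) (δ-same a)) (⊗-identityʳ _)))
      ... | no  a≢b  = inj₂ ((λ j q → a≢b (proj₁ (petal-injective q))) , trans (scaled a b (d (suc i)) e)
          (trans (cong ((e ⊗ d (suc i)) ⊗_) (δ-other a≢b)) (⊗-zeroʳ _)))

      d≢0 : ∀ i → d (suc i) ≢ 0F
      d≢0 i = det≢0 λ ()

      -- Tells one petal from everything else: its coordinate vanishes on all forms outside petal
      -- `b`.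
      probe : Fin ρ → Fin dim → 𝔽
      probe b = covector 0F 0F (λ x → 1F ⊗ δ b x)

      ev-probe : ∀ b P → P ≢ none → (∃ λ i → P ≡ petal b i × ev (probe b) P ≢ 0F) ⊎ ((∀ i → P ≢ petal b i) × ev (probe b) P ≡ 0F)
      ev-probe b P n with dot-spread b 1F P n
      ... | inj₁ (i , eq , val) = inj₁ (i , eq , λ z → d≢0 i (trans (sym (trans (trans (ev-covector 0F 0F _ P n) (cong (_ ⊕_) val))
            (𝔽S.solve 3 (λ a b c → (𝔽S.con (0 , 0) 𝔽S.:* a 𝔽S.:+ 𝔽S.con (0 , 0) 𝔽S.:* b) 𝔽S.:+ 𝔽S.con (1 , 0) 𝔽S.:* c 𝔽S.:= c) refl (ψ₀ (idx P)) (ψ₁ (idx P)) (d (suc i))))) z))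
      ... | inj₂ (ne , val) = inj₂ (ne , trans (trans (ev-covector 0F 0F _ P n) (cong (_ ⊕_) val))
            (𝔽S.solve 2 (λ a b → (𝔽S.con (0 , 0) 𝔽S.:* a 𝔽S.:+ 𝔽S.con (0 , 0) 𝔽S.:* b) 𝔽S.:+ 𝔽S.con (0 , 0) 𝔽S.:= 𝔽S.con (0 , 0)) refl (ψ₀ (idx P)) (ψ₁ (idx P))))

      -- The functional det(v_i, ·) on the first two coordinates, corrected by e on the coordinate of petal b.
      slant : Fin (suc k') → Fin ρ → 𝔽 → Fin dim → 𝔽
      slant i b e = covector (⊖ ψ₁ i) (ψ₀ i) (λ x → e ⊗ δ b x)

      slant-plane : ∀ i j → ((⊖ ψ₁ i) ⊗ ψ₀ j ⊕ ψ₀ i ⊗ ψ₁ j) ≡ det i j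
      slant-plane i j = 𝔽S.solve 4 (λ a b c d → (𝔽S.:- b) 𝔽S.:* c 𝔽S.:+ a 𝔽S.:* d 𝔽S.:= a 𝔽S.:* d 𝔽S.:+ 𝔽S.:- (b 𝔽S.:* c)) refl (ψ₀ i) (ψ₁ i) (ψ₀ j) (ψ₁ j)

      ev-slant-off : ∀ i b e P → P ≢ none → (∀ j → P ≢ petal b j) → ev (slant i b e) P ≡ det i (idx P)
      ev-slant-off i b e P n ne with dot-spread b e P n
      ... | inj₁ (j , eq , _) = contradiction eq (ne j)
      ... | inj₂ (_ , val) = trans (ev-covector _ _ _ P n) (trans (cong (_ ⊕_) val) (trans (⊕-identityʳ _) (slant-plane i (idx P))))

      ev-slant-on : ∀ i b e j → ev (slant i b e) (petal b j) ≡ det i (suc j) ⊕ e ⊗ d (suc j)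
      ev-slant-on i b e j with dot-spread b e (petal b j) (λ ())
      ... | inj₁ (.j , refl , val) = trans (ev-covector _ _ _ (petal b j) (λ ())) (cong₂ _⊕_ (slant-plane i (suc j)) val)
      ... | inj₂ (ne , _) = contradiction refl (ne j)

      -- The case of `slant` without correction: among the forms, it kills exactly those of index
      -- `i`, in whatever petal.
      tilt : Fin (suc k') → Fin dim → 𝔽
      tilt i = covector (⊖ ψ₁ i) (ψ₀ i) (λ _ → 0F)

      ev-tilt : ∀ i P → P ≢ none → ev (tilt i) P ≡ det i (idx P)
      ev-tilt i P n = trans (ev-covector (⊖ ψ₁ i) (ψ₀ i) (λ _ → 0F) P n)
        (trans (cong (((⊖ ψ₁ i) ⊗ ψ₀ (idx P) ⊕ ψ₀ i ⊗ ψ₁ (idx P)) ⊕_) (∑-0 ρ (λ x → ⊗-zeroˡ (spread P x)))) (trans (⊕-identityʳ _) (slant-plane i (idx P))))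

      cancel : ∀ D r c → r ⊗ c ≡ 1F → D ⊕ (⊖ (D ⊗ r)) ⊗ c ≡ 0F
      cancel D r c rc = begin
        D ⊕ (⊖ (D ⊗ r)) ⊗ c  ≡⟨ 𝔽S.solve 3 (λ D r c → D 𝔽S.:+ (𝔽S.:- (D 𝔽S.:* r)) 𝔽S.:* c 𝔽S.:= D 𝔽S.:+ 𝔽S.:- (D 𝔽S.:* (r 𝔽S.:* c))) refl D r c ⟩
        D ⊕ ⊖ (D ⊗ (r ⊗ c))  ≡⟨ cong (λ v → D ⊕ ⊖ (D ⊗ v)) rc ⟩
        D ⊕ ⊖ (D ⊗ 1F)       ≡⟨ 𝔽S.solve 1 (λ D → D 𝔽S.:+ 𝔽S.:- (D 𝔽S.:* 𝔽S.con (1 , 0)) 𝔽S.:= 𝔽S.con (0 , 0)) refl D ⟩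
        0F                   ∎
        where open ≡-Reasoning

    separate₁ : ∀ P → P ≢ none → ∃ λ θ → ev θ P ≢ 0F
    separate₁ none        n = contradiction refl n
    separate₁ centre      n = tilt other , λ z → det≢0 other≢0 (trans (sym (ev-tilt other centre n)) z)
      where
      other : Fin (suc k')
      other = suc (Fin.fromℕ< 0<k')
      other≢0 : other ≢ zero
      other≢0 ()
    separate₁ (petal a i) n with ev-probe a (petal a i) n
    ... | inj₁ (_ , _ , q) = probe a , q
    ... | inj₂ (ne , _)    = contradiction refl (ne i)

    -- Forms of different index are told apart by their first two coordinates, through `tilt`;
    -- distinct forms of equal index lie in different petals and are told apart by `probe`.
    separate₂ : ∀ P Q → P ≢ none → Q ≢ none → P ≢ Q → ∃ λ θ → ev θ P ≡ 0F × ev θ Q ≢ 0F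
    separate₂ P Q nP nQ P≢Q with idx P FinP.≟ idx Q
    ... | no  i≢j = tilt (idx P) , trans (ev-tilt (idx P) P nP) (det-self (idx P)) , λ z → det≢0 i≢j (trans (sym (ev-tilt (idx P) Q nQ)) z)
    separate₂ none        Q           nP nQ P≢Q | yes e = contradiction refl nP
    separate₂ centre      none        nP nQ P≢Q | yes e = contradiction refl nQ
    separate₂ centre      centre      nP nQ P≢Q | yes e = contradiction refl P≢Q
    separate₂ (petal a i) (petal b j) nP nQ P≢Q | yes refl with ev-probe b (petal a i) nP | ev-probe b (petal b j) nQ
    ... | inj₁ (_ , q , _) | _                = contradiction (cong (λ c → petal c i) (proj₁ (petal-injective q))) P≢Q
    ... | inj₂ (_ , z)     | inj₁ (_ , _ , q) = probe b , z , q
    ... | inj₂ _           | inj₂ (ne , _)    = contradiction refl (ne j)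

    private
      Separated : Point → Point → Point → Set
      Separated P Q R = ∃ λ θ → ev θ P ≡ 0F × ev θ Q ≡ 0F × ev θ R ≢ 0F

      -- The correction `e` makes `slant` vanish at `petal b j` as well as at `petal a i`. Outside
      -- petal `b` it is invisible, so the value at `R` is the determinant of two distinct columns.
      slanted : ∀ {a b} i j R → a ≢ b → R ≢ none → (∀ l → R ≢ petal b l) → suc i ≢ idx R → Separated (petal a i) (petal b j) R
      slanted {a} {b} i j R a≢b nR R∉b i≢R with inverse (d (suc j)) (d≢0 j)
      ... | r , rd = slant (suc i) b e
        , trans (ev-slant-off (suc i) b e (petal a i) (λ ()) (λ l q → a≢b (proj₁ (petal-injective q)))) (det-self (suc i))
        , trans (ev-slant-on (suc i) b e j) (cancel (det (suc i) (suc j)) r (d (suc j)) rd)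
        , λ z → det≢0 i≢R (trans (sym (ev-slant-off (suc i) b e R nR R∉b)) z)
        where
        e : 𝔽
        e = ⊖ (det (suc i) (suc j) ⊗ r)

      probed : ∀ {a b} i j c l → c ≢ a → c ≢ b → Separated (petal a i) (petal b j) (petal c l)
      probed {a} {b} i j c l c≢a c≢b with ev-probe c (petal a i) (λ ()) | ev-probe c (petal b j) (λ ()) | ev-probe c (petal c l) (λ ())
      ... | inj₁ (_ , q , _) | _                | _                = contradiction (sym (proj₁ (petal-injective q))) c≢a
      ... | inj₂ _           | inj₁ (_ , q , _) | _                = contradiction (sym (proj₁ (petal-injective q))) c≢b
      ... | inj₂ _           | inj₂ _           | inj₂ (ne , _)    = contradiction refl (ne l)
      ... | inj₂ (_ , z)     | inj₂ (_ , z')    | inj₁ (_ , _ , q) = probe c , z , z' , q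

      swapped : ∀ {P Q R} → Separated P Q R → Separated Q P R
      swapped (θ , zP , zQ , nR) = θ , zQ , zP , nR

      petal-petals : ∀ {a b} i j c l → a ≢ b → petal c l ≢ petal a i → petal c l ≢ petal b j → Dec (c ≡ a) → Dec (c ≡ b) →
        Separated (petal a i) (petal b j) (petal c l)
      petal-petals i j c l a≢b R≢P R≢Q (yes refl) _ = slanted i j (petal c l) a≢b (λ ()) (λ l' q → a≢b (proj₁ (petal-injective q)))
        (λ q → R≢P (cong (petal c) (sym (FinP.suc-injective q))))
      petal-petals {a} i j c l a≢b R≢P R≢Q (no _) (yes refl) = swapped {petal c j} {petal a i} {petal c l}
        (slanted j i (petal c l) (a≢b ∘ sym) (λ ()) (λ l' q → a≢b (sym (proj₁ (petal-injective q))))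
          (λ q → R≢Q (cong (petal c) (sym (FinP.suc-injective q)))))
      petal-petals i j c l a≢b R≢P R≢Q (no c≢a) (no c≢b) = probed i j c l c≢a c≢b

    -- The plane spanned by forms of two different petals contains no third form: a form in a third
    -- petal is detected by its own coordinate, and otherwise the correction of `slanted` is placed
    -- on whichever of the two petals does not contain `R`.
    separate₃ : ∀ {a b} i j R → a ≢ b → R ≢ none → R ≢ petal a i → R ≢ petal b j →
      ∃ λ θ → ev θ (petal a i) ≡ 0F × ev θ (petal b j) ≡ 0F × ev θ R ≢ 0F
    separate₃ i j none   a≢b nR R≢P R≢Q = contradiction refl nR
    separate₃ i j centre a≢b nR R≢P R≢Q = slanted i j centre a≢b nR (λ l ()) (λ ())
    separate₃ {a} {b} i j (petal c l) a≢b nR R≢P R≢Q = petal-petals i j c l a≢b R≢P R≢Q (c FinP.≟ a) (c FinP.≟ b)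

  -- Which assignments contribute

  finite-choice : ∀ t {A : Set} {B : Fin t → Set} → (∀ j → A ⊎ B j) → A ⊎ (∀ j → B j)
  finite-choice zero    f = inj₂ λ ()
  finite-choice (suc t) f with f zero | finite-choice t (f ∘ suc)
  ... | inj₁ a | _      = inj₁ a
  ... | _      | inj₁ a = inj₁ a
  ... | inj₂ b | inj₂ g = inj₂ λ { zero → b ; (suc j) → g j }

  module Classification (p : ℕ) .{{_ : NonZero p}} (prime : Prime p) {k' : ℕ} (Ψ : Matrix p 2 (suc k'))
    (minlen : Lengths.MinLength p Ψ k') (full : FullRank Ψ) (3≤k' : 3 ℕ.≤ k') (ρ : ℕ)
    {m t : ℕ} (Ψ' : Matrix p m t) (minlen' : Lengths.MinLength p Ψ' k') where
    open Field p
    open Inverses prime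
    open LinearAlgebra p prime
    open Averages p prime
    open Lengths p
    open Configuration p prime Ψ minlen full (ℕP.≤-trans (s≤s z≤n) 3≤k') ρ
    open Correlations p prime Ψ' dim

    Assignment : Set
    Assignment = Fin t → Point

    vectors : Assignment → Table {t} {dim}
    vectors α j = V (α j)

    E : Assignment → ℚ
    E α = corr (isPt ∘ α) (vectors α)

    Zₙ : ℚ
    Zₙ = Z Ψ' dim

    Cert : Assignment → Set
    Cert α = Certificate Ψ' (vectors α)

    ev-none : ∀ θ → ev θ none ≡ 0F
    ev-none θ = ∑-0 dim (λ l → ⊗-zeroʳ (θ l))

    -- By `certificate-applied` the products are the coefficients of an equation of `Ψ'`, to which
    -- the length bound applies. Variables carrying `none` are never in its support.
    few-zero : ∀ {α} (C : Cert α) θ g → (∀ j → α j ≢ none → mult C j ⊗ ev θ (α j) ≡ 0F ⊎ 1 ℕ.≤ g j) → sumℕ t g ℕ.< k' →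
      ∀ j → mult C j ⊗ ev θ (α j) ≡ 0F
    few-zero {α} C θ g h short j = trans (sym (certificate-applied Ψ' C θ j)) (short⇒zero Ψ' minlen' (λ i → dot dim θ (coeff C i)) g support short j)
      where
      support : ∀ j → ∑ m (λ i → dot dim θ (coeff C i) ⊗ Ψ' i j) ≡ 0F ⊎ 1 ℕ.≤ g j
      support j with α j ≟ᴾ none
      ... | yes e = inj₁ (trans (certificate-applied Ψ' C θ j) (trans (cong (λ P → mult C j ⊗ ev θ P) e) (trans (cong (mult C j ⊗_) (ev-none θ)) (⊗-zeroʳ _))))
      ... | no  n with h j n
      ...   | inj₁ z = inj₁ (trans (certificate-applied Ψ' C θ j) z)
      ...   | inj₂ l = inj₂ l

    isolate : ∀ α j → ∃ (Isolates Ψ' (vectors α) j) ⊎ ∃ λ (C : Cert α) → mult C j ≡ 1F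
    isolate α j = isolate-or-certify Ψ' (vectors α) j

    -- A certificate with multiplier 1 at `j`, contracted with a covector that does not kill the
    -- form there, would be a nonzero equation on fewer than `k'` variables.
    E-small : ∀ α → 0 ℕ.< N α → N α ℕ.< k' → E α ≡ 0ℚ
    E-small α 0<N N<k' with some α 0<N
    ... | j , αj with isolate α j
    ...   | inj₁ iso = corr-isolated (isPt ∘ α) (vectors α) j (isPt-≢none αj) iso
    ...   | inj₂ (C , one) with separate₁ (α j) αj
    ...     | θ , n = contradiction (trans (sym (trans (cong (_⊗ ev θ (α j)) one) (⊗-identityˡ _)))
                (few-zero C θ (size ∘ α) (λ i αi → inj₂ (ℕP.≤-reflexive (sym (size-≢none αi)))) N<k' j)) n

    module Critical (α : Assignment) (N≡k : N α ≡ suc k') where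

      -- Two vanishing coefficients leave only `k' - 1` of the `k' + 1` active variables, below the
      -- minimum length. From here on, a contradiction only takes a `θ` that kills two coefficients
      -- and spares a third.
      two-zeros : (C : Cert α) → ∀ θ i i' → i ≢ i' → α i ≢ none → α i' ≢ none →
        mult C i ⊗ ev θ (α i) ≡ 0F → mult C i' ⊗ ev θ (α i') ≡ 0F → ∀ j → mult C j ⊗ ev θ (α j) ≡ 0F
      two-zeros C θ i i' i≢i' αi αi' zi zi' = few-zero C θ (omit i' (omit i (size ∘ α))) support
          (ℕP.≤-reflexive (ℕP.suc-injective (trans (sym (N-remove2 α i≢i' αi αi')) N≡k)))
        where
        support : ∀ j → α j ≢ none → mult C j ⊗ ev θ (α j) ≡ 0F ⊎ 1 ℕ.≤ omit i' (omit i (size ∘ α)) j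
        support j αj with j FinP.≟ i'
        ... | yes refl = inj₁ zi'
        ... | no  _ with j FinP.≟ i
        ...   | yes refl = inj₁ zi
        ...   | no  _    = inj₂ (ℕP.≤-reflexive (sym (size-≢none αj)))

      3≤N : 3 ℕ.≤ N α
      3≤N = subst (3 ℕ.≤_) (sym N≡k) (ℕP.m≤n⇒m≤1+n 3≤k')

      Certified : Set
      Certified = ∀ j → α j ≢ none → ∃ λ (C : Cert α) → mult C j ≡ 1F

      vanish-or-certified : E α ≡ 0ℚ ⊎ Certified
      vanish-or-certified = finite-choice t pick
        where
        pick : ∀ j → E α ≡ 0ℚ ⊎ (α j ≢ none → ∃ λ (C : Cert α) → mult C j ≡ 1F)
        pick j with α j ≟ᴾ none
        ... | yes e = inj₂ (λ n → contradiction e n)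
        ... | no  n with isolate α j
        ...   | inj₁ iso = inj₁ (corr-isolated (isPt ∘ α) (vectors α) j (isPt-≢none n) iso)
        ...   | inj₂ c   = inj₂ (λ _ → c)

      InjectiveOn : Set
      InjectiveOn = ∀ i j → α i ≢ none → α i ≡ α j → i ≡ j

      -- A covector that kills the repeated form kills two coefficients at once. If another form
      -- occurred, the covector could be chosen to spare it, against the certificate with multiplier
      -- 1 there.
      repeated⇒constant : Certified → ∀ {i j} → i ≢ j → α i ≢ none → α i ≡ α j → ∀ l → α l ≢ none → α l ≡ α i
      repeated⇒constant cert {i} {j} i≢j αi eq l αl with α l ≟ᴾ α i
      ... | yes e = e
      ... | no  n with cert l αl | separate₂ (α i) (α l) αi αl (n ∘ sym)
      ...   | C , one | θ , zP , nzQ = contradiction (trans (sym (trans (cong (_⊗ ev θ (α l)) one) (⊗-identityˡ _)))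
                (two-zeros C θ i j i≢j αi (αi ∘ trans eq) (zero-at i zP) (zero-at j (trans (cong (ev θ) (sym eq)) zP)) l)) nzQ
        where
        zero-at : ∀ i → ev θ (α i) ≡ 0F → mult C i ⊗ ev θ (α i) ≡ 0F
        zero-at i z = trans (cong (mult C i ⊗_) z) (⊗-zeroʳ _)

      -- A zero multiplier already is one vanishing coefficient. A covector that kills a third form
      -- but not the one at `j` supplies the second; injectivity makes these two forms distinct.
      injective⇒mult≢0 : InjectiveOn → (C : Cert α) → ∀ j → α j ≢ none → mult C j ≢ 0F → ∀ i → α i ≢ none → mult C i ≢ 0F
      injective⇒mult≢0 inj C j αj mj i αi mi≡0 with i FinP.≟ j
      ... | yes refl = mj mi≡0
      ... | no  i≢j with third α 3≤N i j i≢j αi αj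
      ...   | l , αl , l≢i , l≢j with separate₂ (α l) (α j) αl αj (λ e → l≢j (inj l j αl e))
      ...     | θ , zP , nzQ = nzQ (⊗≡0 (two-zeros C θ i l (l≢i ∘ sym) αi αl
                  (trans (cong (_⊗ ev θ (α i)) mi≡0) (⊗-zeroˡ _)) (trans (cong (mult C l ⊗_) zP) (⊗-zeroʳ _)) j) mj)

      -- `corr-hyperplane` asks for solutions that move one form and possibly the pivot. They
      -- isolate that form once the pivot is switched off: if there were none, a certificate of the
      -- reduced assignment would extend to one of `α` with multiplier zero at the pivot and nonzero
      -- at `i`.
      E-injective : InjectiveOn → (ν : Fin t → 𝔽) → (∀ x → Solves Ψ' x → ∑ t (λ j → ν j ⊗ form (vectors α) j x) ≡ 0F) →
        (∀ j → α j ≢ none → ν j ≢ 0F) → E α ≡ w 0F * Zₙ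
      E-injective inj ν rel ν≢0 with some α (ℕP.≤-trans (s≤s z≤n) 3≤N)
      ... | j₁ , αj₁ = corr-hyperplane (isPt ∘ α) (vectors α) j₁ (isPt-≢none αj₁)
          (λ i e l → cong (λ P → V P l) (isPt-false {P = α i} e)) ν rel (λ i e → ν≢0 i (isPt-true e)) moves
        where
        α' : Assignment
        α' i with i FinP.≟ j₁
        ... | yes _ = none
        ... | no  _ = α i
        α'-other : ∀ i → i ≢ j₁ → α' i ≡ α i
        α'-other i n with i FinP.≟ j₁
        ... | yes e = contradiction e n
        ... | no  _ = refl
        extend : (C : Cert α') → ∃ λ (C' : Cert α) → mult C' j₁ ≡ 0F × (∀ i → i ≢ j₁ → mult C' i ≡ mult C i)
        extend C = certificate (coeff C) μ matches , μ₁ , μ-other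
          where
          μ : Fin t → 𝔽
          μ i with i FinP.≟ j₁
          ... | yes _ = 0F
          ... | no  _ = mult C i
          μ₁ : μ j₁ ≡ 0F
          μ₁ with j₁ FinP.≟ j₁
          ... | yes _ = refl
          ... | no  n = contradiction refl n
          μ-other : ∀ i → i ≢ j₁ → μ i ≡ mult C i
          μ-other i n with i FinP.≟ j₁
          ... | yes e = contradiction e n
          ... | no  _ = refl
          matches : ∀ i l → rowCombo Ψ' (coeff C) i l ≡ μ i ⊗ V (α i) l
          matches i l with i FinP.≟ j₁ | match C i l
          ... | yes _ | e = trans e (trans (⊗-zeroʳ (mult C i)) (sym (⊗-zeroˡ (V (α i) l))))
          ... | no  _ | e = e
        moves : ∀ i → isPt (α i) ≡ true → i ≢ j₁ → ∃ λ y → Solves Ψ' y × form (vectors α) i y ≡ 1F ×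
          (∀ i' → i' ≢ i → i' ≢ j₁ → form (vectors α) i' y ≡ 0F)
        moves i e i≢j₁ with isolate α' i
        ... | inj₁ (y , sol , one , zeros) = y , sol , trans (cong (λ P → dot dim (V P) (y i)) (sym (α'-other i i≢j₁))) one ,
                λ i' i'≢i i'≢j₁ → trans (cong (λ P → dot dim (V P) (y i')) (sym (α'-other i' i'≢j₁))) (zeros i' i'≢i)
        ... | inj₂ (C , one) with extend C
        ...   | C' , μ₁ , μ-other = contradiction μ₁ (injective⇒mult≢0 inj C' i (isPt-true e)
                  (λ z → 1≢0 (trans (sym one) (trans (sym (μ-other i i≢j₁)) z))) j₁ αj₁)

      -- Without the centre all forms lie in petals. Two different petals are excluded by
      -- `separate₃` together with a third form, and one petal has only `k'` forms besides the
      -- centre, too few for `k' + 1` variables with distinct forms.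
      injective⇒centre : Certified → InjectiveOn → ∃ λ j → α j ≡ centre
      injective⇒centre cert inj with FinP.any? (λ j → α j ≟ᴾ centre)
      ... | yes r = r
      ... | no  n = contradiction bound (ℕP.<⇒≱ (ℕP.≤-reflexive (sym N≡k)))
        where
        asPetal : ∀ j → α j ≢ none → ∃ λ a → ∃ λ i → α j ≡ petal a i
        asPetal j αj with α j in eq
        ... | none      = contradiction refl αj
        ... | centre    = contradiction (j , eq) n
        ... | petal a i = a , i , refl
        same-petal : ∀ {j j' a b i i'} → α j ≡ petal a i → α j' ≡ petal b i' → a ≡ b
        same-petal {j} {j'} {a} {b} {i} {i'} e e' with a FinP.≟ b
        ... | yes q = q
        ... | no  a≢b with third α 3≤N j j' (λ q → a≢b (proj₁ (petal-injective (trans (sym e) (trans (cong α q) e'))))) αj αj'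
          where
          αj : α j ≢ none
          αj z = contradiction (trans (sym e) z) λ ()
          αj' : α j' ≢ none
          αj' z = contradiction (trans (sym e') z) λ ()
        ...   | l , αl , l≢j , l≢j' with cert l αl | separate₃ i i' (α l) a≢b αl (λ q → l≢j (inj l j αl (trans q (sym e)))) (λ q → l≢j' (inj l j' αl (trans q (sym e'))))
        ...     | C , one | θ , zP , zQ , nzR = contradiction (trans (sym (trans (cong (_⊗ ev θ (α l)) one) (⊗-identityˡ _)))
                    (two-zeros C θ j j' (λ q → a≢b (proj₁ (petal-injective (trans (sym e) (trans (cong α q) e')))))
                      (λ z → contradiction (trans (sym e) z) λ ()) (λ z → contradiction (trans (sym e') z) λ ())
                      (trans (cong (λ P → mult C j ⊗ ev θ P) e) (trans (cong (mult C j ⊗_) zP) (⊗-zeroʳ _)))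
                      (trans (cong (λ P → mult C j' ⊗ ev θ P) e') (trans (cong (mult C j' ⊗_) zQ) (⊗-zeroʳ _))) l)) nzR
        base = some α (ℕP.≤-trans (s≤s z≤n) 3≤N)
        a₀ = proj₁ (asPetal (proj₁ base) (proj₂ base))
        -- Incidences between variables and forms of the petal `a₀`, to be counted in both ways: at
        -- least one per active variable, at most one per form.
        at-a₀ : Fin t → Fin k' → ℕ
        at-a₀ j i with α j ≟ᴾ petal a₀ i
        ... | yes _ = 1
        ... | no  _ = 0
        at-a₀-yes : ∀ {j i} → α j ≡ petal a₀ i → at-a₀ j i ≡ 1
        at-a₀-yes {j} {i} e with α j ≟ᴾ petal a₀ i
        ... | yes _ = refl
        ... | no  q = contradiction e q
        at-a₀-≤1 : ∀ j i → at-a₀ j i ℕ.≤ 1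
        at-a₀-≤1 j i with α j ≟ᴾ petal a₀ i
        ... | yes _ = ℕP.≤-refl
        ... | no  _ = z≤n
        at-a₀-inv : ∀ j i → at-a₀ j i ≢ 0 → α j ≡ petal a₀ i
        at-a₀-inv j i q with α j ≟ᴾ petal a₀ i
        ... | yes e = e
        ... | no  _ = contradiction refl q
        term≤sum : ∀ {s} (f : Fin s → ℕ) i → f i ℕ.≤ sumℕ s f
        term≤sum f i = subst (f i ℕ.≤_) (sym (sumℕ-omit _ i f)) (ℕP.m≤m+n (f i) _)
        covered : ∀ j → size (α j) ℕ.≤ sumℕ k' (at-a₀ j)
        covered j with α j ≟ᴾ none
        ... | yes e = subst (λ P → size P ℕ.≤ sumℕ k' (at-a₀ j)) (sym e) z≤n
        ... | no  αj with asPetal j αj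
        ...   | a , i , e = ℕP.≤-trans (ℕP.≤-reflexive (trans (size-≢none αj)
                  (sym (at-a₀-yes (trans e (cong (λ a → petal a i) (same-petal {j} {proj₁ base} e (proj₂ (proj₂ (asPetal (proj₁ base) (proj₂ base)))))))))))
                  (term≤sum (at-a₀ j) i)
        bound : N α ℕ.≤ k'
        bound = ℕP.≤-trans (sumℕ-mono t covered) (ℕP.≤-trans (ℕP.≤-reflexive (sumℕ-swap t k' at-a₀))
          (ℕP.≤-trans (sumℕ-mono k' (λ i → sumℕ-≤1 t (λ j → at-a₀ j i) (λ j → at-a₀-≤1 j i)
            (λ j j' q q' → inj j j' (λ z → contradiction (trans (sym (at-a₀-inv j i q)) z) λ ()) (trans (at-a₀-inv j i q) (sym (at-a₀-inv j' i q'))))))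
            (ℕP.≤-reflexive (sumℕ-1 k'))))

      -- Of a bijection with a petal only the value and the uniqueness of the centre are retained;
      -- they fix the sign of its contribution.
      trichotomy : E α ≡ 0ℚ ⊎ (∃ λ P → P ≢ none × (∀ j → α j ≢ none → α j ≡ P)) ⊎
        (E α ≡ w 0F * Zₙ × ∃ λ j → α j ≡ centre × (∀ i → i ≢ j → α i ≢ centre))
      trichotomy with vanish-or-certified
      ... | inj₁ z = inj₁ z
      ... | inj₂ cert with FinP.any? (λ i → FinP.any? (λ j → ¬? (i FinP.≟ j) ×-dec (¬? (α i ≟ᴾ none) ×-dec (α i ≟ᴾ α j))))
      ...   | yes (i , j , i≢j , αi , e) = inj₂ (inj₁ (α i , αi , repeated⇒constant cert i≢j αi e))
      ...   | no  none-repeated = inj₂ (inj₂ (value , proj₁ c , proj₂ c , λ i i≢j e →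
                i≢j (inj i (proj₁ c) (λ z → contradiction (trans (sym e) z) λ ()) (trans e (sym (proj₂ c))))))
        where
        inj : InjectiveOn
        inj i j αi e = decidable-stable (i FinP.≟ j) (λ i≢j → none-repeated (i , j , i≢j , αi , e))
        c = injective⇒centre cert inj
        αc : α (proj₁ c) ≢ none
        αc z = contradiction (trans (sym (proj₂ c)) z) λ ()
        C = proj₁ (cert (proj₁ c) αc)
        value : E α ≡ w 0F * Zₙ
        value = E-injective inj (mult C) (certificate-relation Ψ' C)
          (injective⇒mult≢0 inj C (proj₁ c) αc (λ z → 1≢0 (trans (sym (proj₂ (cert (proj₁ c) αc))) z)))

  -- The assignments that fill a petal

  module Petals (p : ℕ) .{{_ : NonZero p}} (prime : Prime p) {k' : ℕ} (Ψ : Matrix p 2 (suc k'))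
    (minlen : Lengths.MinLength p Ψ k') (full : FullRank Ψ) (3≤k' : 3 ℕ.≤ k') (ρ : ℕ)
    {m t : ℕ} (Ψ' : Matrix p m t) (minlen' : Lengths.MinLength p Ψ' k') (contains : Contains Ψ' Ψ) where
    open Field p
    open Inverses prime
    open LinearAlgebra p prime
    open Averages p prime
    open Configuration p prime Ψ minlen full (ℕP.≤-trans (s≤s z≤n) 3≤k') ρ
    open Correlations p prime Ψ' dim
    open Classification p prime Ψ minlen full 3≤k' ρ Ψ' minlen'

    private
      B : Fin (suc k') → Fin t
      B = proj₁ contains
      B-injective : Injective _≡_ _≡_ B
      B-injective = proj₁ (proj₂ contains)

    line : Fin ρ → Fin (suc k') → Point
    line a zero    = centre
    line a (suc i) = petal a i

    line≢none : ∀ a i → line a i ≢ none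
    line≢none a zero    ()
    line≢none a (suc i) ()

    line-injective : ∀ a {i j} → line a i ≡ line a j → i ≡ j
    line-injective a {zero}  {zero}  e = refl
    line-injective a {suc i} {suc j} e = cong suc (proj₂ (petal-injective e))

    -- Places the `a`-th petal on the copy of `Ψ` inside `Ψ'`. Other bijections with the petal may
    -- contribute as well, but these ρ assignments are enough.
    full-petal : Fin ρ → Assignment
    full-petal a j with FinP.any? (λ i → B i FinP.≟ j)
    ... | yes (i , _) = line a i
    ... | no  _       = none

    full-petal-at : ∀ a i → full-petal a (B i) ≡ line a i
    full-petal-at a i with FinP.any? (λ i' → B i' FinP.≟ B i)
    ... | yes (i' , e) = cong (line a) (B-injective e)
    ... | no  n        = contradiction (i , refl) n

    full-petal-support : ∀ a j → (∃ λ i → B i ≡ j × full-petal a j ≡ line a i) ⊎ ((∀ i → B i ≢ j) × full-petal a j ≡ none)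
    full-petal-support a j with FinP.any? (λ i → B i FinP.≟ j)
    ... | yes (i , e) = inj₁ (i , e , refl)
    ... | no  n       = inj₂ ((λ i e → n (i , e)) , refl)

    module _ (a : Fin ρ) where

      private
        hit : Fin (suc k') → Fin t → ℕ
        hit i j with B i FinP.≟ j
        ... | yes _ = 1
        ... | no  _ = 0

        hit-yes : ∀ i → hit i (B i) ≡ 1
        hit-yes i with B i FinP.≟ B i
        ... | yes _ = refl
        ... | no  n = contradiction refl n

        hit-no : ∀ i {j} → B i ≢ j → hit i j ≡ 0
        hit-no i {j} n with B i FinP.≟ j
        ... | yes e = contradiction e n
        ... | no  _ = refl

        size-hits : ∀ j → size (full-petal a j) ≡ sumℕ (suc k') (λ i → hit i j)
        size-hits j with full-petal-support a j
        ... | inj₁ (i , refl , e) = trans (size-≢none (λ z → line≢none a i (trans (sym e) z)))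
              (sym (trans (sumℕ-single (suc k') i (λ i' → hit i' (B i)) (λ i' n → hit-no i' (n ∘ B-injective))) (hit-yes i)))
        ... | inj₂ (n , e) = trans (cong size e) (sym (trans (sumℕ-cong (suc k') (λ i → hit-no i (n i))) (sumℕ-0 (suc k'))))

      full-petal-N : N (full-petal a) ≡ suc k'
      full-petal-N = trans (sumℕ-cong t size-hits) (trans (sumℕ-swap t (suc k') (λ j i → hit i j))
        (trans (sumℕ-cong (suc k') (λ i → trans (sumℕ-single t (B i) (hit i) (λ j n → hit-no i (n ∘ sym))) (hit-yes i))) (sumℕ-1 (suc k'))))

      open Critical (full-petal a) full-petal-N

      full-petal-injective : InjectiveOn
      full-petal-injective i j αi e with full-petal-support a i | full-petal-support a j
      ... | inj₁ (_ , bi , ei) | inj₁ (_ , bj , ej) = trans (sym bi) (trans (cong B (line-injective a (trans (sym ei) (trans e ej)))) bj)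
      ... | inj₁ _             | inj₂ (_ , ej)      = contradiction (trans e ej) αi
      ... | inj₂ (_ , ei)      | _                  = contradiction ei αi

      -- Summed over a petal, the forms are the combination of the two equations of Ψ that defines it.
      line-relation : ∀ (y : Fin (suc k') → Fin dim → 𝔽) → Solves Ψ y → ∑ (suc k') (λ i → dot dim (V (line a i)) (y i)) ≡ 0F
      line-relation y sol = begin
        ∑ (suc k') (λ i → dot dim (V (line a i)) (y i))
          ≡⟨ ∑-cong (suc k') expand ⟩
        ∑ (suc k') (λ i → (row zero i ⊕ row (suc zero) i) ⊕ (ψ₀ zero ⊗ last (suc zero) i ⊕ (⊖ ψ₁ zero) ⊗ last zero i))
          ≡⟨ distribute (suc k') (row zero) (row (suc zero)) (last (suc zero)) (last zero) (ψ₀ zero) (⊖ ψ₁ zero) ⟩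
        (∑ (suc k') (row zero) ⊕ ∑ (suc k') (row (suc zero))) ⊕ (ψ₀ zero ⊗ ∑ (suc k') (last (suc zero)) ⊕ (⊖ ψ₁ zero) ⊗ ∑ (suc k') (last zero))
          ≡⟨ cong₂ _⊕_ (cong₂ _⊕_ (sol zero zero) (sol (suc zero) (suc zero)))
               (cong₂ (λ u v → ψ₀ zero ⊗ u ⊕ (⊖ ψ₁ zero) ⊗ v) (sol (suc zero) (suc (suc a))) (sol zero (suc (suc a)))) ⟩
        (0F ⊕ 0F) ⊕ (ψ₀ zero ⊗ 0F ⊕ (⊖ ψ₁ zero) ⊗ 0F)
          ≡⟨ 𝔽S.solve 2 (λ u v → (𝔽S.con (0 , 0) 𝔽S.:+ 𝔽S.con (0 , 0)) 𝔽S.:+ (u 𝔽S.:* 𝔽S.con (0 , 0) 𝔽S.:+ v 𝔽S.:* 𝔽S.con (0 , 0)) 𝔽S.:= 𝔽S.con (0 , 0)) refl (ψ₀ zero) (⊖ ψ₁ zero) ⟩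
        0F ∎
        where
        open ≡-Reasoning
        distribute : ∀ k (f g h e : Fin k → 𝔽) u v →
          ∑ k (λ i → (f i ⊕ g i) ⊕ (u ⊗ h i ⊕ v ⊗ e i)) ≡ (∑ k f ⊕ ∑ k g) ⊕ (u ⊗ ∑ k h ⊕ v ⊗ ∑ k e)
        distribute k f g h e u v = trans (∑-⊕ k _ _) (cong₂ _⊕_ (∑-⊕ k f g)
          (trans (∑-⊕ k _ _) (cong₂ _⊕_ (∑-⊗ k u h) (∑-⊗ k v e))))
        row last : Fin 2 → Fin (suc k') → 𝔽
        row zero    i = ψ₀ i ⊗ y i zero
        row (suc _) i = ψ₁ i ⊗ y i (suc zero)
        last r i = Ψ r i ⊗ y i (suc (suc a))
        tail-dot : ∀ i → d i ⊗ y i (suc (suc a)) ≡ ψ₀ zero ⊗ last (suc zero) i ⊕ (⊖ ψ₁ zero) ⊗ last zero i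
        tail-dot i = 𝔽S.solve 5 (λ a b c e y → (a 𝔽S.:* e 𝔽S.:+ 𝔽S.:- (b 𝔽S.:* c)) 𝔽S.:* y 𝔽S.:= a 𝔽S.:* (e 𝔽S.:* y) 𝔽S.:+ (𝔽S.:- b) 𝔽S.:* (c 𝔽S.:* y)) refl
          (ψ₀ zero) (ψ₁ zero) (ψ₀ i) (ψ₁ i) (y i (suc (suc a)))
        expand : ∀ i → dot dim (V (line a i)) (y i) ≡ (row zero i ⊕ row (suc zero) i) ⊕ (ψ₀ zero ⊗ last (suc zero) i ⊕ (⊖ ψ₁ zero) ⊗ last zero i)
        expand zero = trans (sym (⊕-assoc (row zero zero) (row (suc zero) zero) _)) (cong ((row zero zero ⊕ row (suc zero) zero) ⊕_)
          (trans (∑-0 ρ (λ b → ⊗-zeroˡ (y zero (suc (suc b)))))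
            (𝔽S.solve 3 (λ a b y → 𝔽S.con (0 , 0) 𝔽S.:= a 𝔽S.:* (b 𝔽S.:* y) 𝔽S.:+ (𝔽S.:- b) 𝔽S.:* (a 𝔽S.:* y)) refl (ψ₀ zero) (ψ₁ zero) (y zero (suc (suc a))))))
        expand (suc i) = trans (sym (⊕-assoc (row zero (suc i)) (row (suc zero) (suc i)) _)) (cong ((row zero (suc i) ⊕ row (suc zero) (suc i)) ⊕_)
          (trans (trans (∑-cong ρ (λ b → 𝔽S.solve 3 (λ c e y → (c 𝔽S.:* e) 𝔽S.:* y 𝔽S.:= c 𝔽S.:* (y 𝔽S.:* e)) refl (d (suc i)) (δ a b) (y (suc i) (suc (suc b)))))
            (trans (∑-⊗ ρ (d (suc i)) _) (cong (d (suc i) ⊗_) (dot-δ ρ (λ b → y (suc i) (suc (suc b))) a)))) (tail-dot (suc i))))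

      full-petal-relation : ∀ x → Solves Ψ' x → ∑ t (λ j → 1F ⊗ form (vectors (full-petal a)) j x) ≡ 0F
      full-petal-relation x sol = begin
        ∑ t (λ j → 1F ⊗ form (vectors (full-petal a)) j x)
          ≡⟨ ∑-cong t (λ j → trans (⊗-identityˡ _) (reindex j)) ⟩
        ∑ t (λ j → ∑ (suc k') (λ i → g i ⊗ δ (B i) j))
          ≡⟨ ∑-swap t (suc k') (λ j i → g i ⊗ δ (B i) j) ⟩
        ∑ (suc k') (λ i → ∑ t (λ j → g i ⊗ δ (B i) j))
          ≡⟨ ∑-cong (suc k') (λ i → dot-δ t (λ _ → g i) (B i)) ⟩
        ∑ (suc k') g
          ≡⟨ line-relation (x ∘ B) (IsSol⇒Solves Ψ {x = λ i → x (B i)} (proj₂ (proj₂ contains) dim x (Solves⇒IsSol Ψ' sol))) ⟩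
        0F ∎
        where
        open ≡-Reasoning
        g : Fin (suc k') → 𝔽
        g i = dot dim (V (line a i)) (x (B i))
        reindex : ∀ j → form (vectors (full-petal a)) j x ≡ ∑ (suc k') (λ i → g i ⊗ δ (B i) j)
        reindex j with full-petal-support a j
        ... | inj₁ (i , refl , e) = trans (cong (λ P → dot dim (V P) (x (B i))) e) (sym (trans
                (∑-single (suc k') i (λ i' → g i' ⊗ δ (B i') (B i)) (λ i' n → trans (cong (g i' ⊗_) (δ-other (λ q → n (B-injective (sym q))))) (⊗-zeroʳ (g i'))))
                (trans (cong (g i ⊗_) (δ-same (B i))) (⊗-identityʳ (g i)))))
        ... | inj₂ (n , e) = trans (cong (λ P → dot dim (V P) (x j)) e) (trans (∑-0 dim (λ l → ⊗-zeroˡ (x j l)))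
                (sym (∑-0 (suc k') (λ i → trans (cong (g i ⊗_) (δ-other (n i ∘ sym))) (⊗-zeroʳ (g i))))))

      -- The relation is explicit here, with all coefficients 1, so the gain from a filled petal is
      -- certain to occur.
      full-petal-E : E (full-petal a) ≡ w 0F * Zₙ
      full-petal-E = E-injective full-petal-injective (λ _ → 1F) full-petal-relation (λ _ _ → 1≢0)

    E-cong : ∀ {α β} → (∀ j → α j ≡ β j) → E α ≡ E β
    E-cong e = sol∑-cong Ψ' dim (λ x _ → prod-cong t (λ j → cong (λ P → factor (isPt P) (dot dim (V P) (x j))) (e j)))

    centre-position : Fin t
    centre-position = B zero

    full-petal-centre : ∀ a → full-petal a centre-position ≡ centre
    full-petal-centre a = full-petal-at a zero

    full-petal-other : ∀ a j → j ≢ centre-position → full-petal a j ≢ centre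
    full-petal-other a j n e with full-petal-support a j
    ... | inj₁ (zero  , b , _) = n (sym b)
    ... | inj₁ (suc i , _ , q) = contradiction (trans (sym e) q) λ ()
    ... | inj₂ (_ , q)         = contradiction (trans (sym e) q) λ ()

    full-petal-distinct : ∀ {a b} → (∀ j → full-petal a j ≡ full-petal b j) → a ≡ b
    full-petal-distinct {a} {b} e = proj₁ (petal-injective (trans (sym (full-petal-at a (suc i)))
        (trans (e (B (suc i))) (full-petal-at b (suc i)))))
      where
      i : Fin k'
      i = Fin.fromℕ< (ℕP.≤-trans (s≤s z≤n) 3≤k')

  -- Powers, parity and sums over the forms

  fromℕ-* : ∀ a b → fromℕ (a ℕ.* b) ≡ fromℕ a * fromℕ b
  fromℕ-* zero    b = sym (*-zeroˡ (fromℕ b))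
  fromℕ-* (suc a) b = trans (fromℕ-+ b (a ℕ.* b)) (trans (cong (fromℕ b +_) (fromℕ-* a b))
    (ℚS.solve 2 (λ a b → b ℚS.:+ a ℚS.:* b ℚS.:= (ℚS.con 1ℚ ℚS.:+ a) ℚS.:* b) refl (fromℕ a) (fromℕ b)))

  prod-fromℕ : ∀ t a → prodFin t (λ _ → fromℕ a) ≡ fromℕ (a ℕ.^ t)
  prod-fromℕ zero    a = sym (+-identityʳ 1ℚ)
  prod-fromℕ (suc t) a = trans (cong (fromℕ a *_) (prod-fromℕ t a)) (sym (fromℕ-* a (a ℕ.^ t)))

  sumPi-term : ∀ {B : Set} (R : B → B → Set) → (∀ {b} → R b b) → (s : SumOver ℚ B) {{_ : Finite s}} →
    (∀ b F → (∀ {a c} → R a c → F a ≡ F c) → (∀ a → 0ℚ ≤ F a) → F b ≤ s F) →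
    ∀ k x F → (∀ {x y} → (∀ i → R (x i) (y i)) → F x ≡ F y) → (∀ x → 0ℚ ≤ F x) → F x ≤ sumPi k s F
  sumPi-term R r s term zero    x F resp nonneg = ≤-reflexive (resp λ ())
  sumPi-term R r s term (suc k) x F resp nonneg = ≤-trans (≤-reflexive (resp λ { zero → r ; (suc i) → r }))
    (≤-trans (sumPi-term R r s term k (x ∘ suc) (λ h → F (x zero ∷ᶠ h)) (λ e → resp λ { zero → r ; (suc i) → e i }) (λ h → nonneg _))
      (term (x zero) (λ b → sumPi k s (λ h → F (b ∷ᶠ h))) (λ e → sum-cong (sumPi k s) (λ h → resp λ { zero → e ; (suc i) → r }))
        (λ b → sum-nonneg (sumPi k s) (λ h → nonneg _))))

  sumFin-term : ∀ k (i : Fin k) {g} → (∀ j → 0ℚ ≤ g j) → g i ≤ sumFin k g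
  sumFin-term (suc k) zero    {g} n = subst (λ z → z ≤ g zero + sumFin k (g ∘ suc)) (+-identityʳ (g zero)) (+-monoʳ-≤ (g zero) (sum-nonneg (sumFin k) (n ∘ suc)))
  sumFin-term (suc k) (suc i) {g} n = subst (λ z → z ≤ g zero + sumFin k (g ∘ suc)) (+-identityˡ (g (suc i))) (+-mono-≤ (n zero) (sumFin-term k i (n ∘ suc)))

  pow : ℚ → ℕ → ℚ
  pow e zero    = 1ℚ
  pow e (suc n) = e * pow e n

  pow-+ : ∀ e a b → pow e (a ℕ.+ b) ≡ pow e a * pow e b
  pow-+ e zero    b = sym (*-identityˡ (pow e b))
  pow-+ e (suc a) b = trans (cong (e *_) (pow-+ e a b)) (sym (*-assoc e (pow e a) (pow e b)))

  pow-sumℕ : ∀ t e (f : Fin t → ℕ) → prodFin t (λ j → pow e (f j)) ≡ pow e (sumℕ t f)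
  pow-sumℕ zero    e f = refl
  pow-sumℕ (suc t) e f = trans (cong (pow e (f zero) *_) (pow-sumℕ t e (f ∘ suc))) (sym (pow-+ e (f zero) (sumℕ t (f ∘ suc))))

  pow-neg-even : ∀ e n → pow (- e) (n ℕ.* 2) ≡ pow e (n ℕ.* 2)
  pow-neg-even e zero    = refl
  pow-neg-even e (suc n) = trans (cong (λ z → - e * (- e * z)) (pow-neg-even e n))
    (ℚS.solve 2 (λ e z → (ℚS.:- e) ℚS.:* ((ℚS.:- e) ℚS.:* z) ℚS.:= e ℚS.:* (e ℚS.:* z)) refl e (pow e (n ℕ.* 2)))

  pow-neg-odd : ∀ e n → pow e (suc (n ℕ.* 2)) + pow (- e) (suc (n ℕ.* 2)) ≡ 0ℚ
  pow-neg-odd e n = trans (cong (λ z → e * pow e (n ℕ.* 2) + - e * z) (pow-neg-even e n))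
    (ℚS.solve 2 (λ e z → e ℚS.:* z ℚS.:+ (ℚS.:- e) ℚS.:* z ℚS.:= ℚS.con 0ℚ) refl e (pow e (n ℕ.* 2)))

  parity : ∀ n → (∃ λ i → n ≡ i ℕ.* 2) ⊎ (∃ λ i → n ≡ suc (i ℕ.* 2))
  parity zero = inj₁ (0 , refl)
  parity (suc n) with parity n
  ... | inj₁ (i , refl) = inj₂ (i , refl)
  ... | inj₂ (i , refl) = inj₁ (suc i , refl)

  even≢odd : ∀ i j → i ℕ.* 2 ≢ suc (j ℕ.* 2)
  even≢odd zero    j ()
  even≢odd (suc i) zero ()
  even≢odd (suc i) (suc j) e = even≢odd i j (ℕP.suc-injective (ℕP.suc-injective e))

  pow-nonneg : ∀ {e} → 0ℚ ≤ e → ∀ n → 0ℚ ≤ pow e n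
  pow-nonneg n zero    = nonNegative⁻¹ 1ℚ
  pow-nonneg n (suc k) = *-nonneg n (pow-nonneg n k)

  pow-positive : ∀ {e} → 0ℚ < e → ∀ n → 0ℚ < pow e n
  pow-positive n zero    = positive⁻¹ 1ℚ
  pow-positive {e} n (suc k) = positive⁻¹ (e * pow e k) {{pos*pos⇒pos e {{positive n}} (pow e k) {{positive (pow-positive n k)}}}}

  pow-antitone : ∀ {e} → 0ℚ ≤ e → e ≤ 1ℚ → ∀ {a b} → a ℕ.≤ b → pow e b ≤ pow e a
  pow-antitone 0≤e e≤1 {b = zero}  z≤n = ≤-refl
  pow-antitone {e} 0≤e e≤1 {b = suc b} z≤n = ≤-trans (*-mono-nonneg 0≤e e≤1 (pow-nonneg 0≤e b) (pow-antitone 0≤e e≤1 {b = b} z≤n)) (≤-reflexive (*-identityˡ 1ℚ))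
  pow-antitone {e} 0≤e e≤1 (s≤s l) = *-monoˡ-≤-nonNeg e {{nonNegative 0≤e}} (pow-antitone 0≤e e≤1 l)

  p≤∣p∣ : ∀ q → q ≤ ∣ q ∣
  p≤∣p∣ q with ≤-total 0ℚ q
  ... | inj₁ 0≤q = ≤-reflexive (sym (0≤p⇒∣p∣≡p 0≤q))
  ... | inj₂ q≤0 = ≤-trans q≤0 (0≤∣p∣ q)

  sumPt : ∀ {ρ k'} → SumOver ℚ (Pt ρ k')
  sumPt {ρ} {k'} h = h none + (h centre + sumFin ρ (λ a → sumFin k' (λ i → h (petal a i))))

  instance
    finite-sumPt : ∀ {ρ k'} → Finite (sumPt {ρ} {k'})
    finite-sumPt {ρ} {k'} = finite (none ∷ centre ∷ concatMap (λ a → map (petal a) (elems {s = sumFin k'})) (elems {s = sumFin ρ}))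
      λ g → cong (λ z → g none + (g centre + z)) (begin
        sumFin ρ (λ a → sumFin k' (λ i → g (petal a i)))
          ≡⟨ sum-cong (sumFin ρ) (λ a → trans (eq {s = sumFin k'} _) (sym (sumL-map (petal a) (elems {s = sumFin k'}) g))) ⟩
        sumFin ρ (λ a → sumL (map (petal a) (elems {s = sumFin k'})) g)
          ≡⟨ eq {s = sumFin ρ} _ ⟩
        sumL (elems {s = sumFin ρ}) (λ a → sumL (map (petal a) (elems {s = sumFin k'})) g)
          ≡⟨ sym (sumL-concatMap _ (elems {s = sumFin ρ}) g) ⟩
        sumL (concatMap (λ a → map (petal a) (elems {s = sumFin k'})) (elems {s = sumFin ρ})) g ∎)
      where open ≡-Reasoning

  [_≡ᴾ_] : ∀ {ρ k'} → Pt ρ k' → Pt ρ k' → ℚ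
  [ P ≡ᴾ Q ] with P ≟ᴾ Q
  ... | yes _ = 1ℚ
  ... | no  _ = 0ℚ

  ≡ᴾ-yes : ∀ {ρ k'} {P Q : Pt ρ k'} → P ≡ Q → [ P ≡ᴾ Q ] ≡ 1ℚ
  ≡ᴾ-yes {P = P} {Q} e with P ≟ᴾ Q
  ... | yes _ = refl
  ... | no  n = contradiction e n

  ≡ᴾ-no : ∀ {ρ k'} {P Q : Pt ρ k'} → P ≢ Q → [ P ≡ᴾ Q ] ≡ 0ℚ
  ≡ᴾ-no {P = P} {Q} n with P ≟ᴾ Q
  ... | yes e = contradiction e n
  ... | no  _ = refl

  ≡ᴾ-nonneg : ∀ {ρ k'} (P Q : Pt ρ k') → 0ℚ ≤ [ P ≡ᴾ Q ]
  ≡ᴾ-nonneg P Q with P ≟ᴾ Q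
  ... | yes _ = nonNegative⁻¹ 1ℚ
  ... | no  _ = ≤-refl

  petals-sum : ∀ {ρ k'} (a : Fin ρ) (i : Fin k') → sumFin ρ (λ b → sumFin k' (λ j → [ petal b j ≡ᴾ petal a i ])) ≡ 1ℚ
  petals-sum {ρ} {k'} a i = trans (sumFin-point ρ a {λ b → sumFin k' (λ j → [ petal b j ≡ᴾ petal a i ])} (λ b n → trans (sum-cong (sumFin k') (λ j → ≡ᴾ-no (n ∘ proj₁ ∘ petal-injective))) (sum-0 (sumFin k'))))
    (trans (sumFin-point k' i {λ j → [ petal a j ≡ᴾ petal a i ]} (λ j n → ≡ᴾ-no {P = petal a j} {petal a i} (n ∘ proj₂ ∘ petal-injective))) (≡ᴾ-yes {P = petal a i} refl))

  sumPt-≡ᴾ : ∀ {ρ k'} (Q : Pt ρ k') → sumPt (λ P → [ P ≡ᴾ Q ]) ≡ 1ℚ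
  sumPt-≡ᴾ {ρ} {k'} none   = cong (λ z → 1ℚ + (0ℚ + z)) (trans (sum-cong (sumFin ρ) (λ a → sum-0 (sumFin k'))) (sum-0 (sumFin ρ)))
  sumPt-≡ᴾ {ρ} {k'} centre = cong (λ z → 0ℚ + (1ℚ + z)) (trans (sum-cong (sumFin ρ) (λ a → sum-0 (sumFin k'))) (sum-0 (sumFin ρ)))
  sumPt-≡ᴾ (petal a i)     = cong (λ z → 0ℚ + (0ℚ + z)) (petals-sum a i)

  -- The bounds below are built from products over the variables, so that their totals over all
  -- assignments are plain powers.
  sumPi-prod-const : ∀ {B : Set} (s : SumOver ℚ B) {{_ : Finite s}} t (h : B → ℚ) {c} → s h ≡ c →
    sumPi t s (λ α → prodFin t (λ j → h (α j))) ≡ prodFin t (λ _ → c)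
  sumPi-prod-const s t h e = trans (sym (prod-sum s t (λ _ → h))) (prod-cong t (λ _ → e))

  -- Weights

  module Weights (p : ℕ) .{{_ : NonZero p}} (prime : Prime p) {k' : ℕ} (Ψ : Matrix p 2 (suc k'))
    (minlen : Lengths.MinLength p Ψ k') (full : FullRank Ψ) (3≤k' : 3 ℕ.≤ k') (ρ : ℕ)
    {m t : ℕ} (Ψ' : Matrix p m t) (minlen' : Lengths.MinLength p Ψ' k') (contains : Contains Ψ' Ψ)
    (half : ℕ) (even : suc k' ≡ half ℕ.* 2) (Y : ℚ) (0≤Y : 0ℚ ≤ Y) where
    open Field p
    open LinearAlgebra p prime
    open Averages p prime
    open Configuration p prime Ψ minlen full (ℕP.≤-trans (s≤s z≤n) 3≤k') ρ
    open Correlations p prime Ψ' dim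
    open Classification p prime Ψ minlen full 3≤k' ρ Ψ' minlen'
    open Petals p prime Ψ minlen full 3≤k' ρ Ψ' minlen' contains

    -- Coefficients of the forms in 1 + g, that is, in `2f` without the powers of ε; `none` stands
    -- for the constant term.
    β : Point → ℚ
    β none        = 1ℚ
    β centre      = - Y
    β (petal _ _) = 1ℚ

    weight : Assignment → ℚ
    weight α = prodFin t (λ j → β (α j))

    τ : Assignment → ℚ
    τ α = weight α * E α

    C : ℚ
    C = prodFin t (λ _ → P)

    0≤P : 0ℚ ≤ P
    0≤P = fromℕ-nonneg p

    0≤C : 0ℚ ≤ C
    0≤C = prod-nonneg t (λ _ → 0≤P)

    0≤Z : 0ℚ ≤ Zₙ
    0≤Z = sum-nonneg (allX Ψ' dim) (λ x → *-nonneg (ind-nonneg Ψ' dim x) (nonNegative⁻¹ 1ℚ))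

    1≤w0 : 1ℚ ≤ w 0F
    1≤w0 = subst (λ z → 1ℚ ≤ P * z - 1ℚ) (sym ([≡0]-yes refl)) (subst (λ z → 1ℚ ≤ z - 1ℚ) (sym (*-identityʳ P))
      (subst (λ z → z ≤ P - 1ℚ) {1ℚ + 1ℚ - 1ℚ} {1ℚ} refl (+-monoˡ-≤ (- 1ℚ) (2≤ (ℕ.nonTrivial⇒n>1 p {{prime⇒nonTrivial prime}})))))
      where
      2≤ : ∀ {n} → 2 ℕ.≤ n → 1ℚ + 1ℚ ≤ fromℕ n
      2≤ {suc (suc n)} _ = +-monoʳ-≤ 1ℚ (subst (λ z → z ≤ 1ℚ + fromℕ n) (+-identityʳ 1ℚ) (+-monoʳ-≤ 1ℚ (fromℕ-nonneg n)))
      2≤ {suc zero} (s≤s ())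

    -- Factors of an indicator: for a form `Q`, the product over the variables is 1 if only `Q` and
    -- `none` are assigned, and 0 otherwise. `onlyCentre` does the same for the centre, with a
    -- factor `Y` for each occurrence.
    only : Point → Point → ℚ
    only Q none          = 1ℚ
    only Q centre        = [ centre ≡ᴾ Q ]
    only Q (petal a i)   = [ petal a i ≡ᴾ Q ]

    onlyCentre : Point → ℚ
    onlyCentre none        = 1ℚ
    onlyCentre centre      = Y
    onlyCentre (petal _ _) = 0ℚ

    only-nonneg : ∀ Q P → 0ℚ ≤ only Q P
    only-nonneg Q none        = nonNegative⁻¹ 1ℚ
    only-nonneg Q centre      = ≡ᴾ-nonneg centre Q
    only-nonneg Q (petal a i) = ≡ᴾ-nonneg (petal a i) Q

    onlyCentre-nonneg : ∀ P → 0ℚ ≤ onlyCentre P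
    onlyCentre-nonneg none        = nonNegative⁻¹ 1ℚ
    onlyCentre-nonneg centre      = 0≤Y
    onlyCentre-nonneg (petal _ _) = ≤-refl

    -- `H` majorises the weights of the constant assignments and `G` counts the filled petals. `H`
    -- takes in assignments of every size: this only enlarges the bound, and makes its total
    -- explicit.
    H-petals H G : Assignment → ℚ
    H-petals α = sumFin ρ (λ a → sumFin k' (λ i → prodFin t (λ j → only (petal a i) (α j))))
    H α = prodFin t (λ j → onlyCentre (α j)) + H-petals α
    G α = sumFin ρ (λ a → prodFin t (λ j → [ α j ≡ᴾ full-petal a j ]))

    U : Assignment → ℚ
    U α = Zₙ * (C * H α - Y * G α)

    H-petals-nonneg : ∀ α → 0ℚ ≤ H-petals α
    H-petals-nonneg α = sum-nonneg (sumFin ρ) (λ a → sum-nonneg (sumFin k') (λ i → prod-nonneg t (λ j → only-nonneg (petal a i) (α j))))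

    H-nonneg : ∀ α → 0ℚ ≤ H α
    H-nonneg α = +-mono-≤ (prod-nonneg t (λ j → onlyCentre-nonneg (α j))) (H-petals-nonneg α)

    ∣-Y∣ : ∣ - Y ∣ ≡ Y
    ∣-Y∣ = trans (∣-p∣≡∣p∣ Y) (0≤p⇒∣p∣≡p 0≤Y)

    weight-constant : ∀ α Q → Q ≢ none → (∀ j → α j ≢ none → α j ≡ Q) → ∣ weight α ∣ ≤ H α
    weight-constant α none        n _ = contradiction refl n
    weight-constant α centre      _ const = ≤-trans (≤-reflexive (trans (prod-abs t _) (prod-cong t same)))
        (subst (λ z → z ≤ H α) (+-identityʳ (prodFin t (λ j → onlyCentre (α j)))) (+-monoʳ-≤ (prodFin t (λ j → onlyCentre (α j))) (H-petals-nonneg α)))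
      where
      on-point : ∀ P → (P ≢ none → P ≡ centre) → ∣ β P ∣ ≡ onlyCentre P
      on-point none        c = refl
      on-point centre      c = ∣-Y∣
      on-point (petal a i) c = contradiction (c λ ()) λ ()
      same : ∀ j → ∣ β (α j) ∣ ≡ onlyCentre (α j)
      same j = on-point (α j) (const j)
    weight-constant α (petal a i) _ const = ≤-trans (≤-reflexive (trans (prod-abs t _) (prod-cong t same)))
        (≤-trans (≤-trans (sumFin-term k' i {λ i → prodFin t (λ j → only (petal a i) (α j))} (λ i → prod-nonneg t (λ j → only-nonneg (petal a i) (α j))))
          (sumFin-term ρ a {λ a → sumFin k' (λ i → prodFin t (λ j → only (petal a i) (α j)))}
            (λ a → sum-nonneg (sumFin k') (λ i → prod-nonneg t (λ j → only-nonneg (petal a i) (α j))))))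
          (subst (λ z → z ≤ H α) (+-identityˡ _) (+-monoˡ-≤ (H-petals α) (prod-nonneg t (λ j → onlyCentre-nonneg (α j))))))
      where
      on-point : ∀ P → (P ≢ none → P ≡ petal a i) → ∣ β P ∣ ≡ only (petal a i) P
      on-point none        c = refl
      on-point centre      c = contradiction (c λ ()) λ ()
      on-point (petal b j) c = sym (≡ᴾ-yes {P = petal b j} {petal a i} (c λ ()))
      same : ∀ j → ∣ β (α j) ∣ ≡ only (petal a i) (α j)
      same j = on-point (α j) (const j)

    weight-one-centre : ∀ α j → α j ≡ centre → (∀ i → i ≢ j → α i ≢ centre) → weight α ≡ - Y
    weight-one-centre α j e others = trans (prod-extract t j _) (trans (cong₂ _*_ (cong β e)
        (trans (prod-cong t rest) (prod-1 t))) (*-identityʳ (- Y)))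
      where
      β-noncentre : ∀ P → P ≢ centre → β P ≡ 1ℚ
      β-noncentre none        n = refl
      β-noncentre centre      n = contradiction refl n
      β-noncentre (petal _ _) n = refl
      rest : ∀ i → mask j (λ i → β (α i)) i ≡ 1ℚ
      rest i with i FinP.≟ j
      ... | yes refl = mask-same j _
      ... | no  n    = trans (mask-other j i _ n) (β-noncentre (α i) (others i n))

    E-bound : ∀ α → ∣ E α ∣ ≤ C * Zₙ
    E-bound α = corr-bound (isPt ∘ α) (vectors α)

    agree : ∀ (α γ : Assignment) → (∀ j → α j ≡ γ j) → prodFin t (λ j → [ α j ≡ᴾ γ j ]) ≡ 1ℚ
    agree α γ e = trans (prod-cong t (λ j → ≡ᴾ-yes (e j))) (prod-1 t)

    disagree : ∀ (α γ : Assignment) → ¬ (∀ j → α j ≡ γ j) → prodFin t (λ j → [ α j ≡ᴾ γ j ]) ≡ 0ℚ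
    disagree α γ n with FinP.any? (λ j → ¬? (α j ≟ᴾ γ j))
    ... | yes (j , q) = prod-zero t j (≡ᴾ-no q)
    ... | no  all     = contradiction (λ j → decidable-stable (α j ≟ᴾ γ j) (λ q → all (j , q))) n

    G-none : ∀ α → (∀ a → ¬ (∀ j → α j ≡ full-petal a j)) → G α ≡ 0ℚ
    G-none α n = trans (sum-cong (sumFin ρ) (λ a → disagree α (full-petal a) (n a))) (sum-0 (sumFin ρ))

    G-one : ∀ α a → (∀ j → α j ≡ full-petal a j) → G α ≡ 1ℚ
    G-one α a e = trans (sumFin-point ρ a {λ a → prodFin t (λ j → [ α j ≡ᴾ full-petal a j ])}
      (λ b n → disagree α (full-petal b) (λ e' → n (full-petal-distinct (λ j → trans (sym (e' j)) (e j))))))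
      (agree α (full-petal a) e)

    U-nonneg : ∀ α → (∀ a → ¬ (∀ j → α j ≡ full-petal a j)) → 0ℚ ≤ U α
    U-nonneg α n = *-nonneg 0≤Z (subst (λ z → 0ℚ ≤ C * H α - z) (sym (trans (cong (Y *_) (G-none α n)) (*-zeroʳ Y)))
      (subst (λ z → 0ℚ ≤ z) (sym (+-identityʳ (C * H α))) (*-nonneg 0≤C (H-nonneg α))))

    -- Only the filled petals are credited with their negative value. Vanishing terms and further
    -- bijections with a petal are at most 0, hence below a nonnegative `U`; constant assignments
    -- are controlled by the crude estimate of `E` by `C * Zₙ`.
    critical-bound : ∀ α → N α ≡ suc k' → τ α ≤ U α
    critical-bound α N≡k with FinP.any? (λ a → FinP.all? (λ j → α j ≟ᴾ full-petal a j))
    ... | yes (a , e) = begin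
        weight α * E α
          ≡⟨ cong₂ _*_ (weight-one-centre α centre-position (trans (e centre-position) (full-petal-centre a))
               (λ i n q → full-petal-other a i n (trans (sym (e i)) q))) (trans (E-cong e) (full-petal-E a)) ⟩
        - Y * (w 0F * Zₙ)
          ≡⟨ ℚS.solve 3 (λ Y w Z → (ℚS.:- Y) ℚS.:* (w ℚS.:* Z) ℚS.:= ℚS.:- ((Y ℚS.:* Z) ℚS.:* w)) refl Y (w 0F) Zₙ ⟩
        - ((Y * Zₙ) * w 0F)
          ≤⟨ neg-antimono-≤ (*-monoˡ-≤-nonNeg (Y * Zₙ) {{nonNegative (*-nonneg 0≤Y 0≤Z)}} 1≤w0) ⟩
        - ((Y * Zₙ) * 1ℚ)
          ≡⟨ ℚS.solve 2 (λ Y Z → ℚS.:- ((Y ℚS.:* Z) ℚS.:* ℚS.con 1ℚ) ℚS.:= Z ℚS.:* (ℚS.con 0ℚ ℚS.:- Y ℚS.:* ℚS.con 1ℚ)) refl Y Zₙ ⟩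
        Zₙ * (0ℚ - Y * 1ℚ)
          ≤⟨ *-monoˡ-≤-nonNeg Zₙ {{nonNegative 0≤Z}} (+-monoˡ-≤ (- (Y * 1ℚ)) (*-nonneg 0≤C (H-nonneg α))) ⟩
        Zₙ * (C * H α - Y * 1ℚ)
          ≡⟨ cong (λ g → Zₙ * (C * H α - Y * g)) (sym (G-one α a e)) ⟩
        U α ∎
      where open ≤-Reasoning
    ... | no  n with Critical.trichotomy α N≡k
    ...   | inj₁ E≡0 = ≤-trans (≤-reflexive (trans (cong (weight α *_) E≡0) (*-zeroʳ (weight α)))) (U-nonneg α (λ a e → n (a , e)))
    ...   | inj₂ (inj₁ (Q , nQ , const)) = begin
        weight α * E α            ≤⟨ p≤∣p∣ (weight α * E α) ⟩
        ∣ weight α * E α ∣        ≡⟨ ∣p*q∣≡∣p∣*∣q∣ (weight α) (E α) ⟩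
        ∣ weight α ∣ * ∣ E α ∣    ≤⟨ *-mono-nonneg (0≤∣p∣ (weight α)) (weight-constant α Q nQ const) (0≤∣p∣ (E α)) (E-bound α) ⟩
        H α * (C * Zₙ)            ≡⟨ ℚS.solve 4 (λ H C Z Y → H ℚS.:* (C ℚS.:* Z) ℚS.:= Z ℚS.:* (C ℚS.:* H ℚS.:- Y ℚS.:* ℚS.con 0ℚ)) refl (H α) C Zₙ Y ⟩
        Zₙ * (C * H α - Y * 0ℚ)   ≡⟨ cong (λ g → Zₙ * (C * H α - Y * g)) (sym (G-none α (λ a e → n (a , e)))) ⟩
        U α                       ∎
      where open ≤-Reasoning
    ...   | inj₂ (inj₂ (E≡ , j , c , others)) = begin
        weight α * E α       ≡⟨ cong₂ _*_ (weight-one-centre α j c others) E≡ ⟩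
        - Y * (w 0F * Zₙ)    ≡⟨ sym (neg-distribˡ-* Y (w 0F * Zₙ)) ⟩
        - (Y * (w 0F * Zₙ))  ≤⟨ neg-antimono-≤ (*-nonneg 0≤Y (*-nonneg w0-nonneg 0≤Z)) ⟩
        0ℚ                   ≤⟨ U-nonneg α (λ a e → n (a , e)) ⟩
        U α                  ∎
      where open ≤-Reasoning

    N-full-petal : ∀ {α} a → (∀ j → α j ≡ full-petal a j) → N α ≡ suc k'
    N-full-petal a e = trans (sumℕ-cong t (λ j → cong size (e j))) (full-petal-N a)

    E-none : ∀ α → (∀ j → α j ≡ none) → E α ≡ Zₙ
    E-none α e = sol∑-cong Ψ' dim (λ x _ → trans (prod-cong t (λ j → cong (λ P → factor (isPt P) (dot dim (V P) (x j))) (e j))) (prod-1 t))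

    noneWeight : Assignment → ℚ
    noneWeight α = prodFin t (λ j → [ α j ≡ᴾ none ])

    module _ (ε : ℚ) (0≤ε : 0ℚ ≤ ε) (ε≤1 : ε ≤ 1ℚ) where

      term : Assignment → ℚ
      term α = (pow ε (N α) + pow (- ε) (N α)) * τ α

      -- One formula for all assignments, so that its three parts can be summed separately: the
      -- empty set, the sets of size k, and the larger ones, where `ε ≤ 1` reduces every power to k
      -- + 1. Each part is nonnegative where it is not the relevant one.
      bound : Assignment → ℚ
      bound α = (1ℚ + 1ℚ) * (Zₙ * noneWeight α) + ((1ℚ + 1ℚ) * (pow ε (suc k') * U α) + (1ℚ + 1ℚ) * (pow ε (suc (suc k')) * ∣ τ α ∣))

      private
        0≤2 : 0ℚ ≤ 1ℚ + 1ℚ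
        0≤2 = nonNegative⁻¹ (1ℚ + 1ℚ)

        first-nonneg : ∀ α → 0ℚ ≤ (1ℚ + 1ℚ) * (Zₙ * noneWeight α)
        first-nonneg α = *-nonneg 0≤2 (*-nonneg 0≤Z (prod-nonneg t (λ j → ≡ᴾ-nonneg (α j) none)))

        last-nonneg : ∀ α → 0ℚ ≤ (1ℚ + 1ℚ) * (pow ε (suc (suc k')) * ∣ τ α ∣)
        last-nonneg α = *-nonneg 0≤2 (*-nonneg (pow-nonneg 0≤ε (suc (suc k'))) (0≤∣p∣ (τ α)))

        off-critical : ∀ α → N α ≢ suc k' → 0ℚ ≤ (1ℚ + 1ℚ) * (pow ε (suc k') * U α)
        off-critical α n = *-nonneg 0≤2 (*-nonneg (pow-nonneg 0≤ε (suc k')) (U-nonneg α (λ a e → n (N-full-petal a e))))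

        bound-nonneg : ∀ α → N α ≢ suc k' → 0ℚ ≤ bound α
        bound-nonneg α n = +-mono-≤ (first-nonneg α) (+-mono-≤ (off-critical α n) (last-nonneg α))

        ≤-middle : ∀ {a b c x} → 0ℚ ≤ a → x ≤ b → 0ℚ ≤ c → x ≤ a + (b + c)
        ≤-middle {a} {b} {c} {x} 0≤a x≤b 0≤c = subst (λ z → z ≤ a + (b + c)) (trans (+-identityˡ (x + 0ℚ)) (+-identityʳ x)) (+-mono-≤ 0≤a (+-mono-≤ x≤b 0≤c))

        ≤-first : ∀ {a b c x} → x ≤ a → 0ℚ ≤ b → 0ℚ ≤ c → x ≤ a + (b + c)
        ≤-first {a} {b} {c} {x} x≤a 0≤b 0≤c = subst (λ z → z ≤ a + (b + c)) (+-identityʳ x) (+-mono-≤ x≤a (+-mono-≤ 0≤b 0≤c))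

        ≤-last : ∀ {a b c x} → 0ℚ ≤ a → 0ℚ ≤ b → x ≤ c → x ≤ a + (b + c)
        ≤-last {a} {b} {c} {x} 0≤a 0≤b x≤c = subst (λ z → z ≤ a + (b + c)) (trans (+-identityˡ (0ℚ + x)) (+-identityˡ x)) (+-mono-≤ 0≤a (+-mono-≤ 0≤b x≤c))

        even-term : ∀ α i → N α ≡ i ℕ.* 2 → term α ≡ (1ℚ + 1ℚ) * (pow ε (N α) * τ α)
        even-term α i e = trans (cong (λ z → (pow ε (N α) + z) * τ α) (trans (cong (pow (- ε)) e) (trans (pow-neg-even ε i) (cong (pow ε) (sym e)))))
          (ℚS.solve 2 (λ a b → (a ℚS.:+ a) ℚS.:* b ℚS.:= (ℚS.con (1ℚ + 1ℚ)) ℚS.:* (a ℚS.:* b)) refl (pow ε (N α)) (τ α))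

        small : ∀ α i → N α ≡ i ℕ.* 2 → N α ℕ.≤ k' → N α ≢ suc k' → term α ≤ bound α
        small α i e N≤k' N≢k with N α ℕP.≟ 0
        ... | yes N≡0 = ≤-first (≤-reflexive (trans (even-term α i e) (cong ((1ℚ + 1ℚ) *_)
                (trans (cong₂ (λ n z → pow ε n * z) N≡0 (cong₂ _*_ (trans (prod-cong t (λ j → cong β (all-none j))) (prod-1 t)) (E-none α all-none)))
                  (trans (ℚS.solve 1 (λ Z → ℚS.con 1ℚ ℚS.:* (ℚS.con 1ℚ ℚS.:* Z) ℚS.:= Z ℚS.:* ℚS.con 1ℚ) refl Zₙ)
                    (cong (Zₙ *_) (sym (agree α (λ _ → none) all-none))))))))
              (off-critical α N≢k) (last-nonneg α)
          where
          all-none : ∀ j → α j ≡ none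
          all-none j = decidable-stable (α j ≟ᴾ none) (λ n → contradiction (ℕP.≤-trans (ℕP.≤-reflexive (sym (size-≢none n)))
            (subst (size (α j) ℕ.≤_) N≡0 (subst (size (α j) ℕ.≤_) (sym (sumℕ-omit t j (size ∘ α))) (ℕP.m≤m+n (size (α j)) _)))) λ ())
        ... | no  N≢0 = subst (λ z → z ≤ bound α) (sym (trans (cong ((pow ε (N α) + pow (- ε) (N α)) *_)
                (trans (cong (weight α *_) (E-small α (ℕP.n≢0⇒n>0 N≢0) (ℕP.≤∧≢⇒< N≤k' N≢k'))) (*-zeroʳ (weight α)))) (*-zeroʳ (pow ε (N α) + pow (- ε) (N α)))))
              (bound-nonneg α N≢k)
          where
          -- `E-small` says nothing about size `k'`, but `k'` is odd and the size is even, so the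
          -- size is already below the minimum length.
          N≢k' : N α ≢ k'
          N≢k' q = even≢odd half i (trans (sym even) (cong suc (trans (sym q) e)))

      term≤bound : ∀ α → term α ≤ bound α
      term≤bound α with parity (N α)
      ... | inj₂ (i , odd) = subst (λ z → z ≤ bound α) (sym (trans (cong (_* τ α)
              (trans (cong (λ n → pow ε n + pow (- ε) n) odd) (pow-neg-odd ε i))) (*-zeroˡ (τ α))))
            (bound-nonneg α (λ q → even≢odd half i (trans (sym even) (trans (sym q) odd))))
      ... | inj₁ (i , e) with ℕP.<-cmp (N α) (suc k')
      ...   | tri< N<k N≢k _ = small α i e (ℕP.≤-pred N<k) N≢k
      ...   | tri≈ _ N≡k _ = ≤-middle (first-nonneg α) (≤-trans (≤-reflexive (trans (even-term α i e) (cong (λ n → (1ℚ + 1ℚ) * (pow ε n * τ α)) N≡k)))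
              (*-monoˡ-≤-nonNeg (1ℚ + 1ℚ) (*-monoˡ-≤-nonNeg (pow ε (suc k')) {{nonNegative (pow-nonneg 0≤ε (suc k'))}} (critical-bound α N≡k))))
              (last-nonneg α)
      ...   | tri> _ N≢k k<N = ≤-last (first-nonneg α) (off-critical α N≢k) (≤-trans (≤-reflexive (even-term α i e))
              (*-monoˡ-≤-nonNeg (1ℚ + 1ℚ) (≤-trans (*-monoˡ-≤-nonNeg (pow ε (N α)) {{nonNegative (pow-nonneg 0≤ε (N α))}} (p≤∣p∣ (τ α)))
                (*-monoʳ-≤-nonNeg ∣ τ α ∣ {{∣-∣-nonNeg (τ α)}} (pow-antitone 0≤ε ε≤1 k<N)))))

    assignments : SumOver ℚ Assignment
    assignments = sumPi t sumPt

    ∑τ : ℚ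
    ∑τ = assignments (λ α → ∣ τ α ∣)

    sum-noneWeight : assignments noneWeight ≡ 1ℚ
    sum-noneWeight = trans (sumPi-prod-const sumPt t (λ P → [ P ≡ᴾ none ]) (sumPt-≡ᴾ {ρ} {k'} none)) (prod-1 t)

    sum-G : assignments G ≡ fromℕ ρ
    sum-G = begin
      assignments G
        ≡⟨ sum-swap assignments (sumFin ρ) (λ α a → prodFin t (λ j → [ α j ≡ᴾ full-petal a j ])) ⟩
      sumFin ρ (λ a → assignments (λ α → prodFin t (λ j → [ α j ≡ᴾ full-petal a j ])))
        ≡⟨ sum-cong (sumFin ρ) (λ a → trans (sym (prod-sum sumPt t (λ j P → [ P ≡ᴾ full-petal a j ])))
             (trans (prod-cong t (λ j → sumPt-≡ᴾ (full-petal a j))) (prod-1 t))) ⟩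
      sumFin ρ (λ _ → 1ℚ)
        ≡⟨ trans (sumFin-const ρ 1ℚ) (*-identityʳ (fromℕ ρ)) ⟩
      fromℕ ρ ∎
      where open ≡-Reasoning

    A₁ A₂ : ℚ
    A₁ = prodFin t (λ _ → 1ℚ + Y)
    A₂ = prodFin t (λ _ → 1ℚ + 1ℚ)

    sum-H : assignments H ≡ A₁ + fromℕ ρ * (fromℕ k' * A₂)
    sum-H = trans (sum-+ assignments _ H-petals) (cong₂ _+_ centres petals)
      where
      open ≡-Reasoning
      centres : assignments (λ α → prodFin t (λ j → onlyCentre (α j))) ≡ A₁
      centres = sumPi-prod-const sumPt t onlyCentre (cong (1ℚ +_) (trans (cong (Y +_)
        (trans (sum-cong (sumFin ρ) (λ a → sum-0 (sumFin k'))) (sum-0 (sumFin ρ)))) (+-identityʳ Y)))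
      petals : assignments H-petals ≡ fromℕ ρ * (fromℕ k' * A₂)
      petals = begin
        assignments H-petals
          ≡⟨ sum-swap assignments (sumFin ρ) (λ α a → sumFin k' (λ i → prodFin t (λ j → only (petal a i) (α j)))) ⟩
        sumFin ρ (λ a → assignments (λ α → sumFin k' (λ i → prodFin t (λ j → only (petal a i) (α j)))))
          ≡⟨ sum-cong (sumFin ρ) (λ a → sum-swap assignments (sumFin k') (λ α i → prodFin t (λ j → only (petal a i) (α j)))) ⟩
        sumFin ρ (λ a → sumFin k' (λ i → assignments (λ α → prodFin t (λ j → only (petal a i) (α j)))))
          ≡⟨ sum-cong (sumFin ρ) (λ a → sum-cong (sumFin k') (λ i → sumPi-prod-const sumPt t (only (petal a i))
               (cong (1ℚ +_) (trans (+-identityˡ _) (petals-sum a i))))) ⟩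
        sumFin ρ (λ a → sumFin k' (λ i → A₂))
          ≡⟨ trans (sum-cong (sumFin ρ) (λ a → sumFin-const k' A₂)) (sumFin-const ρ (fromℕ k' * A₂)) ⟩
        fromℕ ρ * (fromℕ k' * A₂) ∎

    sum-U : assignments U ≡ Zₙ * (C * (A₁ + fromℕ ρ * (fromℕ k' * A₂)) - Y * fromℕ ρ)
    sum-U = begin
      assignments U
        ≡⟨ sum-* assignments Zₙ (λ α → C * H α - Y * G α) ⟩
      Zₙ * assignments (λ α → C * H α - Y * G α)
        ≡⟨ cong (Zₙ *_) (trans (sum-cong assignments (λ α → cong (C * H α +_) (neg-distribˡ-* Y (G α)))) (sum-+ assignments (λ α → C * H α) (λ α → - Y * G α))) ⟩
      Zₙ * (assignments (λ α → C * H α) + assignments (λ α → - Y * G α))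
        ≡⟨ cong₂ (λ a b → Zₙ * (a + b)) (sum-* assignments C H) (sum-* assignments (- Y) G) ⟩
      Zₙ * (C * assignments H + - Y * assignments G)
        ≡⟨ cong₂ (λ a b → Zₙ * (C * a + b)) sum-H (trans (cong (- Y *_) sum-G) (sym (neg-distribˡ-* Y (fromℕ ρ)))) ⟩
      Zₙ * (C * (A₁ + fromℕ ρ * (fromℕ k' * A₂)) - Y * fromℕ ρ) ∎
      where open ≡-Reasoning

    sum-bound : ∀ ε (0≤ε : 0ℚ ≤ ε) (ε≤1 : ε ≤ 1ℚ) → assignments (bound ε 0≤ε ε≤1) ≡
      (1ℚ + 1ℚ) * Zₙ + ((1ℚ + 1ℚ) * (pow ε (suc k') * assignments U) + (1ℚ + 1ℚ) * (pow ε (suc (suc k')) * ∑τ))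
    sum-bound ε 0≤ε ε≤1 = trans (sum-+ assignments _ _) (cong₂ _+_
      (trans (sum-* assignments (1ℚ + 1ℚ) (λ α → Zₙ * noneWeight α)) (cong ((1ℚ + 1ℚ) *_) (trans (sum-* assignments Zₙ noneWeight) (trans (cong (Zₙ *_) sum-noneWeight) (*-identityʳ Zₙ)))))
      (trans (sum-+ assignments _ _) (cong₂ _+_
        (trans (sum-* assignments (1ℚ + 1ℚ) (λ α → pow ε (suc k') * U α)) (cong ((1ℚ + 1ℚ) *_) (sum-* assignments (pow ε (suc k')) U)))
        (trans (sum-* assignments (1ℚ + 1ℚ) (λ α → pow ε (suc (suc k')) * ∣ τ α ∣)) (cong ((1ℚ + 1ℚ) *_) (sum-* assignments (pow ε (suc (suc k'))) (λ α → ∣ τ α ∣)))))))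

  -- Choice of the constants and conclusion

  module Uncommonness (p : ℕ) .{{_ : NonZero p}} (prime : Prime p) {k' : ℕ} (Ψ : Matrix p 2 (suc k'))
    (minlen : Lengths.MinLength p Ψ k') (full : FullRank Ψ) (3≤k' : 3 ℕ.≤ k')
    {m t' : ℕ} (Ψ' : Matrix p m (suc t')) (minlen' : Lengths.MinLength p Ψ' k') (contains : Contains Ψ' Ψ)
    (half : ℕ) (even : suc k' ≡ half ℕ.* 2) where

    -- As rationals these are `C`, `A₂`, `Y = 1 + C k' A₂` and `ρ = 1 + C A₁`. The choice is not
    -- circular, since `A₁ = (1 + Y)^t` does not involve `ρ`, and it gives
    -- `C (A₁ + ρ k' A₂) - Y ρ = C A₁ - ρ = -1`.
    t c a y ρ : ℕ
    t = suc t'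
    c = p ℕ.^ t
    a = 2 ℕ.^ t
    y = suc (c ℕ.* (k' ℕ.* a))
    ρ = suc (c ℕ.* suc y ℕ.^ t)

    Y : ℚ
    Y = fromℕ y

    open Field p
    open LinearAlgebra p prime
    open Averages p prime
    open Configuration p prime Ψ minlen full (ℕP.≤-trans (s≤s z≤n) 3≤k') ρ
    open Correlations p prime Ψ' dim
    open Classification p prime Ψ minlen full 3≤k' ρ Ψ' minlen'
    open Weights p prime Ψ minlen full 3≤k' ρ Ψ' minlen' contains half even Y (fromℕ-nonneg y)

    sum-U≡-Z : assignments U ≡ Zₙ * (- 1ℚ)
    sum-U≡-Z = trans sum-U (cong (Zₙ *_) (begin
      C * (A₁ + fromℕ ρ * (fromℕ k' * A₂)) - Y * fromℕ ρ
        ≡⟨ cong₂ (λ r u → C * (A₁ + r * (fromℕ k' * A₂)) - u * r) ρ≡ Y≡ ⟩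
      C * (A₁ + (1ℚ + C * A₁) * (fromℕ k' * A₂)) - (1ℚ + C * (fromℕ k' * A₂)) * (1ℚ + C * A₁)
        ≡⟨ ℚS.solve 3 (λ C A s → C ℚS.:* (A ℚS.:+ (ℚS.con 1ℚ ℚS.:+ C ℚS.:* A) ℚS.:* s) ℚS.:- (ℚS.con 1ℚ ℚS.:+ C ℚS.:* s) ℚS.:* (ℚS.con 1ℚ ℚS.:+ C ℚS.:* A)
             ℚS.:= ℚS.con (- 1ℚ)) refl C A₁ (fromℕ k' * A₂) ⟩
      - 1ℚ ∎))
      where
      open ≡-Reasoning
      ρ≡ : fromℕ ρ ≡ 1ℚ + C * A₁
      ρ≡ = cong (1ℚ +_) (trans (fromℕ-* c (suc y ℕ.^ t)) (sym (cong₂ _*_ (prod-fromℕ t p) (prod-fromℕ t (suc y)))))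
      Y≡ : Y ≡ 1ℚ + C * (fromℕ k' * A₂)
      Y≡ = cong (1ℚ +_) (trans (fromℕ-* c (k' ℕ.* a)) (trans (cong (fromℕ c *_) (fromℕ-* k' a))
        (sym (cong₂ (λ u v → u * (fromℕ k' * v)) (prod-fromℕ t p) (prod-fromℕ t 2)))))

    W : Point → Vecp p dim → ℚ
    W P v = factor (isPt P) (dot dim (V P) v)

    coefficient : ℚ → Point → ℚ
    coefficient e P = pow e (size P) * β P

    -- This is `2f` with parameter `e`; by `complement`, the parameter `- ε` belongs to `1 - f`, so
    -- both averages have the same expansion up to signs.
    doubled : ℚ → Vecp p dim → ℚ
    doubled e v = sumPt (λ P → coefficient e P * W P v)

    perturbation : Vecp p dim → ℚ
    perturbation v = - Y * W centre v + sumFin ρ (λ b → sumFin k' (λ i → W (petal b i) v))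

    perturbation-bound : ℚ
    perturbation-bound = Y * P + sumFin ρ (λ b → sumFin k' (λ i → P))

    ∣perturbation∣ : ∀ v → ∣ perturbation v ∣ ≤ perturbation-bound
    ∣perturbation∣ v = ≤-trans (∣p+q∣≤∣p∣+∣q∣ (- Y * W centre v) _) (+-mono-≤
      (≤-trans (≤-reflexive (trans (∣p*q∣≡∣p∣*∣q∣ (- Y) (W centre v)) (cong (_* ∣ W centre v ∣) ∣-Y∣)))
        (*-monoˡ-≤-nonNeg Y {{nonNegative (fromℕ-nonneg y)}} (factor-bound true (dot dim (V centre) v))))
      (≤-trans (sum-abs (sumFin ρ) (λ b → sumFin k' (λ i → W (petal b i) v))) (sum-mono (sumFin ρ) (λ b →
        ≤-trans (sum-abs (sumFin k') (λ i → W (petal b i) v)) (sum-mono (sumFin k') (λ i → factor-bound true (dot dim (V (petal b i)) v)))))))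

    perturbation-bound-nonneg : 0ℚ ≤ perturbation-bound
    perturbation-bound-nonneg = +-mono-≤ (*-nonneg (fromℕ-nonneg y) 0≤P) (sum-nonneg (sumFin ρ) (λ b → sum-nonneg (sumFin k') (λ i → 0≤P)))

    doubled-≡ : ∀ e v → doubled e v ≡ 1ℚ + e * perturbation v
    doubled-≡ e v = cong (1ℚ +_) (trans (cong₂ _+_
        (ℚS.solve 3 (λ e u w → ((e ℚS.:* ℚS.con 1ℚ) ℚS.:* u) ℚS.:* w ℚS.:= e ℚS.:* (u ℚS.:* w)) refl e (- Y) (W centre v))
        (trans (sum-cong (sumFin ρ) (λ b → trans (sum-cong (sumFin k') (λ i →
            ℚS.solve 2 (λ e w → ((e ℚS.:* ℚS.con 1ℚ) ℚS.:* ℚS.con 1ℚ) ℚS.:* w ℚS.:= e ℚS.:* w) refl e (W (petal b i) v)))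
          (sum-* (sumFin k') e (λ i → W (petal b i) v)))) (sum-* (sumFin ρ) e (λ b → sumFin k' (λ i → W (petal b i) v)))))
      (sym (*-distribˡ-+ e (- Y * W centre v) _)))

    spectrum : ℚ → ℚ
    spectrum e = assignments (λ α → pow e (N α) * τ α)

    -- After expansion by `prod-sum` the powers of `e` collect to the number of active variables,
    -- and what remains of an assignment is its weight times its correlation.
    weighted : ∀ e → (f : Vecp p dim → ℚ) → (∀ v → f v ≡ ½ * doubled e v) →
      sol∑ Ψ' dim (λ x → prodFin t (λ j → f (x j))) ≡ halfPow {p} t * spectrum e
    weighted e f f≡ = begin
      sol∑ Ψ' dim (λ x → prodFin t (λ j → f (x j)))
        ≡⟨ sol∑-cong Ψ' dim (λ x _ → trans (prod-cong t (λ j → f≡ (x j))) (trans (prod-* t (λ _ → ½) (λ j → doubled e (x j))) (cong (_* prodFin t (λ j → doubled e (x j))) (halves t)))) ⟩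
      sol∑ Ψ' dim (λ x → halfPow {p} t * prodFin t (λ j → doubled e (x j)))
        ≡⟨ sol∑-* Ψ' dim (halfPow {p} t) (λ x → prodFin t (λ j → doubled e (x j))) ⟩
      halfPow {p} t * sol∑ Ψ' dim (λ x → prodFin t (λ j → doubled e (x j)))
        ≡⟨ cong (halfPow {p} t *_) (sol∑-cong Ψ' dim (λ x _ → trans (prod-sum sumPt t (λ j P → coefficient e P * W P (x j)))
             (sum-cong assignments (λ α → trans (prod-* t (λ j → coefficient e (α j)) (λ j → W (α j) (x j)))
               (cong (_* prodFin t (λ j → W (α j) (x j))) (trans (prod-* t (λ j → pow e (size (α j))) (λ j → β (α j)))
                 (cong (_* weight α) (pow-sumℕ t e (size ∘ α))))))))) ⟩
      halfPow {p} t * sol∑ Ψ' dim (λ x → assignments (λ α → (pow e (N α) * weight α) * prodFin t (λ j → W (α j) (x j))))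
        ≡⟨ cong (halfPow {p} t *_) (trans (sol∑-swap Ψ' dim assignments (λ α x → (pow e (N α) * weight α) * prodFin t (λ j → W (α j) (x j))))
             (sum-cong assignments (λ α → trans (sol∑-* Ψ' dim (pow e (N α) * weight α) (λ x → prodFin t (λ j → W (α j) (x j)))) (*-assoc (pow e (N α)) (weight α) (E α))))) ⟩
      halfPow {p} t * spectrum e ∎
      where
      open ≡-Reasoning
      halves : ∀ s → prodFin s (λ _ → ½) ≡ halfPow {p} s
      halves zero    = refl
      halves (suc s) = cong (½ *_) (halves s)

    Z≡numSols : fromℕ (numSols dim Ψ') ≡ Zₙ
    Z≡numSols = trans (sumPi-fromℕ (sumPi dim (sumFinℕ p)) (sumPi dim (sumFin p)) (sumPi-fromℕ (sumFinℕ p) (sumFin p) (sumFin-fromℕ p) dim) t (indℕ Ψ'))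
      (sum-cong (allX Ψ' dim) (λ x → trans (indicators x) (sym (*-identityʳ (ind Ψ' x)))))
      where
      indicators : ∀ (x : X Ψ' dim) → fromℕ (indℕ Ψ' x) ≡ ind Ψ' x
      indicators x with isSol? Ψ' x
      ... | yes _ = refl
      ... | no  _ = refl

    -- The origin is a solution.
    1≤Z : 1ℚ ≤ Zₙ
    1≤Z = ≤-trans (≤-reflexive (sym (trans (*-identityʳ (ind Ψ' origin)) ind-origin)))
      (sumPi-term (λ u v → ∀ l → u l ≡ v l) (λ _ → refl) (sumPi dim (sumFin p))
        (λ v F resp nonneg → sumPi-term _≡_ refl (sumFin p) (λ b G _ nonneg → sumFin-term p b nonneg) dim v F resp nonneg)
        t origin (λ x → ind Ψ' x * 1ℚ)
        (λ e → cong (_* 1ℚ) (ind-Solves Ψ' dim (Solves-cong Ψ' dim e) (Solves-cong Ψ' dim (λ j l → sym (e j l)))))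
        (λ x → *-nonneg (ind-nonneg Ψ' dim x) (nonNegative⁻¹ 1ℚ)))
      where
      origin : X Ψ' dim
      origin _ _ = 0F
      ind-origin : ind Ψ' origin ≡ 1ℚ
      ind-origin with isSol? Ψ' origin
      ... | yes _ = refl
      ... | no  n = contradiction (Solves⇒IsSol Ψ' {x = origin} (λ i l → ∑-0 t (λ j → ⊗-zeroʳ (Ψ' i j)))) n

    0<Z : 0ℚ < Zₙ
    0<Z = <-≤-trans (positive⁻¹ 1ℚ) 1≤Z

    avg-* : ∀ s n → fromℕ n ≡ Zₙ → avg {p} s n * Zₙ ≡ s
    avg-* s zero    e = contradiction (subst (0ℚ <_) (sym e) 0<Z) (<-irrefl refl)
    avg-* s (suc n) e = trans (cong (s * (ℤ.+ 1 / suc n) *_) (sym e)) (trans (*-assoc s (ℤ.+ 1 / suc n) (fromℕ (suc n)))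
      (trans (cong (s *_) (trans (*-comm (ℤ.+ 1 / suc n) (fromℕ (suc n))) (fromℕ-inverse n))) (*-identityʳ s)))

    -- The single choice `ε = 1 / D` meets all requirements: `ε ≤ 1`; `ε` times the bound on the
    -- perturbation is at most 1, so that `f` takes values in [0,1]; and `ε * ∑τ < 1 ≤ Zₙ`, strictly
    -- because of the summand 1.
    D : ℚ
    D = 1ℚ + (perturbation-bound + ∑τ)

    ∑τ-nonneg : 0ℚ ≤ ∑τ
    ∑τ-nonneg = sum-nonneg assignments (λ α → 0≤∣p∣ (τ α))

    0<D : 0ℚ < D
    0<D = +-mono-<-≤ (positive⁻¹ 1ℚ) (+-mono-≤ perturbation-bound-nonneg ∑τ-nonneg)

    private instance
      D-positive : Positive D
      D-positive = positive 0<D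
      D-nonZero : Data.Rational.NonZero D
      D-nonZero = pos⇒nonZero D

    ε : ℚ
    ε = 1/ D

    0<ε : 0ℚ < ε
    0<ε = positive⁻¹ ε {{1/pos⇒pos D}}

    0≤ε : 0ℚ ≤ ε
    0≤ε = <⇒≤ 0<ε

    εD : ε + (ε * perturbation-bound + ε * ∑τ) ≡ 1ℚ
    εD = trans (ℚS.solve 3 (λ e b s → e ℚS.:+ (e ℚS.:* b ℚS.:+ e ℚS.:* s) ℚS.:= e ℚS.:* (ℚS.con 1ℚ ℚS.:+ (b ℚS.:+ s))) refl ε perturbation-bound ∑τ)
      (*-inverseˡ D)

    ε≤1 : ε ≤ 1ℚ
    ε≤1 = subst₂ _≤_ (+-identityʳ ε) εD (+-monoʳ-≤ ε (+-mono-≤ (*-nonneg 0≤ε perturbation-bound-nonneg) (*-nonneg 0≤ε ∑τ-nonneg)))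

    ε-perturbation≤1 : ε * perturbation-bound ≤ 1ℚ
    ε-perturbation≤1 = subst₂ _≤_ (trans (+-identityˡ _) (+-identityʳ (ε * perturbation-bound))) εD
      (+-mono-≤ 0≤ε (+-monoʳ-≤ (ε * perturbation-bound) (*-nonneg 0≤ε ∑τ-nonneg)))

    ε∑τ<Z : ε * ∑τ < Zₙ
    ε∑τ<Z = <-≤-trans (subst₂ _<_ (trans (+-identityˡ (0ℚ + ε * ∑τ)) (+-identityˡ (ε * ∑τ))) εD
      (+-mono-<-≤ 0<ε (+-monoˡ-≤ (ε * ∑τ) (*-nonneg 0≤ε perturbation-bound-nonneg)))) 1≤Z

    density : Vecp p dim → ℚ
    density v = ½ * doubled ε v

    small : ∀ v → ∣ ε * perturbation v ∣ ≤ 1ℚ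
    small v = ≤-trans (≤-reflexive (trans (∣p*q∣≡∣p∣*∣q∣ ε (perturbation v)) (cong (_* ∣ perturbation v ∣) (0≤p⇒∣p∣≡p 0≤ε))))
      (≤-trans (*-monoˡ-≤-nonNeg ε {{nonNegative 0≤ε}} (∣perturbation∣ v)) ε-perturbation≤1)

    -∣p∣≤p : ∀ q → - ∣ q ∣ ≤ q
    -∣p∣≤p q = subst (- ∣ q ∣ ≤_) (neg-involutive q) (neg-antimono-≤ (subst (λ z → - q ≤ z) (∣-p∣≡∣p∣ q) (p≤∣p∣ (- q))))
      where
      neg-involutive : ∀ q → - (- q) ≡ q
      neg-involutive q = ℚS.solve 1 (λ q → ℚS.:- (ℚS.:- q) ℚS.:= q) refl q

    density-range : ∀ v → 0ℚ ≤ density v × density v ≤ 1ℚ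
    density-range v =
        *-nonneg (nonNegative⁻¹ ½) (subst (0ℚ ≤_) (sym (doubled-≡ ε v))
          (+-monoʳ-≤ 1ℚ {x = - 1ℚ} (≤-trans (neg-antimono-≤ (small v)) (-∣p∣≤p (ε * perturbation v)))))
      , *-monoˡ-≤-nonNeg ½ {doubled ε v} {1ℚ + 1ℚ} (subst (_≤ 1ℚ + 1ℚ) (sym (doubled-≡ ε v)) (+-monoʳ-≤ 1ℚ (≤-trans (p≤∣p∣ (ε * perturbation v)) (small v))))

    complement : ∀ v → 1ℚ - density v ≡ ½ * doubled (- ε) v
    complement v = trans (cong (λ z → 1ℚ - ½ * z) (doubled-≡ ε v)) (trans
      (ℚS.solve 2 (λ e r → ℚS.con 1ℚ ℚS.:- ℚS.con ½ ℚS.:* (ℚS.con 1ℚ ℚS.:+ e ℚS.:* r) ℚS.:= ℚS.con ½ ℚS.:* (ℚS.con 1ℚ ℚS.:+ (ℚS.:- e) ℚS.:* r)) refl ε (perturbation v))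
      (cong (½ *_) (sym (doubled-≡ (- ε) v))))

    -- The empty set gives `2 Zₙ`. The bounds for size k add up to `-2 ε^k Zₙ` and those for larger
    -- sizes to `2 ε^(k+1) ∑τ`, and together these are negative because `ε * ∑τ < Zₙ`.
    spectra : spectrum ε + spectrum (- ε) < (1ℚ + 1ℚ) * Zₙ
    spectra = begin-strict
      spectrum ε + spectrum (- ε)
        ≡⟨ sym (trans (sum-cong assignments (λ α → *-distribʳ-+ (τ α) (pow ε (N α)) (pow (- ε) (N α))))
             (sum-+ assignments (λ α → pow ε (N α) * τ α) (λ α → pow (- ε) (N α) * τ α))) ⟩
      assignments (term ε 0≤ε ε≤1)
        ≤⟨ sum-mono assignments (term≤bound ε 0≤ε ε≤1) ⟩
      assignments (bound ε 0≤ε ε≤1)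
        ≡⟨ trans (sum-bound ε 0≤ε ε≤1) (cong (λ u → (1ℚ + 1ℚ) * Zₙ + ((1ℚ + 1ℚ) * (pow ε (suc k') * u) + (1ℚ + 1ℚ) * (pow ε (suc (suc k')) * ∑τ))) sum-U≡-Z) ⟩
      (1ℚ + 1ℚ) * Zₙ + ((1ℚ + 1ℚ) * (pow ε (suc k') * (Zₙ * (- 1ℚ))) + (1ℚ + 1ℚ) * (pow ε (suc (suc k')) * ∑τ))
        ≡⟨ ℚS.solve 5 (λ T Z q e s → T ℚS.:* Z ℚS.:+ (T ℚS.:* (q ℚS.:* (Z ℚS.:* ℚS.con (- 1ℚ))) ℚS.:+ T ℚS.:* ((e ℚS.:* q) ℚS.:* s))
             ℚS.:= T ℚS.:* Z ℚS.:+ (T ℚS.:* q) ℚS.:* (e ℚS.:* s ℚS.:- Z)) refl (1ℚ + 1ℚ) Zₙ (pow ε (suc k')) ε ∑τ ⟩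
      (1ℚ + 1ℚ) * Zₙ + ((1ℚ + 1ℚ) * pow ε (suc k')) * (ε * ∑τ - Zₙ)
        <⟨ +-monoʳ-< ((1ℚ + 1ℚ) * Zₙ) (*-monoʳ-<-pos ((1ℚ + 1ℚ) * pow ε (suc k')) {{pos*pos⇒pos (1ℚ + 1ℚ) (pow ε (suc k')) {{positive (pow-positive 0<ε (suc k'))}}}}
             (subst (ε * ∑τ - Zₙ <_) (+-inverseʳ Zₙ) (+-monoˡ-< (- Zₙ) ε∑τ<Z))) ⟩
      (1ℚ + 1ℚ) * Zₙ + ((1ℚ + 1ℚ) * pow ε (suc k')) * 0ℚ
        ≡⟨ trans (cong ((1ℚ + 1ℚ) * Zₙ +_) (*-zeroʳ ((1ℚ + 1ℚ) * pow ε (suc k')))) (+-identityʳ ((1ℚ + 1ℚ) * Zₙ)) ⟩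
      (1ℚ + 1ℚ) * Zₙ ∎
      where open ≤-Reasoning

    halfPow-positive : ∀ s → 0ℚ < halfPow {p} s
    halfPow-positive zero    = positive⁻¹ 1ℚ
    halfPow-positive (suc s) = positive⁻¹ (½ * halfPow {p} s) {{pos*pos⇒pos ½ (halfPow {p} s) {{positive (halfPow-positive s)}}}}

    -- Multiplying by the number of solutions clears the normalisation of both averages at once.
    uncommon : Uncommon Ψ'
    uncommon = dim , density , density-range , *-cancelʳ-<-nonNeg Zₙ {{nonNegative 0≤Z}} (begin-strict
      (TΨ dim Ψ' density + TΨ dim Ψ' (λ v → 1ℚ - density v)) * Zₙ
        ≡⟨ *-distribʳ-+ Zₙ (TΨ dim Ψ' density) (TΨ dim Ψ' (λ v → 1ℚ - density v)) ⟩
      TΨ dim Ψ' density * Zₙ + TΨ dim Ψ' (λ v → 1ℚ - density v) * Zₙ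
        ≡⟨ cong₂ _+_ (trans (avg-* _ (numSols dim Ψ') Z≡numSols) (weighted ε density (λ _ → refl)))
                     (trans (avg-* _ (numSols dim Ψ') Z≡numSols) (weighted (- ε) (λ v → 1ℚ - density v) complement)) ⟩
      halfPow {p} t * spectrum ε + halfPow {p} t * spectrum (- ε)
        ≡⟨ sym (*-distribˡ-+ (halfPow {p} t) (spectrum ε) (spectrum (- ε))) ⟩
      halfPow {p} t * (spectrum ε + spectrum (- ε))
        <⟨ *-monoʳ-<-pos (halfPow {p} t) {{positive (halfPow-positive t)}} spectra ⟩
      halfPow {p} t * ((1ℚ + 1ℚ) * Zₙ)
        ≡⟨ ℚS.solve 2 (λ h Z → (ℚS.con ½ ℚS.:* h) ℚS.:* (ℚS.con (1ℚ + 1ℚ) ℚS.:* Z) ℚS.:= h ℚS.:* Z) refl (halfPow {p} t') Zₙ ⟩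
      halfPow {p} t' * Zₙ ∎)
      where open ≤-Reasoning

open import Defs
open import Data.Nat using (ℕ; NonZero; _≤_; _+_; _∸_; suc; s≤s)
open import Data.Nat.Primality using (Prime)
open import Data.Nat.Divisibility using (_∣_; divides)
open import Data.Product using (Σ; _,_)

theorem1p2 : Σ ℕ λ P → ∀ (p : ℕ) .{{_ : NonZero p}} → Prime p → P ≤ p →
    ∀ (k : ℕ) → 4 ≤ k → 2 ∣ k →
    ∀ (Ψ : Matrix p 2 k) → IsSystem 2 k Ψ → ShortestEq Ψ (k ∸ 1) →
    ∀ (m t : ℕ) → 2 ≤ m → k ≤ t →
    ∀ (Ψ' : Matrix p m t) → IsSystem m t Ψ' → ShortestEq Ψ' (k ∸ 1) →
    Contains Ψ' Ψ → Uncommon Ψ'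
theorem1p2 = 0 , λ { p isPrime _ (suc k') (s≤s 3≤k') (divides half even) Ψ (full , _) (minlen , _)
  m (suc t') _ _ Ψ' _ (minlen' , _) contains →
    Development.Uncommonness.uncommon p isPrime Ψ minlen full 3≤k' Ψ' minlen' contains half even }
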